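{- Let $K=\sum_{P} q^{\text{area of }P}$, where the sum runs over all level two cheesy polyominoes $P$ (on the hexagonal tiling, counted up to translation). Then, as a formal power series in $q$, $$K=\frac{q\cdot(1-6q+11q^{2}-6q^{3}-q^{4}-3q^{6}+5q^{7}+4q^{8}-3q^{9}-3q^{10})}{1-9q+27q^{2}-31q^{3}+8q^{4}+4q^{5}-2q^{6}+16q^{7}-5q^{8}-16q^{9}-2q^{10}+5q^{11}}.$$
   Context: Consider the regular hexagonal tiling of the Euclidean plane, oriented so that every hexagonal tile has two horizontal edges; tiles are called cells. A (hexagonal-celled) polyomino is a union of finitely many (at least one) cells whose interior is connected (for unions of hexagonal cells, this is equivalent to the union being connected). Two polyominoes are considered equal if and only if one is the image of the other under a translation. The area of a polyomino is its number of cells. The cells of a polyomino $P$ are partitioned according to their horizontal projection (cells with the same projection onto the horizontal axis lie in the same block); each block is a column of $P$. Cells of the tiling with the same horizontal projection are stacked vertically, consecutive ones sharing a horizontal edge. A column need not be a connected set; its connected components are its maximal runs of vertically consecutive cells. If a column has two connected components, the gap (hole) between them is the set of cells of the tiling lying in that vertical stack strictly between the two components. Columns are ordered from left to right; the first column is the leftmost one, and two columns are adjacent if they are consecutive in this order. A polyomino $P$ is rightward-semi-directed if the first (leftmost) column of $P$ has no gap (i.e. is connected) and, in every pair of adjacent columns of $P$, every connected component of the right column has at least one edge in common with the left column. For an integer $m\ge 1$, a polyomino $P$ is a level $m$ cheesy polyomino if: (i) $P$ is rightward-semi-directed; (ii) every column of $P$ has at most two connected components; (iii) if a column of $P$ has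 two connected components, then the gap between the components consists of at most $m$ cells. -}

module Defs where

open import Data.Fin using (Fin)
open import Data.Integer using (ℤ; +_; -_; _+_; _-_; _*_; _≤_; _<_; 0ℤ; 1ℤ)
open import Data.Integer.Properties using (+-identityʳ; +-assoc; +-inverseʳ)
open import Data.List using (List; []; _∷_; foldr; length; map; applyUpTo)
open import Data.List.Membership.Propositional using (_∈_; _∉_)
open import Data.List.Properties using (map-id; map-∘)
  renaming (map-cong to map-≗)
open import Data.List.Relation.Binary.BagAndSetEquality
  using (_∼[_]_; set; [_]-Equality) renaming (map-cong to ∼-map)
open import Data.List.Relation.Unary.Unique.Propositional using (Unique)
open import Data.Nat as ℕ using (ℕ; zero; suc)
open import Data.Product using (Σ; ∃-syntax; _×_; _,_; proj₁; proj₂)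
open import Data.Sum using (_⊎_)
open import Function.Bundles using (Bijection)
open import Level using (0ℓ)
open import Relation.Binary using (Setoid)
open import Relation.Binary.Construct.Closure.ReflexiveTransitive using (Star)
open import Relation.Binary.PropositionalEquality as ≡
  using (_≡_; _≢_; refl; sym; trans; cong₂)

AtMost : {A : Set} → ℕ → (A → Set) → Set
AtMost {A} n P = Σ (List A) λ as → length as ℕ.≤ n × (∀ a → P a → a ∈ as)

-- For hexagons of side 1 with two horizontal edges, the cell (x , y) is
-- the one centred at the point (3x/2 , √3 (y + x/2)).  Thus x is the
-- horizontal projection, y ↦ y + 1 moves one cell up in a vertical
-- stack, and the translations preserving the tiling are those of ℤ × ℤ.

Cell : Set
Cell = ℤ × ℤ

neighbours : Cell → List Cell
neighbours (x , y) =
    (x , y + 1ℤ) ∷ (x , y - 1ℤ)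
  ∷ (x + 1ℤ , y) ∷ (x + 1ℤ , y - 1ℤ)
  ∷ (x - 1ℤ , y) ∷ (x - 1ℤ , y + 1ℤ) ∷ []

ShareEdge : Cell → Cell → Set
ShareEdge c d = d ∈ neighbours c

translate : ℤ × ℤ → Cell → Cell
translate (s , t) (x , y) = x + s , y + t

StepIn : List Cell → Cell → Cell → Set
StepIn cs c d = c ∈ cs × d ∈ cs × ShareEdge c d

record Polyomino : Set where
  field
    cells     : List Cell
    unique    : Unique cells
    nonempty  : cells ≢ []
    connected : ∀ c d → c ∈ cells → d ∈ cells → Star (StepIn cells) c d

open Polyomino public using (cells)

area : Polyomino → ℕ
area P = length (cells P)

infix 4 _≈ₜ_

_≈ₜ_ : Polyomino → Polyomino → Set
P ≈ₜ Q = ∃[ t ] map (translate t) (cells P) ∼[ set ] cells Q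

private
  module SetEq = Setoid ([ set ]-Equality Cell)

  inv : ℤ × ℤ → ℤ × ℤ
  inv (s , t) = - s , - t

  _⊕_ : ℤ × ℤ → ℤ × ℤ → ℤ × ℤ
  (s , t) ⊕ (s′ , t′) = s + s′ , t + t′

  translate-0 : ∀ cs → map (translate (0ℤ , 0ℤ)) cs ≡ cs
  translate-0 cs = trans
    (map-≗
      (λ (x , y) → cong₂ _,_ (+-identityʳ x) (+-identityʳ y)) cs)
    (map-id cs)

  translate-⊕ : ∀ t u cs →
    map (translate u) (map (translate t) cs) ≡ map (translate (t ⊕ u)) cs
  translate-⊕ (s , t) (s′ , t′) cs = trans
    (sym (map-∘ cs))
    (map-≗
      (λ (x , y) → cong₂ _,_ (+-assoc x s s′) (+-assoc y t t′)) cs)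

  translate-inv : ∀ t cs → map (translate (inv t)) (map (translate t) cs) ≡ cs
  translate-inv t@(s₁ , s₂) cs = trans (translate-⊕ t (inv t) cs) (trans
    (≡.cong (λ u → map (translate u) cs) (cong₂ _,_ (+-inverseʳ s₁) (+-inverseʳ s₂)))
    (translate-0 cs))

  image : ∀ t {cs ds} → cs ∼[ set ] ds →
    map (translate t) cs ∼[ set ] map (translate t) ds
  image t = ∼-map (λ _ → refl)

≈ₜ-refl : ∀ {P} → P ≈ₜ P
≈ₜ-refl {P} = (0ℤ , 0ℤ) , SetEq.reflexive (translate-0 (cells P))

≈ₜ-sym : ∀ {P Q} → P ≈ₜ Q → Q ≈ₜ P
≈ₜ-sym {P} {Q} (t , tP∼Q) = inv t , SetEq.trans
  (SetEq.sym (image (inv t) tP∼Q))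
  (SetEq.reflexive (translate-inv t (cells P)))

≈ₜ-trans : ∀ {P Q R} → P ≈ₜ Q → Q ≈ₜ R → P ≈ₜ R
≈ₜ-trans {P} {Q} {R} (t , tP∼Q) (u , uQ∼R) = t ⊕ u , SetEq.trans
  (SetEq.reflexive (sym (translate-⊕ t u (cells P))))
  (SetEq.trans (image u tP∼Q) uQ∼R)

IsColumn : Polyomino → ℤ → Set
IsColumn P x = ∃[ y ] (x , y) ∈ cells P

IsFirstColumn : Polyomino → ℤ → Set
IsFirstColumn P x = IsColumn P x × (∀ x′ → IsColumn P x′ → x ≤ x′)

AdjacentColumns : Polyomino → ℤ → ℤ → Set
AdjacentColumns P x x′ =
  IsColumn P x × IsColumn P x′ × x < x′ ×
  (∀ x″ → IsColumn P x″ → x″ ≤ x ⊎ x′ ≤ x″)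

record Run : Set where
  constructor run
  field
    bottom top : ℤ

open Run public

_∈ᴿ_ : ℤ → Run → Set
y ∈ᴿ C = bottom C ≤ y × y ≤ top C

record IsComponent (P : Polyomino) (x : ℤ) (C : Run) : Set where
  field
    inhabited    : bottom C ≤ top C
    contained    : ∀ y → y ∈ᴿ C → (x , y) ∈ cells P
    maximalBelow : (x , bottom C - 1ℤ) ∉ cells P
    maximalAbove : (x , top C + 1ℤ) ∉ cells P

InGap : ℤ → Run → Run → Cell → Set
InGap x C D (x′ , y) = x′ ≡ x × top C < y × y < bottom D

record RightwardSemiDirected (P : Polyomino) : Set where
  field
    firstConnected : ∀ x → IsFirstColumn P x → AtMost 1 (IsComponent P x)
    attached       : ∀ x x′ → AdjacentColumns P x x′ →
                     ∀ C → IsComponent P x′ C →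
                     ∃[ y ] ∃[ y′ ] (x , y) ∈ cells P × y′ ∈ᴿ C ×
                                    ShareEdge (x , y) (x′ , y′)

record Cheesy (m : ℕ) (P : Polyomino) : Set where
  field
    semiDirected  : RightwardSemiDirected P
    twoComponents : ∀ x → IsColumn P x → AtMost 2 (IsComponent P x)
    smallGap      : ∀ x C D → IsComponent P x C → IsComponent P x D →
                    top C < bottom D → AtMost m (InGap x C D)

CheesyOfArea : ℕ → ℕ → Setoid 0ℓ 0ℓ
CheesyOfArea m n = record
  { Carrier       = Σ Polyomino λ P → Cheesy m P × area P ≡ n
  ; _≈_           = λ P Q → proj₁ P ≈ₜ proj₁ Q
  ; isEquivalence = record
    { refl  = λ {P} → ≈ₜ-refl {proj₁ P}
    ; sym   = λ {P} {Q} → ≈ₜ-sym {proj₁ P} {proj₁ Q}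
    ; trans = λ {P} {Q} {R} → ≈ₜ-trans {proj₁ P} {proj₁ Q} {proj₁ R}
    }
  }

CountsCheesy : ℕ → (ℕ → ℕ) → Set
CountsCheesy m k = ∀ n → Bijection (≡.setoid (Fin (k n))) (CheesyOfArea m n)

PowerSeries : Set
PowerSeries = ℕ → ℤ

infix  4 _≈ₚ_
infixl 7 _⊛_

_≈ₚ_ : PowerSeries → PowerSeries → Set
f ≈ₚ g = ∀ n → f n ≡ g n

_⊛_ : PowerSeries → PowerSeries → PowerSeries
(f ⊛ g) n = foldr _+_ 0ℤ (applyUpTo (λ i → f i * g (n ℕ.∸ i)) (suc n))

-- Constant term first.
poly : List ℤ → PowerSeries
poly []       n       = 0ℤ
poly (a ∷ as) zero    = a
poly (a ∷ as) (suc n) = poly as n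

q : PowerSeries
q = poly (0ℤ ∷ 1ℤ ∷ [])

generatingSeries : (ℕ → ℕ) → PowerSeries
generatingSeries k n = + k n

numerator : PowerSeries
numerator = q ⊛ poly
  ( + 1 ∷ - + 6 ∷ + 11 ∷ - + 6 ∷ - + 1 ∷ + 0 ∷ - + 3 ∷ + 5 ∷ + 4 ∷ - + 3
  ∷ - + 3 ∷ [])

denominator : PowerSeries
denominator = poly
  ( + 1 ∷ - + 9 ∷ + 27 ∷ - + 31 ∷ + 8 ∷ + 4 ∷ - + 2 ∷ + 16 ∷ - + 5 ∷ - + 16
  ∷ - + 2 ∷ + 5 ∷ [])

-- K is the quotient of N by D in ℤ[[q]].  The condition on D makes it a
-- unit, so that the product determines K.
_≐_÷_ : PowerSeries → PowerSeries → PowerSeries → Set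
K ≐ N ÷ D = (D 0 ≡ 1ℤ) × (D ⊛ K ≈ₚ N)

{-# OPTIONS --safe #-}

-- A column is attached to the right of another one in a number of ways that depends only on the two
-- shapes (Counting.placements), and after normalising the position of the first column a cheesy
-- polyomino is the same thing as a chain of successively attached columns.  Building each column one
-- cell at a time gives a recursion for the number of chains that continue a given column.  As a
-- function of the shape of that column, this number is always a linear combination of a few fixed
-- functions; the coefficients, together with their partial sums, form a vector of fourteen integers
-- that is multiplied by a fixed matrix when the area grows by one.  Hence the recurrence expressed
-- by the denominator reduces to the vanishing of one explicit linear form.

module Submission where

open import Defs
open import Data.Nat using (ℕ)
open import Data.Product using (Σ; _×_)

-- The obstacle is the gap of two cells. A cell at height y touches the heights y and y - 1 of the
-- next column, so a single run, or two runs one cell apart, offers an interval of contact heights;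
-- a gap of two cells leaves one height out. A run meeting the hull of the contact heights fails to
-- be attached only if it is a single cell at the missing height, so these corrections concern runs
-- of size one. Hence few functions of the shape suffice: the constant 1, the length `width` of the
-- hull, and indicators of exceptional situations (`holes`, the two rooms, and `slack` for a column
-- too short for a wide gap). The two rooms are mirror images and share a coefficient. The weight of
-- a new column is a number of positions times a number of continuations, both affine in its size up
-- to these corrections. Summing over the size therefore needs moments of `α` up to order one and of
-- `β` up to order two. Increasing n shifts the summation index, and expanding powers of j + 1
-- expresses the new moments by the old ones. This closes the system: five coefficients, eight sums
-- and one delayed value.

-- A sound refutation procedure for linear inequalities over the integers.

module LinearArithmetic where

  open import Data.Bool using (Bool; true; false; T)
  open import Data.Fin using (Fin; zero; suc)
  open import Data.Integer as ℤ using (ℤ; +_; -[1+_]; 0ℤ; 1ℤ; +≤+)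
  import Data.Integer.Properties as ℤ
  open import Data.Integer.Tactic.RingSolver using (solve-∀)
  open import Data.Bool.ListAction using (any)
  open import Data.List as List using (List; []; _∷_; _++_)
  open import Data.List.Relation.Unary.All as All using (All; []; _∷_)
  open import Data.List.Relation.Unary.All.Properties as All using ()
  open import Data.Nat as ℕ using (ℕ; zero; suc; z≤n)
  open import Data.Product using (_×_; _,_; proj₁; proj₂)
  open import Data.Empty using (⊥)
  open import Data.Unit using (tt)
  open import Data.Vec as Vec using (Vec; []; _∷_)
  open import Data.Vec.N-ary using (N-ary; _$ⁿ_)
  open import Relation.Binary.PropositionalEquality
    using (_≡_; refl; sym; trans; cong; cong₂; subst)
  open import Data.Integer using (_+_; _-_; _*_; -_; _≤_; _<_)

  -- The form (c , as) stands for the constraint 0 ≤ c + Σ asᵢ ρᵢ.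

  Form : ℕ → Set
  Form k = ℤ × Vec ℤ k

  dot : ∀ {k} → Vec ℤ k → Vec ℤ k → ℤ
  dot []       []       = 0ℤ
  dot (a ∷ as) (x ∷ xs) = a * x + dot as xs

  eval : ∀ {k} → Form k → Vec ℤ k → ℤ
  eval (c , as) ρ = c + dot as ρ

  Sat : ∀ {k} → Vec ℤ k → List (Form k) → Set
  Sat ρ = All (λ l → 0ℤ ≤ eval l ρ)

  combination : ∀ {k} → ℤ → Form k → ℤ → Form k → Form k
  combination m (c , as) n (d , bs) =
    m * c + n * d , Vec.zipWith (λ a b → m * a + n * b) as bs

  dot-combination : ∀ {k} m (as : Vec ℤ k) n bs ρ →
    dot (Vec.zipWith (λ a b → m * a + n * b) as bs) ρ ≡ m * dot as ρ + n * dot bs ρ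
  dot-combination m []       n []       []      = lemma m n
    where
    lemma : ∀ m n → 0ℤ ≡ m * 0ℤ + n * 0ℤ
    lemma = solve-∀
  dot-combination m (a ∷ as) n (b ∷ bs) (x ∷ ρ) =
    trans (cong (_+_ ((m * a + n * b) * x)) (dot-combination m as n bs ρ))
          (lemma m a n b x (dot as ρ) (dot bs ρ))
    where
    lemma : ∀ m a n b x d e →
      (m * a + n * b) * x + (m * d + n * e) ≡ m * (a * x + d) + n * (b * x + e)
    lemma = solve-∀

  eval-combination : ∀ {k} m (l : Form k) n l′ ρ →
    eval (combination m l n l′) ρ ≡ m * eval l ρ + n * eval l′ ρ
  eval-combination m (c , as) n (d , bs) ρ =
    trans (cong (_+_ (m * c + n * d)) (dot-combination m as n bs ρ))
          (lemma m c n d (dot as ρ) (dot bs ρ))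
    where
    lemma : ∀ m c n d u v → m * c + n * d + (m * u + n * v) ≡ m * (c + u) + n * (d + v)
    lemma = solve-∀

  zeros : ∀ {k} → List (Form (suc k)) → List (Form k)
  zeros []                          = []
  zeros ((c , + zero ∷ as) ∷ ls)    = (c , as) ∷ zeros ls
  zeros ((c , + suc _ ∷ as) ∷ ls)   = zeros ls
  zeros ((c , -[1+ _ ] ∷ as) ∷ ls)  = zeros ls

  -- A leading coefficient of absolute value a + 1 is stored as a, which builds in that it is not
  -- zero.
  positives negatives : ∀ {k} → List (Form (suc k)) → List (ℕ × Form k)
  positives []                         = []
  positives ((c , + zero ∷ as) ∷ ls)   = positives ls
  positives ((c , + suc a ∷ as) ∷ ls)  = (a , c , as) ∷ positives ls
  positives ((c , -[1+ _ ] ∷ as) ∷ ls) = positives ls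
  negatives []                         = []
  negatives ((c , + zero ∷ as) ∷ ls)   = negatives ls
  negatives ((c , + suc a ∷ as) ∷ ls)  = negatives ls
  negatives ((c , -[1+ a ] ∷ as) ∷ ls) = (a , c , as) ∷ negatives ls

  -- Each form is multiplied by the absolute value of the other leading coefficient. The eliminated
  -- variable then cancels, and the multipliers are positive, so nonnegativity is preserved.
  resolve : ∀ {k} → ℕ × Form k → ℕ × Form k → Form k
  resolve (a , l) (b , l′) = combination (+ suc b) l (+ suc a) l′

  resolvents : ∀ {k} → List (ℕ × Form k) → List (ℕ × Form k) → List (Form k)
  resolvents []       ns = []
  resolvents (p ∷ ps) ns = List.map (resolve p) ns ++ resolvents ps ns

  negative : ℤ → Bool
  negative (+ _)    = false
  negative -[1+ _ ] = true

  -- Fourier–Motzkin elimination, one variable after the other.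
  refutes : ∀ k → List (Form k) → Bool
  refutes zero    ls = any (λ l → negative (proj₁ l)) ls
  refutes (suc k) ls = refutes k (zeros ls ++ resolvents (positives ls) (negatives ls))

  private
    UpperSat LowerSat : ∀ {k} → ℤ → Vec ℤ k → ℕ × Form k → Set
    LowerSat x ρ (a , l) = 0ℤ ≤ + suc a * x + eval l ρ
    UpperSat x ρ (a , l) = 0ℤ ≤ -[1+ a ] * x + eval l ρ

  zeros-sat : ∀ {k x} {ρ : Vec ℤ k} ls → Sat (x ∷ ρ) ls → Sat ρ (zeros ls)
  zeros-sat []                         []       = []
  zeros-sat {x = x} {ρ} ((c , + zero ∷ as) ∷ ls) (s ∷ ss) =
    subst (0ℤ ≤_) (lemma c x (dot as ρ)) s ∷ zeros-sat ls ss
    where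
    lemma : ∀ c x d → c + (+ 0 * x + d) ≡ c + d
    lemma = solve-∀
  zeros-sat ((c , + suc _ ∷ as) ∷ ls)  (_ ∷ ss) = zeros-sat ls ss
  zeros-sat ((c , -[1+ _ ] ∷ as) ∷ ls) (_ ∷ ss) = zeros-sat ls ss

  private
    swap : ∀ c u d → c + (u + d) ≡ u + (c + d)
    swap = solve-∀

  positives-sat : ∀ {k x} {ρ : Vec ℤ k} ls → Sat (x ∷ ρ) ls → All (LowerSat x ρ) (positives ls)
  positives-sat []                         []       = []
  positives-sat ((c , + zero ∷ as) ∷ ls)   (_ ∷ ss) = positives-sat ls ss
  positives-sat {x = x} {ρ} ((c , + suc a ∷ as) ∷ ls) (s ∷ ss) =
    subst (0ℤ ≤_) (swap c (+ suc a * x) (dot as ρ)) s ∷ positives-sat ls ss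
  positives-sat ((c , -[1+ _ ] ∷ as) ∷ ls) (_ ∷ ss) = positives-sat ls ss

  negatives-sat : ∀ {k x} {ρ : Vec ℤ k} ls → Sat (x ∷ ρ) ls → All (UpperSat x ρ) (negatives ls)
  negatives-sat []                         []       = []
  negatives-sat ((c , + zero ∷ as) ∷ ls)   (_ ∷ ss) = negatives-sat ls ss
  negatives-sat ((c , + suc _ ∷ as) ∷ ls)  (_ ∷ ss) = negatives-sat ls ss
  negatives-sat {x = x} {ρ} ((c , -[1+ a ] ∷ as) ∷ ls) (s ∷ ss) =
    subst (0ℤ ≤_) (swap c (-[1+ a ] * x) (dot as ρ)) s ∷ negatives-sat ls ss

  resolve-sat : ∀ {k x} {ρ : Vec ℤ k} p n → LowerSat x ρ p → UpperSat x ρ n →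
    0ℤ ≤ eval (resolve p n) ρ
  resolve-sat {x = x} {ρ} (a , l) (b , l′) lo hi =
    subst (0ℤ ≤_)
      (trans (lemma (+ suc a) (+ suc b) x (eval l ρ) (eval l′ ρ))
             (sym (eval-combination (+ suc b) l (+ suc a) l′ ρ)))
      (ℤ.+-mono-≤ (nonneg b lo) (nonneg a hi))
    where
    nonneg : ∀ m {z} → 0ℤ ≤ z → 0ℤ ≤ + suc m * z
    nonneg m (+≤+ _) = subst (0ℤ ≤_) (ℤ.pos-* (suc m) _) (+≤+ z≤n)
    lemma : ∀ a b x u v → b * (a * x + u) + a * ((- b) * x + v) ≡ b * u + a * v
    lemma = solve-∀

  resolvents-sat : ∀ {k x} {ρ : Vec ℤ k} ps ns → All (LowerSat x ρ) ps → All (UpperSat x ρ) ns →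
    Sat ρ (resolvents ps ns)
  resolvents-sat []       ns []       us = []
  resolvents-sat {x = x} (p ∷ ps) ns (l ∷ ls) us =
    All.++⁺ (All.map⁺ (All.map (λ {n} u → resolve-sat {x = x} p n l u) us))
            (resolvents-sat {x = x} ps ns ls us)

  -- A common solution also satisfies every resolvent. It survives the elimination down to
  -- constants, where it contradicts a negative one.
  refutes-sound : ∀ k ls (ρ : Vec ℤ k) → T (refutes k ls) → Sat ρ ls → ⊥
  refutes-sound zero    (( + c , []) ∷ ls)     [] r (_ ∷ ss) = refutes-sound zero ls [] r ss
  refutes-sound zero    (( -[1+ c ] , []) ∷ ls) [] r (() ∷ ss)
  refutes-sound (suc k) ls (x ∷ ρ) r ss = refutes-sound k _ ρ r
    (All.++⁺ (zeros-sat ls ss)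
             (resolvents-sat {x = x} (positives ls) (negatives ls)
               (positives-sat ls ss) (negatives-sat ls ss)))

  -- Reflected expressions, facts and sequents.

  infixl 6 _:+_ _:-_
  infixr 7 _:·_
  infix  4 _:≤_ _:<_ _:≡_
  infix  3 ⊢_
  infixr 2 _⇒_

  data Expr (k : ℕ) : Set where
    var       : Fin k → Expr k
    con       : ℤ → Expr k
    _:+_ _:-_ : Expr k → Expr k → Expr k
    _:·_      : ℤ → Expr k → Expr k

  data Fact (k : ℕ) : Set where
    _:≤_ _:<_ _:≡_ : Expr k → Expr k → Fact k
    false          : Fact k

  data Sequent (k : ℕ) : Set where
    ⊢_  : Fact k → Sequent k
    _⇒_ : Fact k → Sequent k → Sequent k

  ⟦_⟧ᵉ : ∀ {k} → Expr k → Vec ℤ k → ℤ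
  ⟦ var i ⟧ᵉ  ρ = Vec.lookup ρ i
  ⟦ con z ⟧ᵉ  ρ = z
  ⟦ d :+ e ⟧ᵉ ρ = ⟦ d ⟧ᵉ ρ + ⟦ e ⟧ᵉ ρ
  ⟦ d :- e ⟧ᵉ ρ = ⟦ d ⟧ᵉ ρ - ⟦ e ⟧ᵉ ρ
  ⟦ z :· e ⟧ᵉ ρ = z * ⟦ e ⟧ᵉ ρ

  ⟦_⟧ᶠ : ∀ {k} → Fact k → Vec ℤ k → Set
  ⟦ d :≤ e ⟧ᶠ ρ = ⟦ d ⟧ᵉ ρ ≤ ⟦ e ⟧ᵉ ρ
  ⟦ d :< e ⟧ᶠ ρ = ⟦ d ⟧ᵉ ρ < ⟦ e ⟧ᵉ ρ
  ⟦ d :≡ e ⟧ᶠ ρ = ⟦ d ⟧ᵉ ρ ≡ ⟦ e ⟧ᵉ ρ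
  ⟦ false ⟧ᶠ  ρ = ⊥

  ⟦_⟧ˢ : ∀ {k} → Sequent k → Vec ℤ k → Set
  ⟦ ⊢ f ⟧ˢ   ρ = ⟦ f ⟧ᶠ ρ
  ⟦ h ⇒ s ⟧ˢ ρ = ⟦ h ⟧ᶠ ρ → ⟦ s ⟧ˢ ρ

  unit : ∀ {k} → Fin k → Vec ℤ k
  unit zero    = 1ℤ ∷ Vec.replicate _ 0ℤ
  unit (suc i) = 0ℤ ∷ unit i

  form : ∀ {k} → Expr k → Form k
  form (var i)  = 0ℤ , unit i
  form (con z)  = z , Vec.replicate _ 0ℤ
  form (d :+ e) = combination 1ℤ (form d) 1ℤ (form e)
  form (d :- e) = combination 1ℤ (form d) (- 1ℤ) (form e)
  form (z :· e) = combination z (form e) 0ℤ (form e)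

  dot-replicate : ∀ {k} (ρ : Vec ℤ k) → dot (Vec.replicate _ 0ℤ) ρ ≡ 0ℤ
  dot-replicate []      = refl
  dot-replicate (x ∷ ρ) = trans (cong (_+_ (0ℤ * x)) (dot-replicate ρ)) (lemma x)
    where
    lemma : ∀ x → 0ℤ * x + 0ℤ ≡ 0ℤ
    lemma = solve-∀

  dot-unit : ∀ {k} (i : Fin k) ρ → dot (unit i) ρ ≡ Vec.lookup ρ i
  dot-unit zero    (x ∷ ρ) = trans (cong (_+_ (1ℤ * x)) (dot-replicate ρ)) (lemma x)
    where
    lemma : ∀ x → 1ℤ * x + 0ℤ ≡ x
    lemma = solve-∀
  dot-unit (suc i) (x ∷ ρ) = trans (cong (_+_ (0ℤ * x)) (dot-unit i ρ)) (lemma x (Vec.lookup ρ i))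
    where
    lemma : ∀ x y → 0ℤ * x + y ≡ y
    lemma = solve-∀

  eval-form : ∀ {k} (e : Expr k) ρ → eval (form e) ρ ≡ ⟦ e ⟧ᵉ ρ
  eval-form (var i)  ρ = trans (ℤ.+-identityˡ _) (dot-unit i ρ)
  eval-form (con z)  ρ = trans (cong (_+_ (z)) (dot-replicate ρ)) (ℤ.+-identityʳ z)
  eval-form (d :+ e) ρ =
    trans (eval-combination 1ℤ (form d) 1ℤ (form e) ρ)
          (trans (lemma (eval (form d) ρ) (eval (form e) ρ)) (cong₂ _+_ (eval-form d ρ) (eval-form e ρ)))
    where
    lemma : ∀ u v → 1ℤ * u + 1ℤ * v ≡ u + v
    lemma = solve-∀
  eval-form (d :- e) ρ =
    trans (eval-combination 1ℤ (form d) (- 1ℤ) (form e) ρ)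
          (trans (lemma (eval (form d) ρ) (eval (form e) ρ)) (cong₂ _-_ (eval-form d ρ) (eval-form e ρ)))
    where
    lemma : ∀ u v → 1ℤ * u + (- 1ℤ) * v ≡ u - v
    lemma = solve-∀
  eval-form (z :· e) ρ =
    trans (eval-combination z (form e) 0ℤ (form e) ρ)
          (trans (lemma z (eval (form e) ρ)) (cong (z *_) (eval-form e ρ)))
    where
    lemma : ∀ z u → z * u + 0ℤ * u ≡ z * u
    lemma = solve-∀

  -- Integrality enters here: d < e becomes 0 ≤ e - d - 1, which over the rationals would be
  -- stronger than the strict inequality.
  ≤-expr <-expr : ∀ {k} → Expr k → Expr k → Expr k
  ≤-expr d e = e :- d
  <-expr d e = e :- d :- con 1ℤ

  ≤-holds : ∀ {k} (d e : Expr k) ρ → ⟦ d :≤ e ⟧ᶠ ρ → 0ℤ ≤ eval (form (≤-expr d e)) ρ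
  ≤-holds d e ρ p = subst (0ℤ ≤_) (sym (eval-form (≤-expr d e) ρ)) (ℤ.i≤j⇒0≤j-i p)

  <-holds : ∀ {k} (d e : Expr k) ρ → ⟦ d :< e ⟧ᶠ ρ → 0ℤ ≤ eval (form (<-expr d e)) ρ
  <-holds d e ρ p = subst (0ℤ ≤_)
    (trans (lemma (⟦ d ⟧ᵉ ρ) (⟦ e ⟧ᵉ ρ)) (sym (eval-form (<-expr d e) ρ)))
    (ℤ.i≤j⇒0≤j-i (ℤ.i<j⇒suc[i]≤j p))
    where
    lemma : ∀ u v → v - (1ℤ + u) ≡ v - u - 1ℤ
    lemma = solve-∀

  constraints : ∀ {k} → Fact k → List (Expr k)
  constraints (d :≤ e) = ≤-expr d e ∷ []
  constraints (d :< e) = <-expr d e ∷ []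
  constraints (d :≡ e) = ≤-expr d e ∷ ≤-expr e d ∷ []
  constraints false    = []

  constraints-hold : ∀ {k} (f : Fact k) ρ → ⟦ f ⟧ᶠ ρ → Sat ρ (List.map form (constraints f))
  constraints-hold (d :≤ e) ρ p = ≤-holds d e ρ p ∷ []
  constraints-hold (d :< e) ρ p = <-holds d e ρ p ∷ []
  constraints-hold (d :≡ e) ρ p =
    ≤-holds d e ρ (ℤ.≤-reflexive p) ∷ ≤-holds e d ρ (ℤ.≤-reflexive (sym p)) ∷ []
  constraints-hold false    ρ ()

  -- Proof by contradiction: the negated goal joins the hypotheses. The negation of an equation is a
  -- disjunction, hence the two refutations.
  proves : ∀ {k} → List (Form k) → Fact k → Bool
  proves ls (d :≤ e) = refutes _ (form (<-expr e d) ∷ ls)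
  proves ls (d :< e) = refutes _ (form (≤-expr e d) ∷ ls)
  proves ls (d :≡ e) = refutes _ (form (<-expr e d) ∷ ls) ∧ refutes _ (form (<-expr d e) ∷ ls)
    where open import Data.Bool using (_∧_)
  proves ls false    = refutes _ ls

  proves-≤ : ∀ {k} ls (d e : Expr k) ρ → T (refutes _ (form (<-expr e d) ∷ ls)) →
    Sat ρ ls → ⟦ d :≤ e ⟧ᶠ ρ
  proves-≤ ls d e ρ r ss =
    ℤ.≮⇒≥ λ e<d → refutes-sound _ _ ρ r (<-holds e d ρ e<d ∷ ss)

  proves-sound : ∀ {k} ls (f : Fact k) ρ → T (proves ls f) → Sat ρ ls → ⟦ f ⟧ᶠ ρ
  proves-sound ls (d :≤ e) ρ r ss = proves-≤ ls d e ρ r ss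
  proves-sound ls (d :< e) ρ r ss =
    ℤ.≰⇒> λ e≤d → refutes-sound _ _ ρ r (≤-holds e d ρ e≤d ∷ ss)
  proves-sound ls (d :≡ e) ρ r ss
    with refutes _ (form (<-expr e d) ∷ ls) in eq | refutes _ (form (<-expr d e) ∷ ls) in eq′
  ... | true | true = ℤ.≤-antisym
    (proves-≤ ls d e ρ (subst T (sym eq) tt) ss) (proves-≤ ls e d ρ (subst T (sym eq′) tt) ss)
  proves-sound ls false ρ r ss = refutes-sound _ ls ρ r ss

  valid : ∀ {k} → List (Form k) → Sequent k → Bool
  valid ls (⊢ f)   = proves ls f
  valid ls (h ⇒ s) = valid (List.map form (constraints h) ++ ls) s

  valid-sound : ∀ {k} ls s (ρ : Vec ℤ k) → T (valid ls s) → Sat ρ ls → ⟦ s ⟧ˢ ρ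
  valid-sound ls (⊢ f)   ρ r ss   = proves-sound ls f ρ r ss
  valid-sound ls (h ⇒ s) ρ r ss p =
    valid-sound _ s ρ r (All.++⁺ (constraints-hold h ρ p) ss)

  -- The hypotheses present from the start: the first m variables are casts of natural numbers and
  -- hence nonnegative.
  naturals : ∀ m n → List (Form (m ℕ.+ n))
  naturals zero    n = []
  naturals (suc m) n = (0ℤ , unit zero) ∷ List.map (λ (c , as) → c , 0ℤ ∷ as) (naturals m n)

  naturals-sat : ∀ {m n} (ν : Vec ℕ m) (ζ : Vec ℤ n) → Sat (Vec.map +_ ν Vec.++ ζ) (naturals m n)
  naturals-sat []      ζ = []
  naturals-sat (x ∷ ν) ζ =
    subst (0ℤ ≤_) (sym (trans (ℤ.+-identityˡ _) (dot-unit zero (+ x ∷ Vec.map +_ ν Vec.++ ζ)))) (+≤+ z≤n)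
    ∷ All.map⁺ (All.map
        (λ {l} s → subst (0ℤ ≤_) (lemma (proj₁ l) (+ x) (dot (proj₂ l) (Vec.map +_ ν Vec.++ ζ))) s)
        (naturals-sat ν ζ))
    where
    lemma : ∀ c x d → c + d ≡ c + (0ℤ * x + d)
    lemma = solve-∀

  variables : ∀ k → Vec (Expr k) k
  variables k = Vec.map var (Vec.allFin k)

  abstract
    -- The first variables of the sequent are the natural numbers ν, the others the integers ζ.
    lin : ∀ {m n} (ν : Vec ℕ m) (ζ : Vec ℤ n) →
      (s : N-ary (m ℕ.+ n) (Expr (m ℕ.+ n)) (Sequent (m ℕ.+ n))) →
      valid (naturals m n) (s $ⁿ variables (m ℕ.+ n)) ≡ true →
      ⟦ s $ⁿ variables (m ℕ.+ n) ⟧ˢ (Vec.map +_ ν Vec.++ ζ)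
    lin {m} {n} ν ζ s v =
      valid-sound (naturals m n) (s $ⁿ variables (m ℕ.+ n)) _ (subst T (sym v) tt) (naturals-sat ν ζ)

-- Counting by explicit bijections with `Fin n`.

module Enumerations where

  open LinearArithmetic using (lin; _:≤_; _:<_; _:≡_; _:+_; _:-_; ⊢_; _⇒_)
  open import Data.Empty using (⊥-elim)
  open import Data.Fin as Fin
    using (Fin; zero; suc; toℕ; fromℕ<; punchIn; punchOut; splitAt; _↑ˡ_; _↑ʳ_; remQuot; combine)
  import Data.Fin.Properties as Fin
  open import Data.Integer as ℤ using (ℤ; +_; +<+)
  import Data.Integer.Properties as ℤ
  open import Data.Nat as ℕ using (ℕ; zero; suc)
  import Data.Nat.Properties as ℕ
  open import Data.Product using (∃-syntax; _×_; _,_; proj₁; proj₂; uncurry)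
  open import Data.Sum using (_⊎_; inj₁; inj₂; [_,_]′)
  open import Data.Vec using ([]; _∷_)
  open import Function using (_∘_; id)
  open import Relation.Nullary using (¬_)
  open import Relation.Binary.PropositionalEquality using (_≡_; _≢_; refl; sym; trans; cong; subst)

  record Enumeration {A : Set} (P : A → Set) (n : ℕ) : Set where
    field
      at        : Fin n → A
      injective : ∀ {i j} → at i ≡ at j → i ≡ j
      sound     : ∀ i → P (at i)
      complete  : ∀ x → P x → ∃[ i ] at i ≡ x

  open Enumeration

  module _ {A : Set} where

    recount : ∀ {P : A → Set} {m n} → m ≡ n → Enumeration P m → Enumeration P n
    recount refl e = e

    image : ∀ {B : Set} {P : A → Set} {Q : B → Set} {n} (f : A → B) →
      (∀ {x y} → f x ≡ f y → x ≡ y) → (∀ x → P x → Q (f x)) →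
      (∀ y → Q y → ∃[ x ] P x × f x ≡ y) → Enumeration P n → Enumeration Q n
    image f f-injective f-sound f-complete e = record
      { at        = f ∘ at e
      ; injective = injective e ∘ f-injective
      ; sound     = λ i → f-sound _ (sound e i)
      ; complete  = λ y q → let x , p , fx≡y = f-complete y q
                                i , ei≡x     = complete e x p
                            in i , trans (cong f ei≡x) fx≡y
      }

    transport : ∀ {P Q : A → Set} {n} → (∀ x → P x → Q x) → (∀ x → Q x → P x) →
      Enumeration P n → Enumeration Q n
    transport to from = image id id to λ y q → y , from y q , refl

    empty : ∀ {P : A → Set} → (∀ x → ¬ P x) → Enumeration P 0
    empty ¬P = record
      { at = λ () ; injective = λ { {()} } ; sound = λ () ; complete = λ x p → ⊥-elim (¬P x p) }

    singleton : ∀ {P : A → Set} x → P x → (∀ y → P y → x ≡ y) → Enumeration P 1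
    singleton x p unique = record
      { at        = λ _ → x
      ; injective = λ { {zero} {zero} _ → refl }
      ; sound     = λ _ → p
      ; complete  = λ y q → zero , unique y q
      }

    disjointUnion : ∀ {P Q : A → Set} {m n} → (∀ x → P x → ¬ Q x) →
      Enumeration P m → Enumeration Q n → Enumeration (λ x → P x ⊎ Q x) (m ℕ.+ n)
    disjointUnion {P} {Q} {m} {n} disjoint d e = record
      { at        = f ∘ splitAt m
      ; injective = λ {i} {j} eq → trans (sym (Fin.join-splitAt m n i))
          (trans (cong (Fin.join m n) (f-injective (splitAt m i) (splitAt m j) eq))
                 (Fin.join-splitAt m n j))
      ; sound     = λ i → f-sound (splitAt m i)
      ; complete  = λ
          { x (inj₁ p) → let i , eq = complete d x p in
              i ↑ˡ n , trans (cong f (Fin.splitAt-↑ˡ m i n)) eq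
          ; x (inj₂ q) → let j , eq = complete e x q in
              m ↑ʳ j , trans (cong f (Fin.splitAt-↑ʳ m n j)) eq
          }
      }
      where
      f : Fin m ⊎ Fin n → A
      f = [ at d , at e ]′
      f-sound : ∀ k → P (f k) ⊎ Q (f k)
      f-sound (inj₁ i) = inj₁ (sound d i)
      f-sound (inj₂ j) = inj₂ (sound e j)
      f-injective : ∀ k l → f k ≡ f l → k ≡ l
      f-injective (inj₁ i) (inj₁ j) eq = cong inj₁ (injective d eq)
      f-injective (inj₁ i) (inj₂ j) eq = ⊥-elim (disjoint _ (subst P eq (sound d i)) (sound e j))
      f-injective (inj₂ i) (inj₁ j) eq = ⊥-elim (disjoint _ (sound d j) (subst Q eq (sound e i)))
      f-injective (inj₂ i) (inj₂ j) eq = cong inj₂ (injective e eq)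

    -- All fibres must have the same size n. In the application the first component is the position
    -- of a column, and the number of its continuations depends on its shape alone.
    pairs : ∀ {B : Set} {P : A → Set} {Q : A → B → Set} {m n} → Enumeration P m →
      (∀ x → Enumeration (Q x) n) → Enumeration (λ (x , y) → P x × Q x y) (m ℕ.* n)
    pairs {B} {P} {Q} {m} {n} d e = record
      { at        = f ∘ remQuot n
      ; injective = λ {i} {j} eq → trans (sym (Fin.combine-remQuot {m} n i))
          (trans (cong (uncurry combine) (f-injective (remQuot n i) (remQuot n j) eq))
                 (Fin.combine-remQuot {m} n j))
      ; sound     = λ i → sound d _ , sound (e _) _
      ; complete  = λ { (x , y) (p , q) → complete′ x y (complete d x p) q }
      }
      where
      f : Fin m × Fin n → A × B
      f (i , j) = at d i , at (e (at d i)) j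
      f-injective : ∀ k l → f k ≡ f l → k ≡ l
      f-injective (i , j) (i′ , j′) eq with injective d {i} {i′} (cong proj₁ eq)
      ... | refl = cong (i ,_) (injective (e (at d i)) (cong proj₂ eq))
      complete′ : ∀ x y → (∃[ i ] at d i ≡ x) → Q x y → ∃[ k ] f (remQuot n k) ≡ (x , y)
      complete′ x y (i , refl) q = let j , eq = complete (e x) y q in
        combine i j , trans (cong f (Fin.remQuot-combine i j)) (cong (x ,_) eq)

    without : ∀ {P : A → Set} {n} x₀ → P x₀ → Enumeration P (suc n) →
      Enumeration (λ x → P x × x ≢ x₀) n
    without {P} {n} x₀ p e with complete e x₀ p
    ... | i₀ , refl = record
      { at        = at e ∘ punchIn i₀
      ; injective = Fin.punchIn-injective i₀ _ _ ∘ injective e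
      ; sound     = λ i → sound e _ , λ eq → Fin.punchInᵢ≢i i₀ i (injective e eq)
      ; complete  = λ x (q , x≢x₀) → complete′ x x≢x₀ (complete e x q)
      }
      where
      complete′ : ∀ x → x ≢ at e i₀ → (∃[ i ] at e i ≡ x) → ∃[ i ] at e (punchIn i₀ i) ≡ x
      complete′ x x≢x₀ (i , refl) =
        punchOut i₀≢i , cong (at e) (Fin.punchIn-punchOut i₀≢i)
        where
        i₀≢i : i₀ ≢ i
        i₀≢i eq = x≢x₀ (cong (at e) (sym eq))

    -- u is the indicator function of the complement of E.
    withoutWhen : ∀ {P : A → Set} {E : Set} {n u} x₀ → (E × u ≡ 0) ⊎ (¬ E × u ≡ 1) →
      (E → P x₀) → Enumeration P (suc n) → Enumeration (λ x → P x × (E → x ≢ x₀)) (n ℕ.+ u)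
    withoutWhen {n = n} x₀ (inj₁ (E , refl)) p e =
      recount (sym (ℕ.+-identityʳ n))
        (transport (λ x (q , x≢x₀) → q , λ _ → x≢x₀) (λ x (q , x≢x₀) → q , x≢x₀ E)
          (without x₀ (p E) e))
    withoutWhen {n = n} x₀ (inj₂ (¬E , refl)) p e =
      recount (sym (ℕ.+-comm n 1))
        (transport (λ x q → q , λ E → ⊥-elim (¬E E)) (λ x → proj₁) e)

  ≤⇒∃ : ∀ {x y} → x ℤ.≤ y → ∃[ k ] y ≡ x ℤ.+ + k
  ≤⇒∃ {x} {y} x≤y with y ℤ.- x in eq | ℤ.i≤j⇒0≤j-i x≤y
  ... | + k | _ = k , lin (k ∷ []) (x ∷ y ∷ []) (λ k x y → y :- x :≡ k ⇒ ⊢ y :≡ x :+ k) refl eq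

  interval : ∀ lo n → Enumeration (λ y → lo ℤ.≤ y × y ℤ.< lo ℤ.+ + n) n
  interval lo n = record
    { at        = λ i → lo ℤ.+ + toℕ i
    ; injective = λ {i} {j} eq → Fin.toℕ-injective (ℤ.+-injective
        (lin (toℕ i ∷ toℕ j ∷ []) (lo ∷ []) (λ i j lo → lo :+ i :≡ lo :+ j ⇒ ⊢ i :≡ j) refl eq))
    ; sound     = λ i →
        lin (toℕ i ∷ []) (lo ∷ []) (λ i lo → ⊢ lo :≤ lo :+ i) refl ,
        lin (toℕ i ∷ n ∷ []) (lo ∷ []) (λ i n lo → i :< n ⇒ ⊢ lo :+ i :< lo :+ n) refl (+<+ (Fin.toℕ<n i))
    ; complete  = λ y (lo≤y , y<hi) → complete′ y (≤⇒∃ lo≤y) y<hi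
    }
    where
    complete′ : ∀ y → (∃[ k ] y ≡ lo ℤ.+ + k) → y ℤ.< lo ℤ.+ + n → ∃[ i ] lo ℤ.+ + toℕ i ≡ y
    complete′ y (k , refl) y<hi = fromℕ< k<n , cong (λ k → lo ℤ.+ + k) (Fin.toℕ-fromℕ< k<n)
      where
      k<n : k ℕ.< n
      k<n = ℤ.drop‿+<+ (lin (k ∷ n ∷ []) (lo ∷ []) (λ k n lo → lo :+ k :< lo :+ n ⇒ ⊢ k :< n) refl y<hi)

-- The counting recursion and its closed formulas.

module Counting where

  open LinearArithmetic using (_:+_; _:-_; _:·_; Expr; var; ⟦_⟧ᵉ)
  open import Data.Fin using (#_)
  open import Data.Integer using (ℤ; +_; -_; 0ℤ; 1ℤ; _+_; _-_; _*_)
  open import Data.Integer.Properties using (pos-*)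
  open import Data.Integer.Tactic.RingSolver using (solve-∀)
  open import Data.Nat as ℕ using (ℕ; zero; suc; _∸_)
  open import Data.Vec as Vec using (Vec; []; _∷_)
  open import Relation.Binary.PropositionalEquality using (_≡_; refl; trans; cong; cong₂)

  data Gap : Set where
    narrow wide : Gap

  data Shape : Set where
    one : ℕ → Shape
    two : ℕ → Gap → ℕ → Shape

  -- placements s s′ is the number of positions of a column of shape s′ attached to the right of a
  -- column of shape s.  A single run of s′ has to meet the contact heights of s.  These form an
  -- interval, except that the middle height of a wide gap is missing: a run consisting of that cell
  -- alone is not attached, which absent and nonzero take into account.

  absent : ℕ → ℕ → ℕ
  absent zero (suc _) = 0
  absent _    _       = 1

  nonzero : ℕ → ℕ
  nonzero zero    = 0
  nonzero (suc _) = 1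

  placements : Shape → Shape → ℕ
  placements (one b)          (one a)          = b ℕ.+ 2 ℕ.+ a
  placements (two c narrow d) (one a)          = c ℕ.+ d ℕ.+ 4 ℕ.+ a
  placements (two c wide d)   (one a)          = c ℕ.+ d ℕ.+ 4 ℕ.+ a ℕ.+ nonzero a
  placements (one b)          (two _ narrow _) = b
  placements (one b)          (two _ wide _)   = b ∸ 1
  placements (two c narrow d) (two _ narrow _) = c ℕ.+ d ℕ.+ 2
  placements (two c narrow d) (two _ wide _)   = c ℕ.+ d ℕ.+ 1
  placements (two c wide d)   (two a narrow b) = c ℕ.+ d ℕ.+ 1 ℕ.+ nonzero a ℕ.+ nonzero b
  placements (two c wide d)   (two a wide b)   = c ℕ.+ d ℕ.+ absent a d ℕ.+ absent b c

  -- chains n s counts the ways to continue a column of shape s to the right with n cells.  In the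
  -- other functions the next column is being built cell by cell: it has at least the cells given by
  -- the last arguments, and n is the number of cells still to be used.

  chains : ℕ → Shape → ℕ
  onesFrom : ℕ → Shape → ℕ → ℕ
  lowersFrom : ℕ → Shape → Gap → ℕ → ℕ
  uppersFrom : ℕ → Shape → ℕ → Gap → ℕ → ℕ

  chains zero    s = 1
  chains (suc n) s = onesFrom n s 0 ℕ.+ (lowersFrom n s narrow 0 ℕ.+ lowersFrom n s wide 0)

  onesFrom zero    s a = placements s (one a) ℕ.* chains zero (one a)
  onesFrom (suc n) s a = placements s (one a) ℕ.* chains (suc n) (one a) ℕ.+ onesFrom n s (suc a)

  -- Without a further cell the obligatory upper run cannot begin. Otherwise the next cell either
  -- begins it or lengthens the lower run.
  lowersFrom zero    s g c = 0
  lowersFrom (suc n) s g c = uppersFrom n s c g 0 ℕ.+ lowersFrom n s g (suc c)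

  uppersFrom zero    s c g d = placements s (two c g d) ℕ.* chains zero (two c g d)
  uppersFrom (suc n) s c g d =
    placements s (two c g d) ℕ.* chains (suc n) (two c g d) ℕ.+ uppersFrom n s c g (suc d)

  startsFrom : ℕ → ℕ → ℕ
  startsFrom zero    a = chains zero (one a)
  startsFrom (suc n) a = chains (suc n) (one a) ℕ.+ startsFrom n (suc a)

  cheesyCount : ℕ → ℕ
  cheesyCount zero    = 0
  cheesyCount (suc n) = startsFrom n 0


  -- Coordinates in which the counts are linear.

  δ : ℕ → ℤ
  δ zero    = 1ℤ
  δ (suc _) = 0ℤ

  -- chains n s depends on s only through these quantities, linearly.  slack compensates for the
  -- truncated subtraction in b ∸ 1.  roomBelow is 1 if the next column, with a wide gap, could have its
  -- upper run at the missing height while its lower run meets s; roomAbove is the mirror image.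

  width holes slack roomBelow roomAbove : Shape → ℤ
  width (one b)          = + b + + 2
  width (two c narrow d) = + c + + d + + 4
  width (two c wide d)   = + c + + d + + 5
  holes (two _ wide _)   = 1ℤ
  holes _                = 0ℤ
  slack (one b)          = δ b
  slack _                = 0ℤ
  roomBelow (two c wide d) = 1ℤ - δ c
  roomBelow _              = 0ℤ
  roomAbove (two c wide d) = 1ℤ - δ d
  roomAbove _              = 0ℤ

  +nonzero : ∀ a → + nonzero a ≡ 1ℤ - δ a
  +nonzero zero    = refl
  +nonzero (suc _) = refl

  +absent : ∀ a d → + absent a d ≡ 1ℤ - (1ℤ - δ d) * δ a
  +absent zero    zero    = refl
  +absent zero    (suc _) = refl
  +absent (suc _) zero    = refl
  +absent (suc _) (suc _) = refl

  +pred : ∀ b → + (b ∸ 1) ≡ + b - 1ℤ + δ b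
  +pred zero    = refl
  +pred (suc b) = lemma (+ b)
    where
    lemma : ∀ x → x ≡ 1ℤ + x - 1ℤ + 0ℤ
    lemma = solve-∀

  placements-one : ∀ s a → + placements s (one a) ≡ width s + + a - holes s * δ a
  placements-one (one b) a = lemma (+ b + + 2) (+ a) (δ a)
    where
    lemma : ∀ x a d → x + a ≡ x + a - 0ℤ * d
    lemma = solve-∀
  placements-one (two c narrow d) a = lemma (+ c + + d + + 4) (+ a) (δ a)
    where
    lemma : ∀ x a d → x + a ≡ x + a - 0ℤ * d
    lemma = solve-∀
  placements-one (two c wide d) a =
    trans (cong (λ z → + c + + d + + 4 + + a + z) (+nonzero a)) (lemma (+ c + + d) (+ a) (δ a))
    where
    lemma : ∀ x a d → x + + 4 + a + (1ℤ - d) ≡ x + + 5 + a - 1ℤ * d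
    lemma = solve-∀

  -- Both runs meet the hull of the contact heights as soon as the top of the lower run is not below
  -- it and the bottom of the upper run is not above it. These two ends are 2 apart, so the hull is
  -- shortened by 2, and the sizes matter only at the missing height.
  placements-narrow : ∀ s a b →
    + placements s (two a narrow b) ≡ width s - + 2 - holes s * (δ a + δ b)
  placements-narrow (one x) a b = lemma (+ x) (δ a + δ b)
    where
    lemma : ∀ x d → x ≡ x + + 2 - + 2 - 0ℤ * d
    lemma = solve-∀
  placements-narrow (two c narrow d) a b = lemma (+ c + + d) (δ a + δ b)
    where
    lemma : ∀ x d → x + + 2 ≡ x + + 4 - + 2 - 0ℤ * d
    lemma = solve-∀
  placements-narrow (two c wide d) a b =
    trans (cong₂ (λ y z → + c + + d + 1ℤ + y + z) (+nonzero a) (+nonzero b))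
          (lemma (+ c + + d) (δ a) (δ b))
    where
    lemma : ∀ x a b → x + 1ℤ + (1ℤ - a) + (1ℤ - b) ≡ x + + 5 - + 2 - 1ℤ * (a + b)
    lemma = solve-∀

  -- When one run is a single cell at the missing height, its partner begins three cells further on.
  -- It still meets a wide column `s` only if the run of `s` on that side has a second cell;
  -- otherwise the position was not in the interval and is not subtracted.
  placements-wide : ∀ s a b → + placements s (two a wide b) ≡
    width s - + 3 + slack s - (roomAbove s * δ a + roomBelow s * δ b)
  placements-wide (one x) a b = trans (+pred x) (lemma (+ x) (δ x) (δ a) (δ b))
    where
    lemma : ∀ x s a b → x - 1ℤ + s ≡ x + + 2 - + 3 + s - (0ℤ * a + 0ℤ * b)
    lemma = solve-∀
  placements-wide (two c narrow d) a b = lemma (+ c + + d) (δ a) (δ b)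
    where
    lemma : ∀ x a b → x + 1ℤ ≡ x + + 4 - + 3 + 0ℤ - (0ℤ * a + 0ℤ * b)
    lemma = solve-∀
  placements-wide (two c wide d) a b =
    trans (cong₂ (λ y z → + c + + d + y + z) (+absent a d) (+absent b c))
          (lemma (+ c + + d) ((1ℤ - δ d) * δ a) ((1ℤ - δ c) * δ b))
    where
    lemma : ∀ x u v → x + (1ℤ - u) + (1ℤ - v) ≡ x + + 5 - + 3 + 0ℤ - (u + v)
    lemma = solve-∀

  -- α, β, γ, X and Y are the coefficients in ChainsFormula below.  The other components are sums over
  -- the sizes of the column being built:
  -- P₀ n = Σ α (n ∸ j), P₁ n = Σ j α (n ∸ j), Qᵢ n = Σ jⁱ β (n ∸ j), R n = Σ X (n ∸ j),
  -- S n = Σ Y (n ∸ j) over j ≤ n, T n = Σ (R i + 2 S i) over i < n, and Y′ (suc n) = Y n.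
  -- The remaining sums needed for two-run columns are linear combinations of these.

  State : Set
  State = Vec ℤ 14

  αᵛ βᵛ γᵛ Xᵛ Yᵛ P₀ᵛ P₁ᵛ Q₀ᵛ Q₁ᵛ Q₂ᵛ Rᵛ Sᵛ Tᵛ Y′ᵛ : Expr 14
  αᵛ  = var (# 0)
  βᵛ  = var (# 1)
  γᵛ  = var (# 2)
  Xᵛ  = var (# 3)
  Yᵛ  = var (# 4)
  P₀ᵛ = var (# 5)
  P₁ᵛ = var (# 6)
  Q₀ᵛ = var (# 7)
  Q₁ᵛ = var (# 8)
  Q₂ᵛ = var (# 9)
  Rᵛ  = var (# 10)
  Sᵛ  = var (# 11)
  Tᵛ  = var (# 12)
  Y′ᵛ = var (# 13)

  -- `Nᵛ` and `Lᵛ` are the total weights of the next columns with a narrow and a wide gap, per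
  -- position in the shortened hull. They are multiplied by `width` minus 2 and by `width` minus 3
  -- plus `slack`, which explains the multiples of both in `α⁺` and the coefficient `Lᵛ` of `slack`.
  -- `X⁺` and `Y⁺` weigh the positions lost because a one-cell run sits at the missing height; the
  -- factor 2 in `X⁺` stands for the lower and the upper run.
  Lᵛ Nᵛ α⁺ β⁺ X⁺ Y⁺ : Expr 14
  Lᵛ = P₁ᵛ :+ (+ 4) :· Q₁ᵛ :+ Q₂ᵛ :- Tᵛ :+ (+ 2) :· (Sᵛ :- Yᵛ)
  Nᵛ = P₁ᵛ :+ (+ 3) :· Q₁ᵛ :+ Q₂ᵛ
  α⁺ = P₁ᵛ :+ (+ 2) :· Q₁ᵛ :+ Q₂ᵛ :- (+ 2) :· Nᵛ :- (+ 3) :· Lᵛ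
  β⁺ = P₀ᵛ :+ (+ 2) :· Q₀ᵛ :+ Q₁ᵛ :+ γᵛ :+ Nᵛ :+ Lᵛ
  X⁺ = αᵛ :+ (+ 2) :· βᵛ :+ γᵛ
    :+ (+ 2) :· (P₀ᵛ :- αᵛ :+ (+ 4) :· (Q₀ᵛ :- βᵛ) :+ (Q₁ᵛ :- (Q₀ᵛ :- βᵛ)))
  Y⁺ = P₀ᵛ :- αᵛ :+ (+ 5) :· (Q₀ᵛ :- βᵛ) :+ (Q₁ᵛ :- (Q₀ᵛ :- βᵛ))
    :- (Rᵛ :- Xᵛ) :- (Sᵛ :- Yᵛ) :+ Y′ᵛ

  transition : Vec (Expr 14) 14
  transition = α⁺ ∷ β⁺ ∷ Lᵛ ∷ X⁺ ∷ Y⁺ ∷ α⁺ :+ P₀ᵛ ∷ P₀ᵛ :+ P₁ᵛ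
    ∷ β⁺ :+ Q₀ᵛ ∷ Q₀ᵛ :+ Q₁ᵛ ∷ Q₀ᵛ :+ (+ 2) :· Q₁ᵛ :+ Q₂ᵛ
    ∷ X⁺ :+ Rᵛ ∷ Y⁺ :+ Sᵛ ∷ Rᵛ :+ (+ 2) :· Sᵛ :+ Tᵛ ∷ Yᵛ ∷ []

  advance : State → State
  advance ρ = Vec.map (λ e → ⟦ e ⟧ᵉ ρ) transition

  state : ℕ → State
  state zero    = 1ℤ ∷ 0ℤ ∷ 0ℤ ∷ 0ℤ ∷ 0ℤ ∷ 1ℤ ∷ 0ℤ ∷ 0ℤ ∷ 0ℤ ∷ 0ℤ ∷ 0ℤ ∷ 0ℤ ∷ 0ℤ ∷ 0ℤ ∷ []
  state (suc n) = advance (state n)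

  α β γ X Y P₀ P₁ Q₀ Q₁ Q₂ R S T Y′ : ℕ → ℤ
  α n  = ⟦ αᵛ ⟧ᵉ (state n)
  β n  = ⟦ βᵛ ⟧ᵉ (state n)
  γ n  = ⟦ γᵛ ⟧ᵉ (state n)
  X n  = ⟦ Xᵛ ⟧ᵉ (state n)
  Y n  = ⟦ Yᵛ ⟧ᵉ (state n)
  P₀ n = ⟦ P₀ᵛ ⟧ᵉ (state n)
  P₁ n = ⟦ P₁ᵛ ⟧ᵉ (state n)
  Q₀ n = ⟦ Q₀ᵛ ⟧ᵉ (state n)
  Q₁ n = ⟦ Q₁ᵛ ⟧ᵉ (state n)
  Q₂ n = ⟦ Q₂ᵛ ⟧ᵉ (state n)
  R n  = ⟦ Rᵛ ⟧ᵉ (state n)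
  S n  = ⟦ Sᵛ ⟧ᵉ (state n)
  T n  = ⟦ Tᵛ ⟧ᵉ (state n)
  Y′ n = ⟦ Y′ᵛ ⟧ᵉ (state n)

  ChainsFormula : ℕ → Set
  ChainsFormula n = ∀ s → + chains n s ≡
    α n + β n * width s + γ n * slack s - holes s * X n - (roomBelow s + roomAbove s) * Y n

  -- The sum over sizes a + j of positions times continuations. Both indicators in the summand are
  -- nonzero only for a = j = 0, hence the last line, with coefficients at n that are not summed.
  OnesFormula : ℕ → Set
  OnesFormula n = ∀ s a → + onesFrom n s a ≡
    (width s + + a) * (P₀ n + (+ a + + 2) * Q₀ n + Q₁ n) + P₁ n + (+ a + + 2) * Q₁ n + Q₂ n
    + δ a * (width s * γ n - holes s * (α n + + 2 * β n + γ n))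

  NarrowUppersFormula : ℕ → Set
  NarrowUppersFormula n = ∀ s c d → + uppersFrom n s c narrow d ≡
    (width s - + 2 - holes s * δ c) * (P₀ n + (+ c + + d + + 4) * Q₀ n + Q₁ n)
    - holes s * δ d * (α n + (+ c + + 4) * β n)

  -- The new column has two rooms less one for each of its runs that is a single cell. A lower run
  -- with c = 0 affects every summand, whereas an upper run of one cell occurs only in the first
  -- summand and only for d = 0; hence `δ c` next to `S n` but `δ d` next to `Y n`.
  WideUppersFormula : ℕ → Set
  WideUppersFormula n = ∀ s c d → + uppersFrom n s c wide d ≡
    (width s - + 3 + slack s - roomAbove s * δ c) *
      (P₀ n + (+ c + + d + + 5) * Q₀ n + Q₁ n - R n - (+ 2 - δ c) * S n + δ d * Y n)
    - roomBelow s * δ d * (α n + (+ c + + 5) * β n - X n - (1ℤ - δ c) * Y n)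

  -- If j further cells go into the column, at least one of them into the upper run, there are j
  -- ways to split them; this is the factor j in `P₁`, `Q₁` and the square in `Q₂`. The differences
  -- `P₀ n - α n`, `Q₀ n - β n` and `Q₁ n - (Q₀ n - β n)` are the values of `P₀`, `Q₀` and `Q₁` at n
  -- - 1, and 0 for n = 0: one cell is reserved for the upper run.
  NarrowLowersFormula : ℕ → Set
  NarrowLowersFormula n = ∀ s c → + lowersFrom n s narrow c ≡
    (width s - + 2) * (P₁ n + (+ c + + 3) * Q₁ n + Q₂ n)
    - holes s * (δ c * (P₀ n - α n + + 4 * (Q₀ n - β n) + (Q₁ n - (Q₀ n - β n)))
                 + (P₀ n - α n + (+ c + + 4) * (Q₀ n - β n) + (Q₁ n - (Q₀ n - β n))))

  -- `T n` charges two rooms for every split of the j further cells. For each positive j one split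
  -- has a one-cell upper run, and for c = 0 one has a one-cell lower run; the multiple of
  -- `S n - Y n` gives these rooms back. `Y′ n` does the same in the correction terms, where one run
  -- is already a single cell and the other one may be, too.
  WideLowersFormula : ℕ → Set
  WideLowersFormula n = ∀ s c → + lowersFrom n s wide c ≡
    (width s - + 3 + slack s) *
      (P₁ n + (+ c + + 4) * Q₁ n + Q₂ n - T n + (1ℤ + δ c) * (S n - Y n))
    - roomAbove s * δ c *
      (P₀ n - α n + + 5 * (Q₀ n - β n) + (Q₁ n - (Q₀ n - β n)) - (R n - X n) - (S n - Y n) + Y′ n)
    - roomBelow s *
      (P₀ n - α n + (+ c + + 5) * (Q₀ n - β n) + (Q₁ n - (Q₀ n - β n))
       - (R n - X n) - (S n - Y n) + δ c * Y′ n)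

  +*-cong : ∀ m n {x y} → + m ≡ x → + n ≡ y → + (m ℕ.* n) ≡ x * y
  +*-cong m n p q = trans (pos-* m n) (cong₂ _*_ p q)

  onesFormula-zero : OnesFormula 0
  onesFormula-zero s a =
    trans (+*-cong (placements s (one a)) 1 (placements-one s a) refl)
          (lemma (width s) (+ a) (holes s) (δ a))
    where
    lemma : ∀ t a κ d → (t + a - κ * d) * 1ℤ ≡
      (t + a) * (1ℤ + (a + + 2) * 0ℤ + 0ℤ) + 0ℤ + (a + + 2) * 0ℤ + 0ℤ
      + d * (t * 0ℤ - κ * (1ℤ + + 2 * 0ℤ + 0ℤ))
    lemma = solve-∀

  narrowUppersFormula-zero : NarrowUppersFormula 0
  narrowUppersFormula-zero s c d =
    trans (+*-cong (placements s (two c narrow d)) 1 (placements-narrow s c d) refl)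
          (lemma (width s) (holes s) (+ c) (+ d) (δ c) (δ d))
    where
    lemma : ∀ t κ c d δc δd → (t - + 2 - κ * (δc + δd)) * 1ℤ ≡
      (t - + 2 - κ * δc) * (1ℤ + (c + d + + 4) * 0ℤ + 0ℤ) - κ * δd * (1ℤ + (c + + 4) * 0ℤ)
    lemma = solve-∀

  wideUppersFormula-zero : WideUppersFormula 0
  wideUppersFormula-zero s c d =
    trans (+*-cong (placements s (two c wide d)) 1 (placements-wide s c d) refl)
          (lemma (width s) (slack s) (roomBelow s) (roomAbove s) (+ c) (+ d) (δ c) (δ d))
    where
    lemma : ∀ t e l r c d δc δd → (t - + 3 + e - (r * δc + l * δd)) * 1ℤ ≡
      (t - + 3 + e - r * δc) *
        (1ℤ + (c + d + + 5) * 0ℤ + 0ℤ - 0ℤ - (+ 2 - δc) * 0ℤ + δd * 0ℤ)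
      - l * δd * (1ℤ + (c + + 5) * 0ℤ - 0ℤ - (1ℤ - δc) * 0ℤ)
    lemma = solve-∀

  narrowLowersFormula-zero : NarrowLowersFormula 0
  narrowLowersFormula-zero s c = lemma (width s) (holes s) (+ c) (δ c)
    where
    lemma : ∀ t κ c d → 0ℤ ≡ (t - + 2) * (0ℤ + (c + + 3) * 0ℤ + 0ℤ)
      - κ * (d * (1ℤ - 1ℤ + + 4 * (0ℤ - 0ℤ) + (0ℤ - (0ℤ - 0ℤ)))
             + (1ℤ - 1ℤ + (c + + 4) * (0ℤ - 0ℤ) + (0ℤ - (0ℤ - 0ℤ))))
    lemma = solve-∀

  wideLowersFormula-zero : WideLowersFormula 0
  wideLowersFormula-zero s c = lemma (width s) (slack s) (roomBelow s) (roomAbove s) (+ c) (δ c)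
    where
    lemma : ∀ t e l r c d → 0ℤ ≡
      (t - + 3 + e) * (0ℤ + (c + + 4) * 0ℤ + 0ℤ - 0ℤ + (1ℤ + d) * (0ℤ - 0ℤ))
      - r * d *
        (1ℤ - 1ℤ + + 5 * (0ℤ - 0ℤ) + (0ℤ - (0ℤ - 0ℤ)) - (0ℤ - 0ℤ) - (0ℤ - 0ℤ) + 0ℤ)
      - l *
        (1ℤ - 1ℤ + (c + + 5) * (0ℤ - 0ℤ) + (0ℤ - (0ℤ - 0ℤ))
         - (0ℤ - 0ℤ) - (0ℤ - 0ℤ) + d * 0ℤ)
    lemma = solve-∀

  chainsFormula-zero : ChainsFormula 0
  chainsFormula-zero s = lemma (width s) (slack s) (holes s) (roomBelow s) (roomAbove s)
    where
    lemma : ∀ t e κ l r → 1ℤ ≡ 1ℤ + 0ℤ * t + 0ℤ * e - κ * 0ℤ - (l + r) * 0ℤ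
    lemma = solve-∀

  -- The case distinction on `a` lets `δ` compute; what remains is a polynomial identity with the
  -- moments as indeterminates. Passing from size a + 1 back to a is absorbed by the rules for the
  -- moments in `transition`.
  onesFormula-suc : ∀ n → ChainsFormula (suc n) → OnesFormula n → OnesFormula (suc n)
  onesFormula-suc n F O s zero =
    trans (cong₂ _+_ (+*-cong (placements s (one 0)) (chains (suc n) (one 0))
                       (placements-one s 0) (F (one 0)))
                     (O s 1))
          (lemma (width s) (holes s) (α (suc n)) (β (suc n)) (γ (suc n)) (X (suc n)) (Y (suc n))
            (P₀ n) (P₁ n) (Q₀ n) (Q₁ n) (Q₂ n)
            (width s * γ n - holes s * (α n + + 2 * β n + γ n)))
    where
    lemma : ∀ t κ α β γ X Y P₀ P₁ Q₀ Q₁ Q₂ z →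
      (t + 0ℤ - κ * 1ℤ) * (α + β * (0ℤ + + 2) + γ * 1ℤ - 0ℤ * X - (0ℤ + 0ℤ) * Y)
      + ((t + 1ℤ) * (P₀ + (1ℤ + + 2) * Q₀ + Q₁) + P₁ + (1ℤ + + 2) * Q₁ + Q₂ + 0ℤ * z)
      ≡ (t + 0ℤ) * ((α + P₀) + (0ℤ + + 2) * (β + Q₀) + (Q₀ + Q₁)) + (P₀ + P₁) + (0ℤ + + 2) * (Q₀ + Q₁)
        + (Q₀ + + 2 * Q₁ + Q₂)
        + 1ℤ * (t * γ - κ * (α + + 2 * β + γ))
    lemma = solve-∀
  onesFormula-suc n F O s (suc a) =
    trans (cong₂ _+_ (+*-cong (placements s (one (suc a))) (chains (suc n) (one (suc a)))
                       (placements-one s (suc a)) (F (one (suc a))))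
                     (O s (suc (suc a))))
          (lemma (width s) (holes s) (+ suc a) (α (suc n)) (β (suc n)) (γ (suc n)) (X (suc n)) (Y (suc n))
            (P₀ n) (P₁ n) (Q₀ n) (Q₁ n) (Q₂ n)
            (width s * γ n - holes s * (α n + + 2 * β n + γ n))
            (width s * γ (suc n) - holes s * (α (suc n) + + 2 * β (suc n) + γ (suc n))))
    where
    lemma : ∀ t κ a α β γ X Y P₀ P₁ Q₀ Q₁ Q₂ z z′ →
      (t + a - κ * 0ℤ) * (α + β * (a + + 2) + γ * 0ℤ - 0ℤ * X - (0ℤ + 0ℤ) * Y)
      + ((t + (1ℤ + a)) * (P₀ + ((1ℤ + a) + + 2) * Q₀ + Q₁) + P₁ + ((1ℤ + a) + + 2) * Q₁ + Q₂ + 0ℤ * z)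
      ≡ (t + a) * ((α + P₀) + (a + + 2) * (β + Q₀) + (Q₀ + Q₁)) + (P₀ + P₁) + (a + + 2) * (Q₀ + Q₁)
        + (Q₀ + + 2 * Q₁ + Q₂)
        + 0ℤ * z′
    lemma = solve-∀

  narrowUppersFormula-suc : ∀ n → ChainsFormula (suc n) → NarrowUppersFormula n →
    NarrowUppersFormula (suc n)
  narrowUppersFormula-suc n F U s c zero =
    trans (cong₂ _+_ (+*-cong (placements s (two c narrow 0)) (chains (suc n) (two c narrow 0))
                       (placements-narrow s c 0) (F (two c narrow 0)))
                     (U s c 1))
          (lemma (width s) (holes s) (+ c) (δ c) (α (suc n)) (β (suc n)) (γ (suc n)) (X (suc n))
            (Y (suc n)) (P₀ n) (Q₀ n) (Q₁ n) (α n + (+ c + + 4) * β n))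
    where
    lemma : ∀ t κ c d α β γ X Y P₀ Q₀ Q₁ z →
      (t - + 2 - κ * (d + 1ℤ)) * (α + β * (c + 0ℤ + + 4) + γ * 0ℤ - 0ℤ * X - (0ℤ + 0ℤ) * Y)
      + ((t - + 2 - κ * d) * (P₀ + (c + 1ℤ + + 4) * Q₀ + Q₁) - κ * 0ℤ * z)
      ≡ (t - + 2 - κ * d) * ((α + P₀) + (c + 0ℤ + + 4) * (β + Q₀) + (Q₀ + Q₁))
        - κ * 1ℤ * (α + (c + + 4) * β)
    lemma = solve-∀
  narrowUppersFormula-suc n F U s c (suc d) =
    trans (cong₂ _+_ (+*-cong (placements s (two c narrow (suc d))) (chains (suc n) (two c narrow (suc d)))
                       (placements-narrow s c (suc d)) (F (two c narrow (suc d))))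
                     (U s c (suc (suc d))))
          (lemma (width s) (holes s) (+ c) (+ suc d) (δ c) (α (suc n)) (β (suc n)) (γ (suc n))
            (X (suc n)) (Y (suc n)) (P₀ n) (Q₀ n) (Q₁ n) (α n + (+ c + + 4) * β n))
    where
    lemma : ∀ t κ c x d α β γ X Y P₀ Q₀ Q₁ z →
      (t - + 2 - κ * (d + 0ℤ)) * (α + β * (c + x + + 4) + γ * 0ℤ - 0ℤ * X - (0ℤ + 0ℤ) * Y)
      + ((t - + 2 - κ * d) * (P₀ + (c + (1ℤ + x) + + 4) * Q₀ + Q₁) - κ * 0ℤ * z)
      ≡ (t - + 2 - κ * d) * ((α + P₀) + (c + x + + 4) * (β + Q₀) + (Q₀ + Q₁))
        - κ * 0ℤ * (α + (c + + 4) * β)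
    lemma = solve-∀

  wideUppersFormula-suc : ∀ n → ChainsFormula (suc n) → WideUppersFormula n →
    WideUppersFormula (suc n)
  wideUppersFormula-suc n F U s c zero =
    trans (cong₂ _+_ (+*-cong (placements s (two c wide 0)) (chains (suc n) (two c wide 0))
                       (placements-wide s c 0) (F (two c wide 0)))
                     (U s c 1))
          (lemma (width s - + 3 + slack s) (roomBelow s) (roomAbove s) (+ c) (δ c)
            (α (suc n)) (β (suc n)) (γ (suc n)) (X (suc n)) (Y (suc n))
            (P₀ n) (Q₀ n) (Q₁ n) (R n) (S n) (Y n)
            (α n + (+ c + + 5) * β n - X n - (1ℤ - δ c) * Y n))
    where
    lemma : ∀ t l r c d α β γ X Y P₀ Q₀ Q₁ R S y z →
      (t - (r * d + l * 1ℤ))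
        * (α + β * (c + 0ℤ + + 5) + γ * 0ℤ - 1ℤ * X - ((1ℤ - d) + (1ℤ - 1ℤ)) * Y)
      + ((t - r * d) * (P₀ + (c + 1ℤ + + 5) * Q₀ + Q₁ - R - (+ 2 - d) * S + 0ℤ * y) - l * 0ℤ * z)
      ≡ (t - r * d) * ((α + P₀) + (c + 0ℤ + + 5) * (β + Q₀) + (Q₀ + Q₁) - (X + R)
                       - (+ 2 - d) * (Y + S) + 1ℤ * Y)
        - l * 1ℤ * (α + (c + + 5) * β - X - (1ℤ - d) * Y)
    lemma = solve-∀
  wideUppersFormula-suc n F U s c (suc d) =
    trans (cong₂ _+_ (+*-cong (placements s (two c wide (suc d))) (chains (suc n) (two c wide (suc d)))
                       (placements-wide s c (suc d)) (F (two c wide (suc d))))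
                     (U s c (suc (suc d))))
          (lemma (width s - + 3 + slack s) (roomBelow s) (roomAbove s) (+ c) (+ suc d) (δ c)
            (α (suc n)) (β (suc n)) (γ (suc n)) (X (suc n)) (Y (suc n))
            (P₀ n) (Q₀ n) (Q₁ n) (R n) (S n) (Y n)
            (α n + (+ c + + 5) * β n - X n - (1ℤ - δ c) * Y n))
    where
    lemma : ∀ t l r c x d α β γ X Y P₀ Q₀ Q₁ R S y z →
      (t - (r * d + l * 0ℤ))
        * (α + β * (c + x + + 5) + γ * 0ℤ - 1ℤ * X - ((1ℤ - d) + (1ℤ - 0ℤ)) * Y)
      + ((t - r * d) * (P₀ + (c + (1ℤ + x) + + 5) * Q₀ + Q₁ - R - (+ 2 - d) * S + 0ℤ * y) - l * 0ℤ * z)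
      ≡ (t - r * d) * ((α + P₀) + (c + x + + 5) * (β + Q₀) + (Q₀ + Q₁) - (X + R)
                       - (+ 2 - d) * (Y + S) + 0ℤ * Y)
        - l * 0ℤ * (α + (c + + 5) * β - X - (1ℤ - d) * Y)
    lemma = solve-∀

  narrowLowersFormula-suc : ∀ n → NarrowUppersFormula n → NarrowLowersFormula n →
    NarrowLowersFormula (suc n)
  narrowLowersFormula-suc n U L s zero =
    trans (cong₂ _+_ (U s 0 0) (L s 1))
          (lemma (width s) (holes s) (α (suc n)) (β (suc n)) (α n) (β n)
            (P₀ n) (P₁ n) (Q₀ n) (Q₁ n) (Q₂ n))
    where
    lemma : ∀ t κ α′ β′ α β P₀ P₁ Q₀ Q₁ Q₂ →
      (t - + 2 - κ * 1ℤ) * (P₀ + (0ℤ + 0ℤ + + 4) * Q₀ + Q₁) - κ * 1ℤ * (α + (0ℤ + + 4) * β)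
      + ((t - + 2) * (P₁ + (1ℤ + + 3) * Q₁ + Q₂)
         - κ * (0ℤ * (P₀ - α + + 4 * (Q₀ - β) + (Q₁ - (Q₀ - β)))
                + (P₀ - α + (1ℤ + + 4) * (Q₀ - β) + (Q₁ - (Q₀ - β)))))
      ≡ (t - + 2) * ((P₀ + P₁) + (0ℤ + + 3) * (Q₀ + Q₁) + (Q₀ + + 2 * Q₁ + Q₂))
        - κ * (1ℤ * (α′ + P₀ - α′ + + 4 * (β′ + Q₀ - β′) + (Q₀ + Q₁ - (β′ + Q₀ - β′)))
               + (α′ + P₀ - α′ + (0ℤ + + 4) * (β′ + Q₀ - β′) + (Q₀ + Q₁ - (β′ + Q₀ - β′))))
    lemma = solve-∀
  narrowLowersFormula-suc n U L s (suc c) =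
    trans (cong₂ _+_ (U s (suc c) 0) (L s (suc (suc c))))
          (lemma (width s) (holes s) (+ suc c) (α (suc n)) (β (suc n)) (α n) (β n)
            (P₀ n) (P₁ n) (Q₀ n) (Q₁ n) (Q₂ n))
    where
    lemma : ∀ t κ c α′ β′ α β P₀ P₁ Q₀ Q₁ Q₂ →
      (t - + 2 - κ * 0ℤ) * (P₀ + (c + 0ℤ + + 4) * Q₀ + Q₁) - κ * 1ℤ * (α + (c + + 4) * β)
      + ((t - + 2) * (P₁ + ((1ℤ + c) + + 3) * Q₁ + Q₂)
         - κ * (0ℤ * (P₀ - α + + 4 * (Q₀ - β) + (Q₁ - (Q₀ - β)))
                + (P₀ - α + ((1ℤ + c) + + 4) * (Q₀ - β) + (Q₁ - (Q₀ - β)))))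
      ≡ (t - + 2) * ((P₀ + P₁) + (c + + 3) * (Q₀ + Q₁) + (Q₀ + + 2 * Q₁ + Q₂))
        - κ * (0ℤ * (α′ + P₀ - α′ + + 4 * (β′ + Q₀ - β′) + (Q₀ + Q₁ - (β′ + Q₀ - β′)))
               + (α′ + P₀ - α′ + (c + + 4) * (β′ + Q₀ - β′) + (Q₀ + Q₁ - (β′ + Q₀ - β′))))
    lemma = solve-∀

  wideLowersFormula-suc : ∀ n → WideUppersFormula n → WideLowersFormula n →
    WideLowersFormula (suc n)
  wideLowersFormula-suc n U L s zero =
    trans (cong₂ _+_ (U s 0 0) (L s 1))
          (lemma (width s - + 3 + slack s) (roomBelow s) (roomAbove s)
            (α (suc n)) (β (suc n)) (X (suc n)) (Y (suc n)) (α n) (β n) (X n) (Y n)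
            (P₀ n) (P₁ n) (Q₀ n) (Q₁ n) (Q₂ n) (R n) (S n) (T n) (Y′ n))
    where
    lemma : ∀ t l r α′ β′ X′ Y′ α β X Y P₀ P₁ Q₀ Q₁ Q₂ R S T y →
      (t - r * 1ℤ) * (P₀ + (0ℤ + 0ℤ + + 5) * Q₀ + Q₁ - R - (+ 2 - 1ℤ) * S + 1ℤ * Y)
        - l * 1ℤ * (α + (0ℤ + + 5) * β - X - (1ℤ - 1ℤ) * Y)
      + (t * (P₁ + (1ℤ + + 4) * Q₁ + Q₂ - T + (1ℤ + 0ℤ) * (S - Y))
        - r * 0ℤ * (P₀ - α + + 5 * (Q₀ - β) + (Q₁ - (Q₀ - β)) - (R - X) - (S - Y) + y)
        - l * (P₀ - α + (1ℤ + + 5) * (Q₀ - β) + (Q₁ - (Q₀ - β)) - (R - X) - (S - Y) + 0ℤ * y))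
      ≡ t * ((P₀ + P₁) + (0ℤ + + 4) * (Q₀ + Q₁) + (Q₀ + + 2 * Q₁ + Q₂) - (R + + 2 * S + T)
             + (1ℤ + 1ℤ) * (Y′ + S - Y′))
        - r * 1ℤ * (α′ + P₀ - α′ + + 5 * (β′ + Q₀ - β′) + (Q₀ + Q₁ - (β′ + Q₀ - β′))
                    - (X′ + R - X′) - (Y′ + S - Y′) + Y)
        - l * (α′ + P₀ - α′ + (0ℤ + + 5) * (β′ + Q₀ - β′) + (Q₀ + Q₁ - (β′ + Q₀ - β′))
               - (X′ + R - X′) - (Y′ + S - Y′) + 1ℤ * Y)
    lemma = solve-∀
  wideLowersFormula-suc n U L s (suc c) =
    trans (cong₂ _+_ (U s (suc c) 0) (L s (suc (suc c))))
          (lemma (width s - + 3 + slack s) (roomBelow s) (roomAbove s) (+ suc c)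
            (α (suc n)) (β (suc n)) (X (suc n)) (Y (suc n)) (α n) (β n) (X n) (Y n)
            (P₀ n) (P₁ n) (Q₀ n) (Q₁ n) (Q₂ n) (R n) (S n) (T n) (Y′ n))
    where
    lemma : ∀ t l r c α′ β′ X′ Y′ α β X Y P₀ P₁ Q₀ Q₁ Q₂ R S T y →
      (t - r * 0ℤ) * (P₀ + (c + 0ℤ + + 5) * Q₀ + Q₁ - R - (+ 2 - 0ℤ) * S + 1ℤ * Y)
        - l * 1ℤ * (α + (c + + 5) * β - X - (1ℤ - 0ℤ) * Y)
      + (t * (P₁ + ((1ℤ + c) + + 4) * Q₁ + Q₂ - T + (1ℤ + 0ℤ) * (S - Y))
        - r * 0ℤ * (P₀ - α + + 5 * (Q₀ - β) + (Q₁ - (Q₀ - β)) - (R - X) - (S - Y) + y)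
        - l * (P₀ - α + ((1ℤ + c) + + 5) * (Q₀ - β) + (Q₁ - (Q₀ - β)) - (R - X) - (S - Y) + 0ℤ * y))
      ≡ t * ((P₀ + P₁) + (c + + 4) * (Q₀ + Q₁) + (Q₀ + + 2 * Q₁ + Q₂) - (R + + 2 * S + T)
             + (1ℤ + 0ℤ) * (Y′ + S - Y′))
        - r * 0ℤ * (α′ + P₀ - α′ + + 5 * (β′ + Q₀ - β′) + (Q₀ + Q₁ - (β′ + Q₀ - β′))
                    - (X′ + R - X′) - (Y′ + S - Y′) + Y)
        - l * (α′ + P₀ - α′ + (c + + 5) * (β′ + Q₀ - β′) + (Q₀ + Q₁ - (β′ + Q₀ - β′))
               - (X′ + R - X′) - (Y′ + S - Y′) + 0ℤ * Y)
    lemma = solve-∀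

  -- A new column starts with sizes 0, where every `δ` of the sizes is 1. Collecting the
  -- coefficients of 1, `width`, `slack`, `holes` and the rooms yields `α⁺`, `β⁺`, `Lᵛ`, `X⁺` and
  -- `Y⁺`; this is the origin of the first five rows of `transition`.
  chainsFormula-suc : ∀ n → OnesFormula n → NarrowLowersFormula n → WideLowersFormula n →
    ChainsFormula (suc n)
  chainsFormula-suc n O N W s =
    trans (cong₂ _+_ (O s 0) (cong₂ _+_ (N s 0) (W s 0)))
          (lemma (width s) (slack s) (holes s) (roomBelow s) (roomAbove s)
            (α n) (β n) (γ n) (X n) (Y n) (P₀ n) (P₁ n) (Q₀ n) (Q₁ n) (Q₂ n) (R n) (S n) (T n) (Y′ n))
    where
    lemma : ∀ t e κ l r α β γ X Y P₀ P₁ Q₀ Q₁ Q₂ R S T y →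
      let p = P₀ - α; q₀ = Q₀ - β; q₁ = Q₁ - q₀; L = P₁ + + 4 * Q₁ + Q₂ - T + + 2 * (S - Y)
          N = P₁ + + 3 * Q₁ + Q₂ in
      (t + 0ℤ) * (P₀ + (0ℤ + + 2) * Q₀ + Q₁) + P₁ + (0ℤ + + 2) * Q₁ + Q₂
        + 1ℤ * (t * γ - κ * (α + + 2 * β + γ))
      + ((t - + 2) * (P₁ + (0ℤ + + 3) * Q₁ + Q₂)
         - κ * (1ℤ * (p + + 4 * q₀ + q₁) + (p + (0ℤ + + 4) * q₀ + q₁))
        + ((t - + 3 + e) * (P₁ + (0ℤ + + 4) * Q₁ + Q₂ - T + (1ℤ + 1ℤ) * (S - Y))
           - r * 1ℤ * (p + + 5 * q₀ + q₁ - (R - X) - (S - Y) + y)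
           - l * (p + (0ℤ + + 5) * q₀ + q₁ - (R - X) - (S - Y) + 1ℤ * y)))
      ≡ (P₁ + + 2 * Q₁ + Q₂ - + 2 * N - + 3 * L)
        + (P₀ + + 2 * Q₀ + Q₁ + γ + N + L) * t + L * e
        - κ * (α + + 2 * β + γ + + 2 * (p + + 4 * q₀ + q₁))
        - (l + r) * (p + + 5 * q₀ + q₁ - (R - X) - (S - Y) + y)
    lemma = solve-∀

  record Formulas (n : ℕ) : Set where
    field
      chainsF       : ChainsFormula n
      onesF         : OnesFormula n
      narrowUppersF : NarrowUppersFormula n
      wideUppersF   : WideUppersFormula n
      narrowLowersF : NarrowLowersFormula n
      wideLowersF   : WideLowersFormula n

  open Formulas

  -- The formula for `chains` at n + 1 comes from the sums at n, while the sums over the last size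
  -- at n + 1 already use it; it is therefore established first.
  formulas : ∀ n → Formulas n
  formulas zero = record
    { chainsF       = chainsFormula-zero
    ; onesF         = onesFormula-zero
    ; narrowUppersF = narrowUppersFormula-zero
    ; wideUppersF   = wideUppersFormula-zero
    ; narrowLowersF = narrowLowersFormula-zero
    ; wideLowersF   = wideLowersFormula-zero
    }
  formulas (suc n) = record
    { chainsF       = F
    ; onesF         = onesFormula-suc n F (onesF ih)
    ; narrowUppersF = narrowUppersFormula-suc n F (narrowUppersF ih)
    ; wideUppersF   = wideUppersFormula-suc n F (wideUppersF ih)
    ; narrowLowersF = narrowLowersFormula-suc n (narrowUppersF ih) (narrowLowersF ih)
    ; wideLowersF   = wideLowersFormula-suc n (wideUppersF ih) (wideLowersF ih)
    }
    where
    ih : Formulas n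
    ih = formulas n
    F : ChainsFormula (suc n)
    F = chainsFormula-suc n (onesF ih) (narrowLowersF ih) (wideLowersF ih)

  -- The first column is not placed relative to another one. Each size has weight 1, and the moments
  -- are of one order less than in `OnesFormula`.
  startsFormula : ∀ n a → + startsFrom n a ≡ P₀ n + (+ a + + 2) * Q₀ n + Q₁ n + δ a * γ n
  startsFormula zero a = lemma (+ a) (δ a)
    where
    lemma : ∀ a d → 1ℤ ≡ 1ℤ + (a + + 2) * 0ℤ + 0ℤ + d * 0ℤ
    lemma = solve-∀
  startsFormula (suc n) a =
    trans (cong₂ _+_ (chainsF (formulas (suc n)) (one a)) (startsFormula n (suc a)))
          (lemma (+ a) (δ a) (α (suc n)) (β (suc n)) (γ (suc n)) (X (suc n)) (Y (suc n))
            (P₀ n) (Q₀ n) (Q₁ n) (γ n))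
    where
    lemma : ∀ a d α β γ X Y P₀ Q₀ Q₁ g →
      α + β * (a + + 2) + γ * d - 0ℤ * X - (0ℤ + 0ℤ) * Y
      + (P₀ + ((1ℤ + a) + + 2) * Q₀ + Q₁ + 0ℤ * g)
      ≡ (α + P₀) + (a + + 2) * (β + Q₀) + (Q₀ + Q₁) + d * γ
    lemma = solve-∀

-- The linear recurrence and the quotient of power series.

module GeneratingFunction where

  open LinearArithmetic
    using (_:+_; _:·_; Form; Expr; form; eval; ⟦_⟧ᵉ; combination; eval-combination; eval-form;
           dot; dot-replicate)
  open Counting
  open import Data.Integer using (ℤ; +_; -_; 0ℤ; 1ℤ; _+_; _-_; _*_)
  open import Data.Integer.Properties using (i-j≡0⇒i≡j; +-identityˡ; *-zeroˡ)
  open import Data.Integer.Tactic.RingSolver using (solve-∀)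
  open import Data.List using (List; []; _∷_; foldr; length; applyUpTo)
  open import Data.Nat as ℕ using (ℕ; zero; suc; _∸_)
  import Data.Nat.Properties as ℕ
  open import Data.Sum using (inj₁; inj₂)
  open import Relation.Nullary using (yes; no)
  open import Data.Product using (_,_)
  open import Data.Vec as Vec using (Vec; []; _∷_)
  open import Data.Bool using (Bool; true; false; _∧_)
  open import Relation.Nullary using (yes; no)
  open import Relation.Binary.PropositionalEquality
    using (_≡_; refl; sym; trans; cong; cong₂; subst)

  zeroForm : ∀ {k} → Form k
  zeroForm = 0ℤ , Vec.replicate _ 0ℤ

  eval-zeroForm : ∀ {k} (ρ : Vec ℤ k) → eval zeroForm ρ ≡ 0ℤ
  eval-zeroForm ρ = trans (+-identityˡ _) (dot-replicate ρ)

  eval-cons : ∀ {k} a (l l′ : Form k) ρ →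
    eval (combination a l 1ℤ l′) ρ ≡ a * eval l ρ + eval l′ ρ
  eval-cons a l l′ ρ = trans (eval-combination a l 1ℤ l′ ρ) (lemma a (eval l ρ) (eval l′ ρ))
    where
    lemma : ∀ a x y → a * x + 1ℤ * y ≡ a * x + y
    lemma = solve-∀

  -- The pullback of an affine form along a linear map. Iterated along `transition` it gives the
  -- form that predicts the output i steps ahead.
  compose : ∀ {j k} → Form j → Vec (Expr k) j → Form k
  compose (c , [])     []       = c , Vec.replicate _ 0ℤ
  compose (c , a ∷ as) (e ∷ es) = combination a (form e) 1ℤ (compose (c , as) es)

  eval-compose : ∀ {j k} (l : Form j) (es : Vec (Expr k) j) ρ →
    eval (compose l es) ρ ≡ eval l (Vec.map (λ e → ⟦ e ⟧ᵉ ρ) es)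
  eval-compose (c , [])     []       ρ = cong (_+_ c) (dot-replicate ρ)
  eval-compose (c , a ∷ as) (e ∷ es) ρ =
    trans (eval-cons a (form e) (compose (c , as) es) ρ)
          (trans (cong₂ (λ x y → a * x + y) (eval-form e ρ) (eval-compose (c , as) es ρ))
                 (lemma c (a * ⟦ e ⟧ᵉ ρ) (dot as (Vec.map (λ e → ⟦ e ⟧ᵉ ρ) es))))
    where
    lemma : ∀ c x y → x + (c + y) ≡ c + (x + y)
    lemma = solve-∀

  outputᵛ : Expr 14
  outputᵛ = P₀ᵛ :+ (+ 2) :· Q₀ᵛ :+ Q₁ᵛ :+ γᵛ

  -- The value at 0 is not read off a state. As the denominator has degree 11, this value occurs in
  -- the convolution up to index 11, so the recurrence is claimed from index 12 on and the twelve
  -- coefficients before are compared by evaluation.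
  output : ℕ → ℤ
  output zero    = 0ℤ
  output (suc n) = ⟦ outputᵛ ⟧ᵉ (state n)

  cheesyCount-output : ∀ n → + cheesyCount n ≡ output n
  cheesyCount-output zero    = refl
  cheesyCount-output (suc n) = trans (startsFormula n 0) (lemma (P₀ n) (Q₀ n) (Q₁ n) (γ n))
    where
    lemma : ∀ p q₀ q₁ g → p + (0ℤ + + 2) * q₀ + q₁ + 1ℤ * g ≡ p + + 2 * q₀ + q₁ + g
    lemma = solve-∀

  outputForm : ℕ → Form 14
  outputForm zero    = form outputᵛ
  outputForm (suc i) = compose (outputForm i) transition

  eval-outputForm : ∀ i n → eval (outputForm i) (state n) ≡ output (suc (i ℕ.+ n))
  eval-outputForm zero    n = eval-form outputᵛ (state n)
  eval-outputForm (suc i) n =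
    trans (eval-compose (outputForm i) transition (state n))
          (trans (eval-outputForm i (suc n)) (cong output (cong suc (ℕ.+-suc i n))))

  Σₚ : (ℕ → ℤ) → ℕ → ℤ
  Σₚ f n = foldr _+_ 0ℤ (applyUpTo f n)

  Σₚ-zero : ∀ f n → (∀ i → f i ≡ 0ℤ) → Σₚ f n ≡ 0ℤ
  Σₚ-zero f zero    f≡0 = refl
  Σₚ-zero f (suc n) f≡0 = cong₂ _+_ (f≡0 0) (Σₚ-zero (λ i → f (suc i)) n (λ i → f≡0 (suc i)))

  Σₚ-cong : ∀ f g n → (∀ i → f i ≡ g i) → Σₚ f n ≡ Σₚ g n
  Σₚ-cong f g zero    f≡g = refl
  Σₚ-cong f g (suc n) f≡g =
    cong₂ _+_ (f≡g 0) (Σₚ-cong (λ i → f (suc i)) (λ i → g (suc i)) n (λ i → f≡g (suc i)))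

  weighted : List ℤ → ℕ → Form 14
  weighted []       i = zeroForm
  weighted (d ∷ ds) i = combination d (outputForm i) 1ℤ (weighted ds (i ∸ 1))

  -- The nonzero terms of the convolution pair the coefficient with index j ≤ i with the output at i
  -- + 1 + n - j. That index is greater than n, so all these outputs are linear in the single state
  -- at n.
  weighted-output : ∀ ds i n → length ds ≡ suc i →
    (poly ds ⊛ output) (suc i ℕ.+ n) ≡ eval (weighted ds i) (state n)
  weighted-output (d ∷ []) zero n refl =
    trans (cong₂ (λ x y → d * x + y) (sym (eval-outputForm 0 n))
                 (trans (Σₚ-zero _ (suc n) (λ j → *-zeroˡ (output (n ∸ j))))
                        (sym (eval-zeroForm (state n)))))
          (sym (eval-cons d (outputForm 0) zeroForm (state n)))
  weighted-output (d ∷ ds@(_ ∷ _)) (suc i) n eq =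
    trans (cong₂ (λ x y → d * x + y) (sym (eval-outputForm (suc i) n))
                 (weighted-output ds i n (cong ℕ.pred eq)))
          (sym (eval-cons d (outputForm (suc i)) (weighted ds i) (state n)))

  denominatorCoefficients : List ℤ
  denominatorCoefficients =
    + 1 ∷ - + 9 ∷ + 27 ∷ - + 31 ∷ + 8 ∷ + 4 ∷ - + 2 ∷ + 16 ∷ - + 5 ∷ - + 16 ∷ - + 2 ∷ + 5 ∷ []

  isZero : ℤ → Bool
  isZero (+ 0) = true
  isZero _     = false

  vanishes : ∀ {k} → Vec ℤ k → Bool
  vanishes []       = true
  vanishes (a ∷ as) = isZero a ∧ vanishes as

  dot-vanishes : ∀ {k} (as : Vec ℤ k) ρ → vanishes as ≡ true → dot as ρ ≡ 0ℤ
  dot-vanishes []          []      _ = refl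
  dot-vanishes (+ 0 ∷ as)  (x ∷ ρ) v = cong₂ _+_ (*-zeroˡ x) (dot-vanishes as ρ v)

  vanishesᶠ : ∀ {k} → Form k → Bool
  vanishesᶠ (c , as) = isZero c ∧ vanishes as

  eval-vanishes : ∀ {k} (l : Form k) ρ → vanishesᶠ l ≡ true → eval l ρ ≡ 0ℤ
  eval-vanishes (+ 0 , as) ρ v = trans (+-identityˡ _) (dot-vanishes as ρ v)

  -- The recurrence for output holds identically as a linear form in the state.
  annihilation : vanishesᶠ (weighted denominatorCoefficients 11) ≡ true
  annihilation = refl

  -- With variables for the coefficients, `weighted ds i` stays unevaluated in this argument; the
  -- concrete form is computed in `annihilation`.
  annihilation⇒recurrence : ∀ D ds i → D ≡ poly ds → length ds ≡ suc i →
    vanishesᶠ (weighted ds i) ≡ true → ∀ n → (D ⊛ output) (suc i ℕ.+ n) ≡ 0ℤ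
  annihilation⇒recurrence _ ds i refl len v n =
    trans (weighted-output ds i n len) (eval-vanishes (weighted ds i) (state n) v)

  recurrence : ∀ n → (denominator ⊛ output) (suc 11 ℕ.+ n) ≡ 0ℤ
  recurrence = annihilation⇒recurrence denominator denominatorCoefficients 11 refl refl annihilation

  q⊛-suc : ∀ f n → (q ⊛ f) (suc n) ≡ f n
  q⊛-suc f n =
    trans (cong₂ (λ x y → x + (1ℤ * f n + y)) (*-zeroˡ (f (suc n)))
                 (Σₚ-zero _ n λ i → *-zeroˡ (f (n ∸ suc i))))
          (lemma (f n))
    where
    lemma : ∀ x → 0ℤ + (1ℤ * x + 0ℤ) ≡ x
    lemma = solve-∀

  poly-degree : ∀ as n → poly as (length as ℕ.+ n) ≡ 0ℤ
  poly-degree []       n = refl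
  poly-degree (_ ∷ as) n = poly-degree as n

  numeratorCoefficients : List ℤ
  numeratorCoefficients =
    + 1 ∷ - + 6 ∷ + 11 ∷ - + 6 ∷ - + 1 ∷ + 0 ∷ - + 3 ∷ + 5 ∷ + 4 ∷ - + 3 ∷ - + 3 ∷ []

  numerator-degree : ∀ n → numerator (suc 11 ℕ.+ n) ≡ 0ℤ
  numerator-degree n =
    trans (q⊛-suc (poly numeratorCoefficients) (11 ℕ.+ n)) (poly-degree numeratorCoefficients n)

  isZero-sound : ∀ z → isZero z ≡ true → z ≡ 0ℤ
  isZero-sound (+ 0) _ = refl

  agreesBelow : ℕ → PowerSeries → PowerSeries → Bool
  agreesBelow zero    f g = true
  agreesBelow (suc n) f g = isZero (f n - g n) ∧ agreesBelow n f g

  agreesBelow-sound : ∀ n f g → agreesBelow n f g ≡ true → ∀ {i} → i ℕ.< n → f i ≡ g i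
  agreesBelow-sound (suc n) f g agrees i<1+n
    with isZero (f n - g n) in eq | agreesBelow n f g in eq′ | ℕ.m<1+n⇒m<n∨m≡n i<1+n
  ... | true | true | inj₁ i<n  = agreesBelow-sound n f g eq′ i<n
  ... | true | true | inj₂ refl = i-j≡0⇒i≡j (f n) (g n) (isZero-sound _ eq)

  agreement : agreesBelow (suc 11) (denominator ⊛ output) numerator ≡ true
  agreement = refl

  ≈ₚ-from-agreement : ∀ m f g → agreesBelow m f g ≡ true →
    (∀ n → f (m ℕ.+ n) ≡ 0ℤ) → (∀ n → g (m ℕ.+ n) ≡ 0ℤ) → f ≈ₚ g
  ≈ₚ-from-agreement m f g agrees f≡0 g≡0 n with n ℕ.<? m
  ... | yes n<m = agreesBelow-sound m f g agrees n<m
  ... | no  n≮m = subst (λ i → f i ≡ g i) (ℕ.m+[n∸m]≡n (ℕ.≮⇒≥ n≮m))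
    (trans (f≡0 (n ∸ m)) (sym (g≡0 (n ∸ m))))

  ⊛-congˡ : ∀ f {g h} → g ≈ₚ h → f ⊛ g ≈ₚ f ⊛ h
  ⊛-congˡ f g≈h n = Σₚ-cong _ _ (suc n) λ i → cong (f i *_) (g≈h (n ∸ i))

  ≈ₚ-trans : ∀ {f g h} → f ≈ₚ g → g ≈ₚ h → f ≈ₚ h
  ≈ₚ-trans f≈g g≈h n = trans (f≈g n) (g≈h n)

  denominator-output : denominator ⊛ output ≈ₚ numerator
  denominator-output =
    ≈ₚ-from-agreement (suc 11) (denominator ⊛ output) numerator agreement recurrence numerator-degree

  cheesyCount-series : generatingSeries cheesyCount ≐ numerator ÷ denominator
  cheesyCount-series = refl ,
    ≈ₚ-trans {denominator ⊛ generatingSeries cheesyCount} {denominator ⊛ output} {numerator}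
      (⊛-congˡ denominator cheesyCount-output) denominator-output

-- Positions of a column relative to its left neighbour.

module Columns where

  open LinearArithmetic using (lin; _:≤_; _:<_; _:≡_; _:+_; _:-_; con; false; ⊢_; _⇒_)
  open Enumerations
  open Counting using (Gap; narrow; wide; Shape; one; two; placements; nonzero; absent)
  open import Data.Empty using (⊥)
  open import Data.Integer as ℤ using (ℤ; +_; 0ℤ; 1ℤ; _+_; _-_; _≤_; _<_)
  import Data.Integer.Properties as ℤ
  open import Data.List using (List; []; _∷_)
  open import Data.List.Relation.Unary.All as All using (All; []; _∷_)
  open import Data.List.Relation.Unary.Any using (Any; here; there)
  open import Data.Nat as ℕ using (ℕ; zero; suc)
  import Data.Nat.Properties as ℕ
  open import Data.Product using (∃-syntax; _×_; _,_; proj₂)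
  open import Data.Sum using (_⊎_; inj₁; inj₂)
  open import Data.Vec using ([]; _∷_)
  open import Function using (_∘_)
  open import Relation.Nullary using (¬_; yes; no)
  open import Relation.Binary.PropositionalEquality using (_≡_; _≢_; refl; trans)

  -- In (p , one a) the cells are p … p + a; in (p , two c g d) the lower component is
  -- p − c … p and the upper one has d + 1 cells.

  Column : Set
  Column = ℤ × Shape

  -- The distance from the top of the lower run to the bottom of the upper run, hence one more than
  -- the number of cells in the gap.
  rise : Gap → ℤ
  rise narrow = + 2
  rise wide   = + 3

  runs : Column → List Run
  runs (p , one a)     = run p (p + + a) ∷ []
  runs (p , two c g d) = run (p - + c) p ∷ run (p + rise g) (p + rise g + + d) ∷ []

  infix 4 _∈ᶜ_

  _∈ᶜ_ : ℤ → Column → Set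
  y ∈ᶜ C = Any (y ∈ᴿ_) (runs C)

  -- The two right-hand neighbours of a cell at height y have the heights y and y - 1.
  Touches : Column → Run → Set
  Touches L r = ∃[ y ] ∃[ y′ ] y ∈ᶜ L × y′ ∈ᴿ r × y - 1ℤ ≤ y′ × y′ ≤ y

  Attached : Column → Column → Set
  Attached L C = All (Touches L) (runs C)

  -- Touches, expressed by inequalities between the end points of the runs.
  Meets : Column → Run → Set
  Meets (p , one b)          r = bottom r ≤ p + + b × p - 1ℤ ≤ top r
  Meets (p , two c narrow d) r = bottom r ≤ p + + 2 + + d × p - + c - 1ℤ ≤ top r
  Meets (p , two c wide d)   r =
    bottom r ≤ p + + 3 + + d × p - + c - 1ℤ ≤ top r × ¬ (bottom r ≡ p + 1ℤ × top r ≡ p + 1ℤ)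

  ≤-<-connex : ∀ x y → x ≤ y ⊎ y < x
  ≤-<-connex x y with x ℤ.≤? y
  ... | yes x≤y = inj₁ x≤y
  ... | no  x≰y = inj₂ (ℤ.≰⇒> x≰y)

  -- The height p + 1 always lies in the gap. This lets many arguments treat both gap sizes alike.
  gap<rise : ∀ g → 1ℤ < rise g
  gap<rise narrow = ℤ.+<+ (ℕ.s≤s (ℕ.s≤s ℕ.z≤n))
  gap<rise wide   = ℤ.+<+ (ℕ.s≤s (ℕ.s≤s ℕ.z≤n))

  private
    spans : ∀ {a b s t y y′} → a ≤ y → y ≤ b → s ≤ y′ → y′ ≤ t → y - 1ℤ ≤ y′ → y′ ≤ y →
      s ≤ b × a - 1ℤ ≤ t
    spans {a} {b} {s} {t} {y} {y′} a≤y y≤b s≤y′ y′≤t lo hi =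
      lin [] (b ∷ s ∷ y ∷ y′ ∷ []) (λ b s y y′ → y :≤ b ⇒ s :≤ y′ ⇒ y′ :≤ y ⇒ ⊢ s :≤ b) refl y≤b s≤y′ hi ,
      lin [] (a ∷ t ∷ y ∷ y′ ∷ []) (λ a t y y′ →
        a :≤ y ⇒ y′ :≤ t ⇒ y :- con 1ℤ :≤ y′ ⇒ ⊢ a :- con 1ℤ :≤ t) refl a≤y y′≤t lo

    spans-lower : ∀ {p s t y y′} c g d → p - + c ≤ y → y ≤ p → s ≤ y′ → y′ ≤ t → y - 1ℤ ≤ y′ → y′ ≤ y →
      s ≤ p + rise g + + d × p - + c - 1ℤ ≤ t
    spans-lower {p} {s} c g d a≤y y≤b s≤y′ y′≤t lo hi =
      let s≤p , low = spans a≤y y≤b s≤y′ y′≤t lo hi in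
      lin (d ∷ []) (p ∷ s ∷ rise g ∷ []) (λ d p s r →
        s :≤ p ⇒ con 1ℤ :< r ⇒ ⊢ s :≤ p :+ r :+ d) refl s≤p (gap<rise g) , low

    spans-upper : ∀ {p s t y y′} c g d → p + rise g ≤ y → y ≤ p + rise g + + d →
      s ≤ y′ → y′ ≤ t → y - 1ℤ ≤ y′ → y′ ≤ y → s ≤ p + rise g + + d × p - + c - 1ℤ ≤ t
    spans-upper {p} {s} {t} c g d a≤y y≤b s≤y′ y′≤t lo hi =
      let high , q≤t = spans a≤y y≤b s≤y′ y′≤t lo hi in
      high , lin (c ∷ []) (p ∷ t ∷ rise g ∷ []) (λ c p t r →
        p :+ r :- con 1ℤ :≤ t ⇒ con 1ℤ :< r ⇒ ⊢ p :- c :- con 1ℤ :≤ t) refl q≤t (gap<rise g)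

  touches⇒meets : ∀ L r → Touches L r → Meets L r
  touches⇒meets (p , one b) r (y , y′ , here (a≤y , y≤b) , (s≤y′ , y′≤t) , lo , hi) =
    spans a≤y y≤b s≤y′ y′≤t lo hi
  touches⇒meets (p , two c narrow d) r (y , y′ , here (a≤y , y≤b) , (s≤y′ , y′≤t) , lo , hi) =
    spans-lower {p} c narrow d a≤y y≤b s≤y′ y′≤t lo hi
  touches⇒meets (p , two c narrow d) r (y , y′ , there (here (a≤y , y≤b)) , (s≤y′ , y′≤t) , lo , hi) =
    spans-upper {p} c narrow d a≤y y≤b s≤y′ y′≤t lo hi
  touches⇒meets (p , two c wide d) r (y , y′ , here (a≤y , y≤b) , (s≤y′ , y′≤t) , lo , hi) =
    let high , low = spans-lower {p} c wide d a≤y y≤b s≤y′ y′≤t lo hi in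
    high , low , λ (s≡ , _) → belowGap p (bottom r) y y′ y≤b s≤y′ hi s≡
    where
    belowGap : ∀ p s y y′ → y ≤ p → s ≤ y′ → y′ ≤ y → s ≡ p + 1ℤ → ⊥
    belowGap p s y y′ = lin [] (p ∷ s ∷ y ∷ y′ ∷ []) (λ p s y y′ →
      y :≤ p ⇒ s :≤ y′ ⇒ y′ :≤ y ⇒ s :≡ p :+ con 1ℤ ⇒ ⊢ false) refl
  touches⇒meets (p , two c wide d) r (y , y′ , there (here (a≤y , y≤b)) , (s≤y′ , y′≤t) , lo , hi) =
    let high , low = spans-upper {p} c wide d a≤y y≤b s≤y′ y′≤t lo hi in
    high , low , λ (_ , t≡) → aboveGap p (top r) y y′ a≤y y′≤t lo t≡
    where
    aboveGap : ∀ p t y y′ → p + + 3 ≤ y → y′ ≤ t → y - 1ℤ ≤ y′ → t ≡ p + 1ℤ → ⊥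
    aboveGap p t y y′ = lin [] (p ∷ t ∷ y ∷ y′ ∷ []) (λ p t y y′ →
      p :+ con (+ 3) :≤ y ⇒ y′ :≤ t ⇒ y :- con 1ℤ :≤ y′ ⇒ t :≡ p :+ con 1ℤ ⇒ ⊢ false) refl

  -- The candidates for the cell of r on the contact line are its two ends and the cells next to
  -- the gap of L.
  meets⇒touches : ∀ L r → bottom r ≤ top r → Meets L r → Touches L r
  meets⇒touches (p , one b) (run s t) s≤t (s≤p+b , p-1≤t) with ≤-<-connex p s
  ... | inj₁ p≤s = s , s , here (p≤s , s≤p+b) , (ℤ.≤-refl , s≤t) ,
    lin [] (s ∷ []) (λ s → ⊢ s :- con 1ℤ :≤ s) refl , ℤ.≤-refl
  ... | inj₂ s<p = p , p - 1ℤ ,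
    here (ℤ.≤-refl , lin (b ∷ []) (p ∷ []) (λ b p → ⊢ p :≤ p :+ b) refl) ,
    (lin [] (s ∷ p ∷ []) (λ s p → s :< p ⇒ ⊢ s :≤ p :- con 1ℤ) refl s<p , p-1≤t) ,
    ℤ.≤-refl , lin [] (p ∷ []) (λ p → ⊢ p :- con 1ℤ :≤ p) refl
  meets⇒touches (p , two c narrow d) (run s t) s≤t (s≤hi , lo≤t) with ≤-<-connex (p + + 2) s
  ... | inj₁ p+2≤s = s , s , there (here (p+2≤s , s≤hi)) , (ℤ.≤-refl , s≤t) ,
    lin [] (s ∷ []) (λ s → ⊢ s :- con 1ℤ :≤ s) refl , ℤ.≤-refl
  ... | inj₂ s<p+2 with ≤-<-connex (p + 1ℤ) t
  ... | inj₁ p+1≤t = p + + 2 , p + 1ℤ ,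
    there (here (ℤ.≤-refl , lin (d ∷ []) (p ∷ []) (λ d p → ⊢ p :+ con (+ 2) :≤ p :+ con (+ 2) :+ d) refl)) ,
    (lin [] (s ∷ p ∷ []) (λ s p → s :< p :+ con (+ 2) ⇒ ⊢ s :≤ p :+ con 1ℤ) refl s<p+2 , p+1≤t) ,
    lin [] (p ∷ []) (λ p → ⊢ p :+ con (+ 2) :- con 1ℤ :≤ p :+ con 1ℤ) refl ,
    lin [] (p ∷ []) (λ p → ⊢ p :+ con 1ℤ :≤ p :+ con (+ 2)) refl
  ... | inj₂ t<p+1 with ≤-<-connex (p - + c) t
  ... | inj₁ lo′≤t = t , t ,
    here (lo′≤t , lin [] (t ∷ p ∷ []) (λ t p → t :< p :+ con 1ℤ ⇒ ⊢ t :≤ p) refl t<p+1) ,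
    (s≤t , ℤ.≤-refl) , lin [] (t ∷ []) (λ t → ⊢ t :- con 1ℤ :≤ t) refl , ℤ.≤-refl
  ... | inj₂ t<lo′ = p - + c , t ,
    here (ℤ.≤-refl , lin (c ∷ []) (p ∷ []) (λ c p → ⊢ p :- c :≤ p) refl) ,
    (s≤t , ℤ.≤-refl) , lo≤t , ℤ.<⇒≤ t<lo′
  meets⇒touches (p , two c wide d) (run s t) s≤t (s≤hi , lo≤t , notGap) with ≤-<-connex (p + + 3) s
  ... | inj₁ p+3≤s = s , s , there (here (p+3≤s , s≤hi)) , (ℤ.≤-refl , s≤t) ,
    lin [] (s ∷ []) (λ s → ⊢ s :- con 1ℤ :≤ s) refl , ℤ.≤-refl
  ... | inj₂ s<p+3 with ≤-<-connex (p + + 2) t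
  ... | inj₁ p+2≤t = p + + 3 , p + + 2 ,
    there (here (ℤ.≤-refl , lin (d ∷ []) (p ∷ []) (λ d p → ⊢ p :+ con (+ 3) :≤ p :+ con (+ 3) :+ d) refl)) ,
    (lin [] (s ∷ p ∷ []) (λ s p → s :< p :+ con (+ 3) ⇒ ⊢ s :≤ p :+ con (+ 2)) refl s<p+3 , p+2≤t) ,
    lin [] (p ∷ []) (λ p → ⊢ p :+ con (+ 3) :- con 1ℤ :≤ p :+ con (+ 2)) refl ,
    lin [] (p ∷ []) (λ p → ⊢ p :+ con (+ 2) :≤ p :+ con (+ 3)) refl
  ... | inj₂ t<p+2 with ≤-<-connex p t
  ... | inj₁ p≤t = p , p ,
    here (lin (c ∷ []) (p ∷ []) (λ c p → ⊢ p :- c :≤ p) refl , ℤ.≤-refl) ,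
    (s≤p , p≤t) , lin [] (p ∷ []) (λ p → ⊢ p :- con 1ℤ :≤ p) refl , ℤ.≤-refl
    where
    s≤p : s ≤ p
    -- With p ≤ t < p + 2, a bottom above p would make the run the single cell p + 1, which is
    -- excluded.
    s≤p = ℤ.≮⇒≥ λ p<s → notGap
      ( lin [] (p ∷ s ∷ t ∷ []) (λ p s t → p :< s ⇒ s :≤ t ⇒ t :< p :+ con (+ 2) ⇒
          ⊢ s :≡ p :+ con 1ℤ) refl p<s s≤t t<p+2
      , lin [] (p ∷ s ∷ t ∷ []) (λ p s t → p :< s ⇒ s :≤ t ⇒ t :< p :+ con (+ 2) ⇒
          ⊢ t :≡ p :+ con 1ℤ) refl p<s s≤t t<p+2 )
  ... | inj₂ t<p with ≤-<-connex (p - + c) t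
  ... | inj₁ lo′≤t = t , t , here (lo′≤t , ℤ.<⇒≤ t<p) ,
    (s≤t , ℤ.≤-refl) , lin [] (t ∷ []) (λ t → ⊢ t :- con 1ℤ :≤ t) refl , ℤ.≤-refl
  ... | inj₂ t<lo′ = p - + c , t ,
    here (ℤ.≤-refl , lin (c ∷ []) (p ∷ []) (λ c p → ⊢ p :- c :≤ p) refl) ,
    (s≤t , ℤ.≤-refl) , lo≤t , ℤ.<⇒≤ t<lo′

  positions⇔ : ∀ L s {n} {P : ℤ → Set} → Enumeration P n →
    (∀ p → P p → All (Meets L) (runs (p , s))) → (∀ p → All (Meets L) (runs (p , s)) → P p) →
    Enumeration (λ p → Attached L (p , s)) n
  positions⇔ L s e to from = transport
    (λ p → attach p ∘ to p)
    (λ p → from p ∘ All.map (λ {r} → touches⇒meets L r))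
    e
    where
    nonempty : ∀ p s → All (λ r → bottom r ≤ top r) (runs (p , s))
    nonempty p (one a)     = lin (a ∷ []) (p ∷ []) (λ a p → ⊢ p :≤ p :+ a) refl ∷ []
    nonempty p (two c g d) =
      lin (c ∷ []) (p ∷ []) (λ c p → ⊢ p :- c :≤ p) refl ∷
      lin (d ∷ []) (p + rise g ∷ []) (λ d q → ⊢ q :≤ q :+ d) refl ∷ []
    attach : ∀ p → All (Meets L) (runs (p , s)) → Attached L (p , s)
    attach p ms = All.zipWith (λ {r} (m , i≤t) → meets⇒touches L r i≤t m) (ms , nonempty p s)

  zeroIndicator : ∀ a → (a ≡ 0 × nonzero a ≡ 0) ⊎ (¬ a ≡ 0 × nonzero a ≡ 1)
  zeroIndicator zero    = inj₁ (refl , refl)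
  zeroIndicator (suc _) = inj₂ ((λ ()) , refl)

  absentIndicator : ∀ a d →
    ((a ≡ 0 × 0 ℕ.< d) × absent a d ≡ 0) ⊎ (¬ (a ≡ 0 × 0 ℕ.< d) × absent a d ≡ 1)
  absentIndicator zero    zero    = inj₂ ((λ ()) , refl)
  absentIndicator zero    (suc d) = inj₁ ((refl , ℕ.z<s) , refl)
  absentIndicator (suc a) zero    = inj₂ ((λ ()) , refl)
  absentIndicator (suc a) (suc d) = inj₂ ((λ ()) , refl)

  oneInterval : ∀ lo hi t a → hi + 1ℤ ≡ lo + + t →
    Enumeration (λ y → y ≤ hi × lo ≤ y + + a) (t ℕ.+ a)
  oneInterval lo hi t a length≡ = transport
    (λ y (low , high) →
      lin (t ∷ a ∷ []) (lo ∷ hi ∷ y ∷ []) (λ t a lo hi y →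
        hi :+ con 1ℤ :≡ lo :+ t ⇒ y :< lo :- a :+ (t :+ a) ⇒ ⊢ y :≤ hi) refl length≡ high ,
      lin (a ∷ []) (lo ∷ y ∷ []) (λ a lo y → lo :- a :≤ y ⇒ ⊢ lo :≤ y :+ a) refl low)
    (λ y (high , low) →
      lin (a ∷ []) (lo ∷ y ∷ []) (λ a lo y → lo :≤ y :+ a ⇒ ⊢ lo :- a :≤ y) refl low ,
      lin (t ∷ a ∷ []) (lo ∷ hi ∷ y ∷ []) (λ t a lo hi y →
        hi :+ con 1ℤ :≡ lo :+ t ⇒ y :≤ hi ⇒ ⊢ y :< lo :- a :+ (t :+ a)) refl length≡ high)
    (interval (lo - + a) (t ℕ.+ a))

  -- Since the lower run lies below the upper one, only lo ≤ y and y + r ≤ hi are binding. The sizes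
  -- c and d drop out because y is the top of the lower run.
  twoInterval : ∀ lo hi r n c d → 0ℤ ≤ r → hi + 1ℤ ≡ lo + r + + n →
    Enumeration (λ y → (y - + c ≤ hi × lo ≤ y) × (y + r ≤ hi × lo ≤ y + r + + d)) n
  twoInterval lo hi r n c d 0≤r length≡ = transport
    (λ y (low , high) →
      ( lin (n ∷ c ∷ []) (lo ∷ hi ∷ r ∷ y ∷ []) (λ n c lo hi r y →
          con 0ℤ :≤ r ⇒ hi :+ con 1ℤ :≡ lo :+ r :+ n ⇒ y :< lo :+ n ⇒ ⊢ y :- c :≤ hi)
          refl 0≤r length≡ high
      , low ) ,
      ( lin (n ∷ []) (lo ∷ hi ∷ r ∷ y ∷ []) (λ n lo hi r y →
          hi :+ con 1ℤ :≡ lo :+ r :+ n ⇒ y :< lo :+ n ⇒ ⊢ y :+ r :≤ hi) refl length≡ high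
      , lin (d ∷ []) (lo ∷ r ∷ y ∷ []) (λ d lo r y →
          con 0ℤ :≤ r ⇒ lo :≤ y ⇒ ⊢ lo :≤ y :+ r :+ d) refl 0≤r low ))
    (λ { y ((_ , low) , (high , _)) → low ,
      lin (n ∷ []) (lo ∷ hi ∷ r ∷ y ∷ []) (λ n lo hi r y →
        hi :+ con 1ℤ :≡ lo :+ r :+ n ⇒ y :+ r :≤ hi ⇒ ⊢ y :< lo :+ n) refl length≡ high })
    (interval lo n)

  0≤rise : ∀ g → 0ℤ ≤ rise g
  0≤rise narrow = ℤ.+≤+ ℕ.z≤n
  0≤rise wide   = ℤ.+≤+ ℕ.z≤n

  onePositions : ∀ L a → Enumeration (λ y → Attached L (y , one a)) (placements (proj₂ L) (one a))
  onePositions (p , one b) a = positions⇔ (p , one b) (one a)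
    (oneInterval (p - 1ℤ) (p + + b) (b ℕ.+ 2) a
      (lin (b ∷ []) (p ∷ []) (λ b p → ⊢ p :+ b :+ con 1ℤ :≡ p :- con 1ℤ :+ (b :+ con (+ 2))) refl))
    (λ y m → m ∷ []) (λ { y (m ∷ []) → m })
  onePositions (p , two c narrow d) a = positions⇔ (p , two c narrow d) (one a)
    (oneInterval (p - + c - 1ℤ) (p + + 2 + + d) (c ℕ.+ d ℕ.+ 4) a
      (lin (c ∷ d ∷ []) (p ∷ []) (λ c d p →
        ⊢ p :+ con (+ 2) :+ d :+ con 1ℤ :≡ p :- c :- con 1ℤ :+ (c :+ d :+ con (+ 4))) refl))
    (λ y m → m ∷ []) (λ { y (m ∷ []) → m })
  onePositions (p , two c wide d) a = positions⇔ (p , two c wide d) (one a)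
    -- All positions meeting the hull are counted first, one more than the constant part of
    -- `placements`. Position p + 1 is then removed if the run is a single cell.
    (withoutWhen (p + 1ℤ) (zeroIndicator a) (λ { refl → inRange })
      (oneInterval (p - + c - 1ℤ) (p + + 3 + + d) (suc (c ℕ.+ d ℕ.+ 4)) a
        (lin (c ∷ d ∷ []) (p ∷ []) (λ c d p →
          ⊢ p :+ con (+ 3) :+ d :+ con 1ℤ :≡ p :- c :- con 1ℤ :+ (con 1ℤ :+ (c :+ d :+ con (+ 4)))) refl)))
    (λ { y ((high , low) , avoids) →
      (high , low , λ (y≡ , y+a≡) → avoids (ℤ.+-injective (a≡0 y y≡ y+a≡)) y≡) ∷ [] })
    (λ { y ((high , low , notGap) ∷ []) →
      (high , low) , λ { refl y≡ → notGap (y≡ , trans (ℤ.+-identityʳ y) y≡) } })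
    where
    inRange : p + 1ℤ ≤ p + + 3 + + d × p - + c - 1ℤ ≤ p + 1ℤ + + 0
    inRange =
      lin (d ∷ []) (p ∷ []) (λ d p → ⊢ p :+ con 1ℤ :≤ p :+ con (+ 3) :+ d) refl ,
      lin (c ∷ []) (p ∷ []) (λ c p → ⊢ p :- c :- con 1ℤ :≤ p :+ con 1ℤ :+ con (+ 0)) refl
    a≡0 : ∀ y → y ≡ p + 1ℤ → y + + a ≡ p + 1ℤ → + a ≡ 0ℤ
    a≡0 y = lin (a ∷ []) (p ∷ y ∷ []) (λ a p y →
      y :≡ p :+ con 1ℤ ⇒ y :+ a :≡ p :+ con 1ℤ ⇒ ⊢ a :≡ con 0ℤ) refl

  twoPositions : ∀ L a g b →
    Enumeration (λ y → Attached L (y , two a g b)) (placements (proj₂ L) (two a g b))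
  twoPositions (p , one b) a narrow d = positions⇔ (p , one b) (two a narrow d)
    (twoInterval (p - 1ℤ) (p + + b) (+ 2) b a d (0≤rise narrow)
      (lin (b ∷ []) (p ∷ []) (λ b p →
        ⊢ p :+ b :+ con 1ℤ :≡ p :- con 1ℤ :+ con (+ 2) :+ b) refl))
    (λ y (m , m′) → m ∷ m′ ∷ []) (λ { y (m ∷ m′ ∷ []) → m , m′ })
  -- A single cell offers two contact heights, too few for run ends that are three apart; here the
  -- subtraction in `placements` truncates.
  twoPositions (p , one zero) a wide d = positions⇔ (p , one zero) (two a wide d)
    (empty {P = λ _ → ⊥} λ _ ())
    (λ _ ()) (λ { y ((_ , low) ∷ (high , _) ∷ []) → tooNarrow y low high })
    where
    tooNarrow : ∀ y → p - 1ℤ ≤ y → y + + 3 ≤ p + 0ℤ → ⊥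
    tooNarrow y = lin [] (p ∷ y ∷ []) (λ p y →
      p :- con 1ℤ :≤ y ⇒ y :+ con (+ 3) :≤ p :+ con 0ℤ ⇒ ⊢ false) refl
  twoPositions (p , one (suc b)) a wide d = positions⇔ (p , one (suc b)) (two a wide d)
    (twoInterval (p - 1ℤ) (p + + suc b) (+ 3) b a d (0≤rise wide)
      (lin (b ∷ []) (p ∷ []) (λ b p →
        ⊢ p :+ (con 1ℤ :+ b) :+ con 1ℤ :≡ p :- con 1ℤ :+ con (+ 3) :+ b) refl))
    (λ y (m , m′) → m ∷ m′ ∷ []) (λ { y (m ∷ m′ ∷ []) → m , m′ })
  twoPositions (p , two c narrow d) a narrow b = positions⇔ (p , two c narrow d) (two a narrow b)
    (twoInterval (p - + c - 1ℤ) (p + + 2 + + d) (+ 2) (c ℕ.+ d ℕ.+ 2) a b (0≤rise narrow)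
      (lin (c ∷ d ∷ []) (p ∷ []) (λ c d p →
        ⊢ p :+ con (+ 2) :+ d :+ con 1ℤ :≡ p :- c :- con 1ℤ :+ con (+ 2) :+ (c :+ d :+ con (+ 2))) refl))
    (λ y (m , m′) → m ∷ m′ ∷ []) (λ { y (m ∷ m′ ∷ []) → m , m′ })
  twoPositions (p , two c narrow d) a wide b = positions⇔ (p , two c narrow d) (two a wide b)
    (twoInterval (p - + c - 1ℤ) (p + + 2 + + d) (+ 3) (c ℕ.+ d ℕ.+ 1) a b (0≤rise wide)
      (lin (c ∷ d ∷ []) (p ∷ []) (λ c d p →
        ⊢ p :+ con (+ 2) :+ d :+ con 1ℤ :≡ p :- c :- con 1ℤ :+ con (+ 3) :+ (c :+ d :+ con (+ 1))) refl))
    (λ y (m , m′) → m ∷ m′ ∷ []) (λ { y (m ∷ m′ ∷ []) → m , m′ })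
  twoPositions (p , two c wide d) a narrow b = positions⇔ (p , two c wide d) (two a narrow b)
    -- The missing height p + 1 is taken by the lower run when y is p + 1, and by the upper run,
    -- which starts at y + 2, when y is p - 1.
    (withoutWhen (p - 1ℤ) (zeroIndicator b) upperInRange
      (withoutWhen (p + 1ℤ) (zeroIndicator a) lowerInRange
        (twoInterval (p - + c - 1ℤ) (p + + 3 + + d) (+ 2) (suc (suc (c ℕ.+ d ℕ.+ 1))) a b (0≤rise narrow)
          (lin (c ∷ d ∷ []) (p ∷ []) (λ c d p →
            ⊢ p :+ con (+ 3) :+ d :+ con 1ℤ :≡
              p :- c :- con 1ℤ :+ con (+ 2) :+ (con (+ 2) :+ (c :+ d :+ con (+ 1)))) refl))))
    (λ { y ((((h , l) , (h′ , l′)) , avoids) , avoids′) →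
      (h , l , λ (y-a≡ , y≡) → avoids (ℤ.+-injective (a≡0 y y-a≡ y≡)) y≡) ∷
      (h′ , l′ , λ (u≡ , u+b≡) → avoids′ (ℤ.+-injective (b≡0 y u≡ u+b≡)) (y≡p-1 y u≡)) ∷ [] })
    (λ { y ((h , l , notGap) ∷ (h′ , l′ , notGap′) ∷ []) →
      (((h , l) , (h′ , l′)) , λ { refl y≡ → notGap (trans (ℤ.+-identityʳ y) y≡ , y≡) }) ,
      λ { refl y≡ → notGap′ (u≡p+1 y y≡ , trans (ℤ.+-identityʳ _) (u≡p+1 y y≡)) } })
    where
    a≡0 : ∀ y → y - + a ≡ p + 1ℤ → y ≡ p + 1ℤ → + a ≡ 0ℤ
    a≡0 y = lin (a ∷ []) (p ∷ y ∷ []) (λ a p y →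
      y :- a :≡ p :+ con 1ℤ ⇒ y :≡ p :+ con 1ℤ ⇒ ⊢ a :≡ con 0ℤ) refl
    b≡0 : ∀ y → y + + 2 ≡ p + 1ℤ → y + + 2 + + b ≡ p + 1ℤ → + b ≡ 0ℤ
    b≡0 y = lin (b ∷ []) (p ∷ y ∷ []) (λ b p y →
      y :+ con (+ 2) :≡ p :+ con 1ℤ ⇒ y :+ con (+ 2) :+ b :≡ p :+ con 1ℤ ⇒ ⊢ b :≡ con 0ℤ) refl
    y≡p-1 : ∀ y → y + + 2 ≡ p + 1ℤ → y ≡ p - 1ℤ
    y≡p-1 y = lin [] (p ∷ y ∷ []) (λ p y → y :+ con (+ 2) :≡ p :+ con 1ℤ ⇒ ⊢ y :≡ p :- con 1ℤ) refl
    u≡p+1 : ∀ y → y ≡ p - 1ℤ → y + + 2 ≡ p + 1ℤ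
    u≡p+1 y = lin [] (p ∷ y ∷ []) (λ p y → y :≡ p :- con 1ℤ ⇒ ⊢ y :+ con (+ 2) :≡ p :+ con 1ℤ) refl
    InRange : ℤ → Set
    InRange y = (y - + a ≤ p + + 3 + + d × p - + c - 1ℤ ≤ y) ×
                (y + + 2 ≤ p + + 3 + + d × p - + c - 1ℤ ≤ y + + 2 + + b)
    lowerInRange : a ≡ 0 → InRange (p + 1ℤ)
    lowerInRange _ =
      ( lin (a ∷ d ∷ []) (p ∷ []) (λ a d p → ⊢ p :+ con 1ℤ :- a :≤ p :+ con (+ 3) :+ d) refl
      , lin (c ∷ []) (p ∷ []) (λ c p → ⊢ p :- c :- con 1ℤ :≤ p :+ con 1ℤ) refl ) ,
      ( lin (d ∷ []) (p ∷ []) (λ d p → ⊢ p :+ con 1ℤ :+ con (+ 2) :≤ p :+ con (+ 3) :+ d) refl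
      , lin (b ∷ c ∷ []) (p ∷ []) (λ b c p →
          ⊢ p :- c :- con 1ℤ :≤ p :+ con 1ℤ :+ con (+ 2) :+ b) refl )
    upperInRange : b ≡ 0 → InRange (p - 1ℤ) × (a ≡ 0 → p - 1ℤ ≢ p + 1ℤ)
    upperInRange _ =
      (( lin (a ∷ d ∷ []) (p ∷ []) (λ a d p → ⊢ p :- con 1ℤ :- a :≤ p :+ con (+ 3) :+ d) refl
       , lin (c ∷ []) (p ∷ []) (λ c p → ⊢ p :- c :- con 1ℤ :≤ p :- con 1ℤ) refl ) ,
       ( lin (d ∷ []) (p ∷ []) (λ d p → ⊢ p :- con 1ℤ :+ con (+ 2) :≤ p :+ con (+ 3) :+ d) refl
       , lin (b ∷ c ∷ []) (p ∷ []) (λ b c p →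
           ⊢ p :- c :- con 1ℤ :≤ p :- con 1ℤ :+ con (+ 2) :+ b) refl )) ,
      λ _ → lin [] (p ∷ []) (λ p → p :- con 1ℤ :≡ p :+ con 1ℤ ⇒ ⊢ false) refl
  twoPositions (p , two c wide d) a wide b = positions⇔ (p , two c wide d) (two a wide b)
    -- The upper run now starts at y + 3, which gives p - 2. Neither position is automatically in
    -- the interval: p - c - 1 ≤ p - 2 needs 0 < c, and p + 4 ≤ p + 3 + d needs 0 < d.
    (withoutWhen (p - + 2) (absentIndicator b c) upperInRange
      (withoutWhen (p + 1ℤ) (absentIndicator a d) lowerInRange
        (twoInterval (p - + c - 1ℤ) (p + + 3 + + d) (+ 3) (suc (suc (c ℕ.+ d))) a b (0≤rise wide)
          (lin (c ∷ d ∷ []) (p ∷ []) (λ c d p →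
            ⊢ p :+ con (+ 3) :+ d :+ con 1ℤ :≡
              p :- c :- con 1ℤ :+ con (+ 3) :+ (con (+ 2) :+ (c :+ d))) refl))))
    (λ { y ((((h , l) , (h′ , l′)) , avoids) , avoids′) →
      (h , l , λ (y-a≡ , y≡) →
        avoids (ℤ.+-injective (a≡0 y y-a≡ y≡) , ℤ.drop‿+≤+ (0<d y y≡ h′)) y≡) ∷
      (h′ , l′ , λ (u≡ , u+b≡) →
        avoids′ (ℤ.+-injective (b≡0 y u≡ u+b≡) , ℤ.drop‿+≤+ (0<c y u≡ l)) (y≡p-2 y u≡)) ∷ [] })
    (λ { y ((h , l , notGap) ∷ (h′ , l′ , notGap′) ∷ []) →
      (((h , l) , (h′ , l′)) ,
        λ { (refl , _) y≡ → notGap (trans (ℤ.+-identityʳ y) y≡ , y≡) }) ,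
      λ { (refl , _) y≡ → notGap′ (u≡p+1 y y≡ , trans (ℤ.+-identityʳ _) (u≡p+1 y y≡)) } })
    where
    a≡0 : ∀ y → y - + a ≡ p + 1ℤ → y ≡ p + 1ℤ → + a ≡ 0ℤ
    a≡0 y = lin (a ∷ []) (p ∷ y ∷ []) (λ a p y →
      y :- a :≡ p :+ con 1ℤ ⇒ y :≡ p :+ con 1ℤ ⇒ ⊢ a :≡ con 0ℤ) refl
    b≡0 : ∀ y → y + + 3 ≡ p + 1ℤ → y + + 3 + + b ≡ p + 1ℤ → + b ≡ 0ℤ
    b≡0 y = lin (b ∷ []) (p ∷ y ∷ []) (λ b p y →
      y :+ con (+ 3) :≡ p :+ con 1ℤ ⇒ y :+ con (+ 3) :+ b :≡ p :+ con 1ℤ ⇒ ⊢ b :≡ con 0ℤ) refl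
    0<d : ∀ y → y ≡ p + 1ℤ → y + + 3 ≤ p + + 3 + + d → 1ℤ ≤ + d
    0<d y = lin (d ∷ []) (p ∷ y ∷ []) (λ d p y →
      y :≡ p :+ con 1ℤ ⇒ y :+ con (+ 3) :≤ p :+ con (+ 3) :+ d ⇒ ⊢ con 1ℤ :≤ d) refl
    0<c : ∀ y → y + + 3 ≡ p + 1ℤ → p - + c - 1ℤ ≤ y → 1ℤ ≤ + c
    0<c y = lin (c ∷ []) (p ∷ y ∷ []) (λ c p y →
      y :+ con (+ 3) :≡ p :+ con 1ℤ ⇒ p :- c :- con 1ℤ :≤ y ⇒ ⊢ con 1ℤ :≤ c) refl
    y≡p-2 : ∀ y → y + + 3 ≡ p + 1ℤ → y ≡ p - + 2
    y≡p-2 y = lin [] (p ∷ y ∷ []) (λ p y → y :+ con (+ 3) :≡ p :+ con 1ℤ ⇒ ⊢ y :≡ p :- con (+ 2)) refl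
    u≡p+1 : ∀ y → y ≡ p - + 2 → y + + 3 ≡ p + 1ℤ
    u≡p+1 y = lin [] (p ∷ y ∷ []) (λ p y → y :≡ p :- con (+ 2) ⇒ ⊢ y :+ con (+ 3) :≡ p :+ con 1ℤ) refl
    InRange : ℤ → Set
    InRange y = (y - + a ≤ p + + 3 + + d × p - + c - 1ℤ ≤ y) ×
                (y + + 3 ≤ p + + 3 + + d × p - + c - 1ℤ ≤ y + + 3 + + b)
    lowerInRange : a ≡ 0 × 0 ℕ.< d → InRange (p + 1ℤ)
    lowerInRange (_ , 0<d) =
      ( lin (a ∷ d ∷ []) (p ∷ []) (λ a d p → ⊢ p :+ con 1ℤ :- a :≤ p :+ con (+ 3) :+ d) refl
      , lin (c ∷ []) (p ∷ []) (λ c p → ⊢ p :- c :- con 1ℤ :≤ p :+ con 1ℤ) refl ) ,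
      ( lin (d ∷ []) (p ∷ []) (λ d p →
          con 1ℤ :≤ d ⇒ ⊢ p :+ con 1ℤ :+ con (+ 3) :≤ p :+ con (+ 3) :+ d) refl (ℤ.+≤+ 0<d)
      , lin (b ∷ c ∷ []) (p ∷ []) (λ b c p →
          ⊢ p :- c :- con 1ℤ :≤ p :+ con 1ℤ :+ con (+ 3) :+ b) refl )
    upperInRange : b ≡ 0 × 0 ℕ.< c → InRange (p - + 2) × (a ≡ 0 × 0 ℕ.< d → p - + 2 ≢ p + 1ℤ)
    upperInRange (_ , 0<c) =
      (( lin (a ∷ d ∷ []) (p ∷ []) (λ a d p → ⊢ p :- con (+ 2) :- a :≤ p :+ con (+ 3) :+ d) refl
       , lin (c ∷ []) (p ∷ []) (λ c p →
           con 1ℤ :≤ c ⇒ ⊢ p :- c :- con 1ℤ :≤ p :- con (+ 2)) refl (ℤ.+≤+ 0<c) ) ,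
       ( lin (d ∷ []) (p ∷ []) (λ d p → ⊢ p :- con (+ 2) :+ con (+ 3) :≤ p :+ con (+ 3) :+ d) refl
       , lin (b ∷ c ∷ []) (p ∷ []) (λ b c p →
           ⊢ p :- c :- con 1ℤ :≤ p :- con (+ 2) :+ con (+ 3) :+ b) refl )) ,
      λ _ → lin [] (p ∷ []) (λ p → p :- con (+ 2) :≡ p :+ con 1ℤ ⇒ ⊢ false) refl

-- Enumeration of chains of attached columns.

module Chains where

  open LinearArithmetic using (lin; _:≤_; _:<_; _:≡_; _:+_; con; false; ⊢_; _⇒_)
  open Enumerations
  open Columns
  open Counting
    using (Gap; narrow; wide; Shape; one; two; chains; onesFrom; lowersFrom; uppersFrom;
           startsFrom; cheesyCount)
  open import Data.Empty using (⊥; ⊥-elim)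
  open import Data.Integer as ℤ using (ℤ; +_; 0ℤ; 1ℤ)
  import Data.Integer.Properties as ℤ
  open import Data.List using (List; []; _∷_)
  open import Data.Nat as ℕ using (ℕ; zero; suc; _+_; _≤_; _<_)
  import Data.Nat.Properties as ℕ
  open import Data.Product using (∃-syntax; _×_; _,_; proj₁; proj₂)
  open import Data.Sum using (_⊎_; inj₁; inj₂)
  open import Data.Vec using ([]; _∷_)
  open import Relation.Binary.PropositionalEquality using (_≡_; _≢_; refl; sym; trans; cong)

  height : Column → ℕ
  height (p , one a)     = suc a
  height (p , two c g d) = suc c + suc d

  total : List Column → ℕ
  total []       = 0
  total (C ∷ Cs) = height C + total Cs

  data Chain : Column → List Column → Set where
    []  : ∀ {L} → Chain L []
    _∷_ : ∀ {L C Cs} → Attached L C → Chain C Cs → Chain L (C ∷ Cs)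

  ChainOf : ℕ → Column → List Column → Set
  ChainOf n L Cs = Chain L Cs × total Cs ≡ n

  StartsOne : ℕ → List Column → Set
  StartsOne a ((_ , one a′) ∷ _) = a ≤ a′
  StartsOne a _                  = ⊥

  StartsLower : Gap → ℕ → List Column → Set
  StartsLower g c ((_ , two c′ g′ _) ∷ _) = g′ ≡ g × c ≤ c′
  StartsLower g c _                       = ⊥

  StartsUpper : ℕ → Gap → ℕ → List Column → Set
  StartsUpper c g d ((_ , two c′ g′ d′) ∷ _) = c′ ≡ c × g′ ≡ g × d ≤ d′
  StartsUpper c g d _                        = ⊥

  data Placed (n : ℕ) (L : Column) (s : Shape) : List Column → Set where
    placed : ∀ {p Cs} → Attached L (p , s) → ChainOf n (p , s) Cs → Placed n L s ((p , s) ∷ Cs)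

  OnesFrom : ℕ → Column → ℕ → List Column → Set
  OnesFrom n L a Cs = ChainOf (suc a + n) L Cs × StartsOne a Cs

  LowersFrom : ℕ → Column → Gap → ℕ → List Column → Set
  LowersFrom n L g c Cs = ChainOf (suc c + n) L Cs × StartsLower g c Cs

  UppersFrom : ℕ → Column → ℕ → Gap → ℕ → List Column → Set
  UppersFrom n L c g d Cs = ChainOf (suc c + suc d + n) L Cs × StartsUpper c g d Cs

  private
    none-one : ∀ {a a′ t} → a < a′ → suc a′ + t ≢ suc a + 0
    none-one {a} {a′} {t} a<a′ eq = lin (a ∷ a′ ∷ t ∷ []) [] (λ a a′ t →
      a :< a′ ⇒ con 1ℤ :+ a′ :+ t :≡ con 1ℤ :+ a :+ con 0ℤ ⇒ ⊢ false) refl (ℤ.+<+ a<a′) (cong +_ eq)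

    none-lower : ∀ {c c′ d t} → c ≤ c′ → suc c′ + suc d + t ≢ suc c + 0
    none-lower {c} {c′} {d} {t} c≤c′ eq = lin (c ∷ c′ ∷ d ∷ t ∷ []) [] (λ c c′ d t →
      c :≤ c′ ⇒ con 1ℤ :+ c′ :+ (con 1ℤ :+ d) :+ t :≡ con 1ℤ :+ c :+ con 0ℤ ⇒ ⊢ false) refl
      (ℤ.+≤+ c≤c′) (cong +_ eq)

    none-upper : ∀ {c d d′ t} → d < d′ → suc c + suc d′ + t ≢ suc c + suc d + 0
    none-upper {c} {d} {d′} {t} d<d′ eq = lin (c ∷ d ∷ d′ ∷ t ∷ []) [] (λ c d d′ t →
      d :< d′ ⇒ con 1ℤ :+ c :+ (con 1ℤ :+ d′) :+ t :≡ con 1ℤ :+ c :+ (con 1ℤ :+ d) :+ con 0ℤ ⇒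
      ⊢ false) refl (ℤ.+<+ d<d′) (cong +_ eq)

    grow-lower : ∀ c n → suc c + 1 + n ≡ suc c + suc n
    grow-lower c n = ℤ.+-injective (lin (c ∷ n ∷ []) [] (λ c n →
      ⊢ con 1ℤ :+ c :+ con 1ℤ :+ n :≡ con 1ℤ :+ c :+ (con 1ℤ :+ n)) refl)

    grow-upper : ∀ c d n → suc c + suc (suc d) + n ≡ suc c + suc d + suc n
    grow-upper c d n = ℤ.+-injective (lin (c ∷ d ∷ n ∷ []) [] (λ c d n →
      ⊢ con 1ℤ :+ c :+ (con (+ 2) :+ d) :+ n :≡ con 1ℤ :+ c :+ (con 1ℤ :+ d) :+ (con 1ℤ :+ n)) refl)

  placedChains : ∀ n s → (∀ p → Enumeration (ChainOf n (p , s)) (chains n s)) →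
    ∀ L k → Enumeration (λ p → Attached L (p , s)) k → Enumeration (Placed n L s) (k ℕ.* chains n s)
  placedChains n s rest L k ps = image (λ (p , Cs) → (p , s) ∷ Cs)
    (λ { refl → refl })
    (λ { _ (attached , chain) → placed attached chain })
    (λ { _ (placed {p} {Cs} attached chain) → (p , Cs) , (attached , chain) , refl })
    (pairs ps rest)

  -- The four enumerations follow the recursion of the counting functions. The run under
  -- construction either has exactly the size reached so far or is longer; the second case is the
  -- recursive call with one cell less.
  chainsOf : ∀ n L → Enumeration (ChainOf n L) (chains n (proj₂ L))
  ones : ∀ n L a → Enumeration (OnesFrom n L a) (onesFrom n (proj₂ L) a)
  lowers : ∀ n L g c → Enumeration (LowersFrom n L g c) (lowersFrom n (proj₂ L) g c)
  uppers : ∀ n L c g d → Enumeration (UppersFrom n L c g d) (uppersFrom n (proj₂ L) c g d)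

  chainsOf zero    L = singleton [] ([] , refl) λ
    { []                       _        → refl
    ; ((_ , one _)     ∷ _) (_ , ())
    ; ((_ , two _ _ _) ∷ _) (_ , ())
    }
  chainsOf (suc n) L = transport
    (λ { _ (inj₁ (chain , _))        → chain
       ; _ (inj₂ (inj₁ (chain , _))) → chain
       ; _ (inj₂ (inj₂ (chain , _))) → chain
       })
    (λ { []                           (_ , ())
       ; ((_ , one _)          ∷ _) chain → inj₁ (chain , ℕ.z≤n)
       ; ((_ , two _ narrow _) ∷ _) chain → inj₂ (inj₁ (chain , refl , ℕ.z≤n))
       ; ((_ , two _ wide _)   ∷ _) chain → inj₂ (inj₂ (chain , refl , ℕ.z≤n))
       })
    (disjointUnion
      (λ { ((_ , one _)     ∷ _) _        (inj₁ (_ , ()))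
         ; ((_ , one _)     ∷ _) _        (inj₂ (_ , ()))
         ; ((_ , two _ _ _) ∷ _) (_ , ()) _
         })
      (ones n L 0)
      (disjointUnion
        (λ { ((_ , two _ _ _) ∷ _) (_ , refl , _) (_ , () , _) })
        (lowers n L narrow 0) (lowers n L wide 0)))

  ones zero    L a = transport
    (λ { _ (placed attached (chain , size)) →
           (attached ∷ chain , cong (_+_ (suc a)) size) , ℕ.≤-refl })
    (λ { ((_ , one a′) ∷ Cs) ((attached ∷ chain , size) , a≤a′) →
           from attached chain size (ℕ.m≤n⇒m<n∨m≡n a≤a′) })
    (placedChains 0 (one a) (λ p → chainsOf 0 (p , one a)) L _ (onePositions L a))
    where
    from : ∀ {p a′ Cs} → Attached L (p , one a′) → Chain (p , one a′) Cs →
      suc a′ + total Cs ≡ suc a + 0 → a < a′ ⊎ a ≡ a′ → Placed 0 L (one a) ((p , one a′) ∷ Cs)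
    from attached chain size (inj₁ a<a′) = ⊥-elim (none-one a<a′ size)
    from attached chain size (inj₂ refl) = placed attached (chain , ℕ.+-cancelˡ-≡ (suc a) _ _ size)
  ones (suc n) L a = transport
    (λ { _ (inj₁ (placed attached (chain , size))) →
           (attached ∷ chain , cong (_+_ (suc a)) size) , ℕ.≤-refl
       ; ((_ , one _) ∷ _) (inj₂ ((chain , size) , a<a′)) →
           (chain , trans size (sym (ℕ.+-suc (suc a) n))) , ℕ.<⇒≤ a<a′
       })
    (λ { ((_ , one a′) ∷ Cs) ((attached ∷ chain , size) , a≤a′) →
           from attached chain size (ℕ.m≤n⇒m<n∨m≡n a≤a′) })
    (disjointUnion
      (λ { _ (placed _ _) (_ , a<a) → ℕ.<-irrefl refl a<a })
      (placedChains (suc n) (one a) (λ p → chainsOf (suc n) (p , one a)) L _ (onePositions L a))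
      (ones n L (suc a)))
    where
    from : ∀ {p a′ Cs} → Attached L (p , one a′) → Chain (p , one a′) Cs →
      suc a′ + total Cs ≡ suc a + suc n → a < a′ ⊎ a ≡ a′ →
      Placed (suc n) L (one a) ((p , one a′) ∷ Cs) ⊎ OnesFrom n L (suc a) ((p , one a′) ∷ Cs)
    from attached chain size (inj₁ a<a′) =
      inj₂ ((attached ∷ chain , trans size (ℕ.+-suc (suc a) n)) , a<a′)
    from attached chain size (inj₂ refl) =
      inj₁ (placed attached (chain , ℕ.+-cancelˡ-≡ (suc a) _ _ size))

  lowers zero    L g c = empty λ
    { ((_ , two _ _ _) ∷ _) ((_ , size) , _ , c≤c′) → none-lower c≤c′ size }
  lowers (suc n) L g c = transport
    (λ { ((_ , two _ _ _) ∷ _) (inj₁ ((chain , size) , refl , refl , _)) →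
           (chain , trans size (grow-lower c n)) , refl , ℕ.≤-refl
       ; ((_ , two _ _ _) ∷ _) (inj₂ ((chain , size) , refl , c<c′)) →
           (chain , trans size (sym (ℕ.+-suc (suc c) n))) , refl , ℕ.<⇒≤ c<c′
       })
    (λ { ((_ , two _ _ _) ∷ _) ((chain , size) , refl , c≤c′) →
           from chain size (ℕ.m≤n⇒m<n∨m≡n c≤c′) })
    (disjointUnion
      (λ { ((_ , two _ _ _) ∷ _) (_ , refl , _) (_ , _ , c<c) → ℕ.<-irrefl refl c<c })
      (uppers n L c g 0)
      (lowers n L g (suc c)))
    where
    from : ∀ {p c′ d Cs} → Chain L ((p , two c′ g d) ∷ Cs) →
      total ((p , two c′ g d) ∷ Cs) ≡ suc c + suc n → c < c′ ⊎ c ≡ c′ →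
      UppersFrom n L c g 0 ((p , two c′ g d) ∷ Cs) ⊎ LowersFrom n L g (suc c) ((p , two c′ g d) ∷ Cs)
    from chain size (inj₁ c<c′) = inj₂ ((chain , trans size (ℕ.+-suc (suc c) n)) , refl , c<c′)
    from chain size (inj₂ refl) =
      inj₁ ((chain , trans size (sym (grow-lower c n))) , refl , refl , ℕ.z≤n)

  uppers zero    L c g d = transport
    (λ { _ (placed attached (chain , size)) →
           (attached ∷ chain , cong (_+_ (suc c + suc d)) size) , refl , refl , ℕ.≤-refl })
    (λ { ((_ , two _ _ _) ∷ _) ((attached ∷ chain , size) , refl , refl , d≤d′) →
           from attached chain size (ℕ.m≤n⇒m<n∨m≡n d≤d′) })
    (placedChains 0 (two c g d) (λ p → chainsOf 0 (p , two c g d)) L _ (twoPositions L c g d))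
    where
    from : ∀ {p d′ Cs} → Attached L (p , two c g d′) → Chain (p , two c g d′) Cs →
      suc c + suc d′ + total Cs ≡ suc c + suc d + 0 → d < d′ ⊎ d ≡ d′ →
      Placed 0 L (two c g d) ((p , two c g d′) ∷ Cs)
    from attached chain size (inj₁ d<d′) = ⊥-elim (none-upper {c} d<d′ size)
    from attached chain size (inj₂ refl) =
      placed attached (chain , ℕ.+-cancelˡ-≡ (suc c + suc d) _ _ size)
  uppers (suc n) L c g d = transport
    (λ { _ (inj₁ (placed attached (chain , size))) →
           (attached ∷ chain , cong (_+_ (suc c + suc d)) size) , refl , refl , ℕ.≤-refl
       ; ((_ , two _ _ _) ∷ _) (inj₂ ((chain , size) , refl , refl , d<d′)) →
           (chain , trans size (grow-upper c d n)) , refl , refl , ℕ.<⇒≤ d<d′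
       })
    (λ { ((_ , two _ _ _) ∷ _) ((attached ∷ chain , size) , refl , refl , d≤d′) →
           from attached chain size (ℕ.m≤n⇒m<n∨m≡n d≤d′) })
    (disjointUnion
      (λ { _ (placed _ _) (_ , _ , _ , d<d) → ℕ.<-irrefl refl d<d })
      (placedChains (suc n) (two c g d) (λ p → chainsOf (suc n) (p , two c g d)) L _ (twoPositions L c g d))
      (uppers n L c g (suc d)))
    where
    from : ∀ {p d′ Cs} → Attached L (p , two c g d′) → Chain (p , two c g d′) Cs →
      suc c + suc d′ + total Cs ≡ suc c + suc d + suc n → d < d′ ⊎ d ≡ d′ →
      Placed (suc n) L (two c g d) ((p , two c g d′) ∷ Cs) ⊎
      UppersFrom n L c g (suc d) ((p , two c g d′) ∷ Cs)
    from attached chain size (inj₁ d<d′) =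
      inj₂ ((attached ∷ chain , trans size (sym (grow-upper c d n))) , refl , refl , d<d′)
    from attached chain size (inj₂ refl) =
      inj₁ (placed attached (chain , ℕ.+-cancelˡ-≡ (suc c + suc d) _ _ size))

  -- A normalised polyomino has its first column at height 0; (a , Cs) stands for that column,
  -- with a + 1 cells, and the columns to its right.
  Normalised : ℕ → ℕ × List Column → Set
  Normalised n (a , Cs) = Chain (0ℤ , one a) Cs × suc a + total Cs ≡ n

  StartsFrom : ℕ → ℕ → ℕ × List Column → Set
  StartsFrom n a (a′ , Cs) = Normalised (suc a + n) (a′ , Cs) × a ≤ a′

  starts : ∀ n a → Enumeration (StartsFrom n a) (startsFrom n a)
  starts zero    a = image (a ,_) (λ { refl → refl })
    (λ { Cs (chain , size) → (chain , cong (_+_ (suc a)) size) , ℕ.≤-refl })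
    (λ { (a′ , Cs) ((chain , size) , a≤a′) → from chain size (ℕ.m≤n⇒m<n∨m≡n a≤a′) })
    (chainsOf 0 (0ℤ , one a))
    where
    from : ∀ {a′ Cs} → Chain (0ℤ , one a′) Cs → suc a′ + total Cs ≡ suc a + 0 → a < a′ ⊎ a ≡ a′ →
      ∃[ Cs′ ] ChainOf 0 (0ℤ , one a) Cs′ × (a , Cs′) ≡ (a′ , Cs)
    from chain size (inj₁ a<a′) = ⊥-elim (none-one a<a′ size)
    from chain size (inj₂ refl) = _ , (chain , ℕ.+-cancelˡ-≡ (suc a) _ _ size) , refl
  starts (suc n) a = transport
    (λ { _ (inj₁ (_ , (chain , size) , refl)) → (chain , cong (_+_ (suc a)) size) , ℕ.≤-refl
       ; _ (inj₂ ((chain , size) , a<a′)) → (chain , trans size (sym (ℕ.+-suc (suc a) n))) , ℕ.<⇒≤ a<a′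
       })
    (λ { (a′ , Cs) ((chain , size) , a≤a′) → from chain size (ℕ.m≤n⇒m<n∨m≡n a≤a′) })
    (disjointUnion
      (λ { _ (_ , _ , refl) (_ , a<a) → ℕ.<-irrefl refl a<a })
      (image {Q = λ x → ∃[ Cs ] ChainOf (suc n) (0ℤ , one a) Cs × (a , Cs) ≡ x} (a ,_)
        (λ { refl → refl }) (λ Cs chain → Cs , chain , refl) (λ _ x → x)
        (chainsOf (suc n) (0ℤ , one a)))
      (starts n (suc a)))
    where
    from : ∀ {a′ Cs} → Chain (0ℤ , one a′) Cs → suc a′ + total Cs ≡ suc a + suc n → a < a′ ⊎ a ≡ a′ →
      (∃[ Cs′ ] ChainOf (suc n) (0ℤ , one a) Cs′ × (a , Cs′) ≡ (a′ , Cs)) ⊎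
      StartsFrom n (suc a) (a′ , Cs)
    from chain size (inj₁ a<a′) = inj₂ ((chain , trans size (ℕ.+-suc (suc a) n)) , a<a′)
    from chain size (inj₂ refl) = inj₁ (_ , (chain , ℕ.+-cancelˡ-≡ (suc a) _ _ size) , refl)

  normalised : ∀ n → Enumeration (Normalised n) (cheesyCount n)
  normalised zero    = empty λ { _ (_ , ()) }
  normalised (suc n) = transport (λ _ → proj₁) (λ _ x → x , ℕ.z≤n) (starts n 0)

-- The cells of a list of columns and paths between them.

module Cells where

  open LinearArithmetic using (lin; _:≤_; _:<_; _:≡_; _:+_; _:-_; con; false; ⊢_; _⇒_)
  open Enumerations using (≤⇒∃)
  open Columns
  open Chains using (height; total; Chain; []; _∷_)
  open Counting using (one; two)
  open import Data.Empty using (⊥; ⊥-elim)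
  open import Data.Integer as ℤ using (ℤ; +_; 1ℤ; _+_; _-_; _≤_)
  import Data.Integer.Properties as ℤ
  open import Data.List using (List; []; _∷_; _++_; map; upTo; length)
  open import Data.List.Properties using (length-map; length-++; length-upTo)
  open import Data.List.Membership.Propositional using (_∈_)
  open import Data.List.Membership.Propositional.Properties
    using (∈-map⁺; ∈-map⁻; ∈-++⁺ˡ; ∈-++⁺ʳ; ∈-++⁻; ∈-upTo⁺; ∈-upTo⁻)
  open import Data.List.Relation.Unary.All using (All; []; _∷_)
  open import Data.List.Relation.Unary.Any using (Any; here; there)
  open import Data.List.Relation.Unary.AllPairs using ([]; _∷_)
  open import Data.List.Relation.Unary.Unique.Propositional using (Unique)
  import Data.List.Relation.Unary.Unique.Propositional.Properties as Unique
  open import Data.Nat as ℕ using (ℕ; zero; suc)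
  import Data.Nat.Properties as ℕ
  open import Data.Product using (∃-syntax; _×_; _,_; proj₁; proj₂)
  open import Data.Sum using (inj₁; inj₂)
  open import Data.Vec using ([]; _∷_)
  open import Function using (_∘_)
  open import Relation.Binary.Construct.Closure.ReflexiveTransitive
    using (Star; ε; _◅_; _◅◅_; reverse)
  open import Relation.Nullary using (¬_)
  open import Relation.Binary.PropositionalEquality
    using (_≡_; refl; sym; trans; cong; cong₂; subst)

  segment : ℤ → ℕ → List ℤ
  segment lo n = map (λ i → lo + + i) (upTo (suc n))

  ∈-segment⁺ : ∀ {y} lo n → lo ≤ y → y ≤ lo + + n → y ∈ segment lo n
  ∈-segment⁺ lo n lo≤y y≤hi with ≤⇒∃ lo≤y
  ... | k , refl = ∈-map⁺ (λ i → lo + + i) (∈-upTo⁺ (ℕ.s≤s (k≤n y≤hi)))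
    where
    k≤n : lo + + k ≤ lo + + n → k ℕ.≤ n
    k≤n p = ℤ.drop‿+≤+ (lin (k ∷ n ∷ []) (lo ∷ []) (λ k n lo → lo :+ k :≤ lo :+ n ⇒ ⊢ k :≤ n) refl p)

  ∈-segment⁻ : ∀ {y} lo n → y ∈ segment lo n → lo ≤ y × y ≤ lo + + n
  ∈-segment⁻ lo n y∈ with ∈-map⁻ (λ i → lo + + i) y∈
  ... | i , i∈ , refl = low , high
    where
    low : lo ≤ lo + + i
    low = lin (i ∷ []) (lo ∷ []) (λ i lo → ⊢ lo :≤ lo :+ i) refl
    high : lo + + i ≤ lo + + n
    high = lin (i ∷ n ∷ []) (lo ∷ []) (λ i n lo → i :≤ n ⇒ ⊢ lo :+ i :≤ lo :+ n) refl
      (ℤ.+≤+ (ℕ.s≤s⁻¹ (∈-upTo⁻ i∈)))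

  segment-unique : ∀ lo n → Unique (segment lo n)
  segment-unique lo n = Unique.map⁺ (λ {i} {j} → ℤ.+-injective ∘ injective i j) (Unique.upTo⁺ (suc n))
    where
    injective : ∀ i j → lo + + i ≡ lo + + j → + i ≡ + j
    injective i j = lin (i ∷ j ∷ []) (lo ∷ []) (λ i j lo → lo :+ i :≡ lo :+ j ⇒ ⊢ i :≡ j) refl

  length-segment : ∀ lo n → length (segment lo n) ≡ suc n
  length-segment lo n = trans (length-map _ (upTo (suc n))) (length-upTo (suc n))

  heights : Column → List ℤ
  heights (p , one a)     = segment p a
  heights (p , two c g d) = segment (p - + c) c ++ segment (p + rise g) d

  private
    lower-top : ∀ p c → p - + c + + c ≡ p
    lower-top p c = lin (c ∷ []) (p ∷ []) (λ c p → ⊢ p :- c :+ c :≡ p) refl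

  ∈-heights⁺ : ∀ {y} C → y ∈ᶜ C → y ∈ heights C
  ∈-heights⁺ (p , one a)     (here (lo , hi))         = ∈-segment⁺ p a lo hi
  ∈-heights⁺ (p , two c g d) (here (lo , hi))         =
    ∈-++⁺ˡ (∈-segment⁺ (p - + c) c lo (subst (_ ≤_) (sym (lower-top p c)) hi))
  ∈-heights⁺ (p , two c g d) (there (here (lo , hi))) =
    ∈-++⁺ʳ (segment (p - + c) c) (∈-segment⁺ (p + rise g) d lo hi)

  ∈-heights⁻ : ∀ {y} C → y ∈ heights C → y ∈ᶜ C
  ∈-heights⁻ (p , one a)     y∈ = here (∈-segment⁻ p a y∈)
  ∈-heights⁻ (p , two c g d) y∈ with ∈-++⁻ (segment (p - + c) c) y∈
  ... | inj₁ y∈ˡ = let lo , hi = ∈-segment⁻ (p - + c) c y∈ˡ in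
    here (lo , subst (_ ≤_) (lower-top p c) hi)
  ... | inj₂ y∈ʳ = there (here (∈-segment⁻ (p + rise g) d y∈ʳ))

  heights-unique : ∀ C → Unique (heights C)
  heights-unique (p , one a)     = segment-unique p a
  heights-unique (p , two c g d) = Unique.++⁺ (segment-unique (p - + c) c) (segment-unique (p + rise g) d)
    λ {y} (y∈ˡ , y∈ʳ) → disjoint y (∈-segment⁻ (p - + c) c y∈ˡ) (∈-segment⁻ (p + rise g) d y∈ʳ)
    where
    disjoint : ∀ y → p - + c ≤ y × y ≤ p - + c + + c → p + rise g ≤ y × y ≤ p + rise g + + d → ⊥
    disjoint y (_ , hi) (lo , _) = lin (c ∷ []) (p ∷ y ∷ rise g ∷ []) (λ c p y r →
      y :≤ p :- c :+ c ⇒ p :+ r :≤ y ⇒ con 1ℤ :< r ⇒ ⊢ false) refl hi lo (gap<rise g)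

  length-heights : ∀ C → length (heights C) ≡ height C
  length-heights (p , one a)     = length-segment p a
  length-heights (p , two c g d) = trans (length-++ (segment (p - + c) c))
    (cong₂ ℕ._+_ (length-segment (p - + c) c) (length-segment (p + rise g) d))

  columnCells : ℤ → List Column → List Cell
  columnCells x []       = []
  columnCells x (C ∷ Cs) = map (x ,_) (heights C) ++ columnCells (x + 1ℤ) Cs

  data At : ℤ → List Column → ℤ → Column → Set where
    here  : ∀ {x C Cs} → At x (C ∷ Cs) x C
    there : ∀ {x C Cs x′ D} → At (x + 1ℤ) Cs x′ D → At x (C ∷ Cs) x′ D

  At-≤ : ∀ {x Cs x′ D} → At x Cs x′ D → x ≤ x′
  At-≤ here = ℤ.≤-refl
  At-≤ {x} {x′ = x′} (there at) =
    lin [] (x ∷ x′ ∷ []) (λ x x′ → x :+ con 1ℤ :≤ x′ ⇒ ⊢ x :≤ x′) refl (At-≤ at)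

  x+1≰x : ∀ {x} → ¬ (x + 1ℤ ≤ x)
  x+1≰x {x} = lin [] (x ∷ []) (λ x → x :+ con 1ℤ :≤ x ⇒ ⊢ false) refl

  At-unique : ∀ {x Cs x′ D E} → At x Cs x′ D → At x Cs x′ E → D ≡ E
  At-unique here       here       = refl
  At-unique here       (there at) = ⊥-elim (x+1≰x (At-≤ at))
  At-unique (there at) here       = ⊥-elim (x+1≰x (At-≤ at))
  At-unique (there at) (there bt) = At-unique at bt

  ∈-cells⁺ : ∀ {x Cs x′ y D} → At x Cs x′ D → y ∈ᶜ D → (x′ , y) ∈ columnCells x Cs
  ∈-cells⁺ {D = D} here       y∈D = ∈-++⁺ˡ (∈-map⁺ (_ ,_) (∈-heights⁺ D y∈D))
  ∈-cells⁺ {x} {C ∷ Cs} (there at) y∈D = ∈-++⁺ʳ (map (x ,_) (heights C)) (∈-cells⁺ at y∈D)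

  ∈-cells⁻ : ∀ {x′ y} x Cs → (x′ , y) ∈ columnCells x Cs → ∃[ D ] At x Cs x′ D × y ∈ᶜ D
  ∈-cells⁻ x (C ∷ Cs) xy∈ with ∈-++⁻ (map (x ,_) (heights C)) xy∈
  ... | inj₂ xy∈ʳ = let D , at , y∈D = ∈-cells⁻ (x + 1ℤ) Cs xy∈ʳ in D , there at , y∈D
  ... | inj₁ xy∈ˡ with ∈-map⁻ (x ,_) xy∈ˡ
  ... | _ , y∈ , refl = C , here , ∈-heights⁻ C y∈

  ∈-cells-At : ∀ {x Cs x′ y D} → At x Cs x′ D → (x′ , y) ∈ columnCells x Cs → y ∈ᶜ D
  ∈-cells-At {x} {Cs} at xy∈ with ∈-cells⁻ x Cs xy∈
  ... | E , at′ , y∈E = subst (_ ∈ᶜ_) (At-unique at′ at) y∈E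

  columnCells-unique : ∀ x Cs → Unique (columnCells x Cs)
  columnCells-unique x []       = []
  columnCells-unique x (C ∷ Cs) = Unique.++⁺
    (Unique.map⁺ (cong proj₂) (heights-unique C)) (columnCells-unique (x + 1ℤ) Cs) disjoint
    where
    disjoint : ∀ {c} → c ∈ map (x ,_) (heights C) × c ∈ columnCells (x + 1ℤ) Cs → ⊥
    disjoint (c∈ˡ , c∈ʳ) with ∈-map⁻ (x ,_) c∈ˡ
    ... | _ , _ , refl = x+1≰x (At-≤ (proj₁ (proj₂ (∈-cells⁻ (x + 1ℤ) Cs c∈ʳ))))

  length-columnCells : ∀ x Cs → length (columnCells x Cs) ≡ total Cs
  length-columnCells x []       = refl
  length-columnCells x (C ∷ Cs) = trans (length-++ (map (x ,_) (heights C)))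
    (cong₂ ℕ._+_ (trans (length-map _ (heights C)) (length-heights C)) (length-columnCells (x + 1ℤ) Cs))

  shareEdge-sym : ∀ {c d} → ShareEdge c d → ShareEdge d c
  shareEdge-sym {x , y} (here refl) = there (here (cong (x ,_) (sym (+1-1 y))))
    where
    +1-1 : ∀ y → y + 1ℤ - 1ℤ ≡ y
    +1-1 y = lin [] (y ∷ []) (λ y → ⊢ y :+ con 1ℤ :- con 1ℤ :≡ y) refl
  shareEdge-sym {x , y} (there (here refl)) = here (cong (x ,_) (sym (-1+1 y)))
    where
    -1+1 : ∀ y → y - 1ℤ + 1ℤ ≡ y
    -1+1 y = lin [] (y ∷ []) (λ y → ⊢ y :- con 1ℤ :+ con 1ℤ :≡ y) refl
  shareEdge-sym {x , y} (there (there (here refl))) =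
    there (there (there (there (here (cong (_, y) (x≡ x))))))
    where
    x≡ : ∀ x → x ≡ x + 1ℤ - 1ℤ
    x≡ x = lin [] (x ∷ []) (λ x → ⊢ x :≡ x :+ con 1ℤ :- con 1ℤ) refl
  shareEdge-sym {x , y} (there (there (there (here refl)))) =
    there (there (there (there (there (here (cong₂ _,_ (x≡ x) (y≡ y)))))))
    where
    x≡ : ∀ x → x ≡ x + 1ℤ - 1ℤ
    x≡ x = lin [] (x ∷ []) (λ x → ⊢ x :≡ x :+ con 1ℤ :- con 1ℤ) refl
    y≡ : ∀ y → y ≡ y - 1ℤ + 1ℤ
    y≡ y = lin [] (y ∷ []) (λ y → ⊢ y :≡ y :- con 1ℤ :+ con 1ℤ) refl
  shareEdge-sym {x , y} (there (there (there (there (here refl))))) =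
    there (there (here (cong (_, y) (x≡ x))))
    where
    x≡ : ∀ x → x ≡ x - 1ℤ + 1ℤ
    x≡ x = lin [] (x ∷ []) (λ x → ⊢ x :≡ x :- con 1ℤ :+ con 1ℤ) refl
  shareEdge-sym {x , y} (there (there (there (there (there (here refl)))))) =
    there (there (there (here (cong₂ _,_ (x≡ x) (y≡ y)))))
    where
    x≡ : ∀ x → x ≡ x - 1ℤ + 1ℤ
    x≡ x = lin [] (x ∷ []) (λ x → ⊢ x :≡ x :- con 1ℤ :+ con 1ℤ) refl
    y≡ : ∀ y → y ≡ y + 1ℤ - 1ℤ
    y≡ y = lin [] (y ∷ []) (λ y → ⊢ y :≡ y :+ con 1ℤ :- con 1ℤ) refl

  stepIn-sym : ∀ {cs c d} → StepIn cs c d → StepIn cs d c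
  stepIn-sym (c∈ , d∈ , edge) = d∈ , c∈ , shareEdge-sym edge

  shareEdge-right : ∀ x {y y′} → y - 1ℤ ≤ y′ → y′ ≤ y → ShareEdge (x , y) (x + 1ℤ , y′)
  shareEdge-right x {y} {y′} lo hi with ≤-<-connex y y′
  ... | inj₁ y≤y′ = there (there (here (cong (x + 1ℤ ,_) (ℤ.≤-antisym hi y≤y′))))
  ... | inj₂ y′<y = there (there (there (here (cong (x + 1ℤ ,_) (ℤ.≤-antisym y′≤y-1 lo)))))
    where
    y′≤y-1 : y′ ≤ y - 1ℤ
    y′≤y-1 = lin [] (y ∷ y′ ∷ []) (λ y y′ → y′ :< y ⇒ ⊢ y′ :≤ y :- con 1ℤ) refl y′<y

  module _ (all : List Cell) where

    climb : ∀ x y n → (∀ z → y ≤ z → z ≤ y + + n → (x , z) ∈ all) →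
      Star (StepIn all) (x , y) (x , y + + n)
    climb x y zero    inside = subst (λ z → Star (StepIn all) (x , y) (x , z)) (sym (ℤ.+-identityʳ y)) ε
    climb x y (suc n) inside =
      (inside y ℤ.≤-refl y≤ , inside (y + 1ℤ) y≤y+1 y+1≤ , here refl) ◅
      subst (λ z → Star (StepIn all) (x , y + 1ℤ) (x , z)) top≡
        (climb x (y + 1ℤ) n λ z lo hi → inside z (ℤ.≤-trans y≤y+1 lo) (subst (z ≤_) top≡ hi))
      where
      y≤ : y ≤ y + + suc n
      y≤ = lin (n ∷ []) (y ∷ []) (λ n y → ⊢ y :≤ y :+ (con 1ℤ :+ n)) refl
      y≤y+1 : y ≤ y + 1ℤ
      y≤y+1 = lin [] (y ∷ []) (λ y → ⊢ y :≤ y :+ con 1ℤ) refl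
      y+1≤ : y + 1ℤ ≤ y + + suc n
      y+1≤ = lin (n ∷ []) (y ∷ []) (λ n y → ⊢ y :+ con 1ℤ :≤ y :+ (con 1ℤ :+ n)) refl
      top≡ : y + 1ℤ + + n ≡ y + + suc n
      top≡ = lin (n ∷ []) (y ∷ []) (λ n y → ⊢ y :+ con 1ℤ :+ n :≡ y :+ (con 1ℤ :+ n)) refl

    within-run : ∀ x r → (∀ z → z ∈ᴿ r → (x , z) ∈ all) → ∀ {y z} → y ∈ᴿ r → z ∈ᴿ r →
      Star (StepIn all) (x , y) (x , z)
    within-run x r inside {y} {z} (s≤y , y≤t) (s≤z , z≤t) with ≤-<-connex y z
    ... | inj₁ y≤z with ≤⇒∃ y≤z
    ... | n , refl = climb x y n λ w lo hi → inside w (ℤ.≤-trans s≤y lo , ℤ.≤-trans hi z≤t)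
    within-run x r inside {y} {z} (s≤y , y≤t) (s≤z , z≤t) | inj₂ z<y with ≤⇒∃ (ℤ.<⇒≤ z<y)
    ... | n , refl = reverse stepIn-sym
      (climb x z n λ w lo hi → inside w (ℤ.≤-trans s≤z lo , ℤ.≤-trans hi y≤t))

    module _ (root : Cell) where

      -- Every run of the next column touches a cell already linked to `root` and is linked within
      -- itself by vertical steps. The list `all` stays fixed while the recursion passes to tails,
      -- because the paths run through the earlier columns.
      chain-linked : ∀ x L Cs → Chain L Cs →
        (∀ y → y ∈ᶜ L → (x , y) ∈ all × Star (StepIn all) root (x , y)) →
        (∀ c → c ∈ columnCells (x + 1ℤ) Cs → c ∈ all) →
        ∀ {x′ D y} → At (x + 1ℤ) Cs x′ D → y ∈ᶜ D → Star (StepIn all) root (x′ , y)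
      chain-linked x L (C ∷ Cs) (attached ∷ chain) L-linked inside at y∈D = go at y∈D
        where
        run-linked : ∀ r → Touches L r → (∀ z → z ∈ᴿ r → (x + 1ℤ , z) ∈ all) →
          ∀ {y} → y ∈ᴿ r → Star (StepIn all) root (x + 1ℤ , y)
        run-linked r (z , z′ , z∈L , z′∈r , lo , hi) inside-r y∈r =
          let z∈all , linked = L-linked z z∈L in
          linked ◅◅ (z∈all , inside-r z′ z′∈r , shareEdge-right x lo hi) ◅
            within-run (x + 1ℤ) r inside-r z′∈r y∈r
        C-inside : ∀ y → y ∈ᶜ C → (x + 1ℤ , y) ∈ all
        C-inside y y∈C = inside (x + 1ℤ , y) (∈-cells⁺ (here {Cs = Cs}) y∈C)
        runs-linked : ∀ rs → All (Touches L) rs → (∀ y → Any (y ∈ᴿ_) rs → (x + 1ℤ , y) ∈ all) →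
          ∀ {y} → Any (y ∈ᴿ_) rs → Star (StepIn all) root (x + 1ℤ , y)
        runs-linked (r ∷ rs) (touch ∷ _)   inside-rs (here y∈r)   =
          run-linked r touch (λ z → inside-rs z ∘ here) y∈r
        runs-linked (r ∷ rs) (_ ∷ touches) inside-rs (there y∈rs) =
          runs-linked rs touches (λ z → inside-rs z ∘ there) y∈rs
        C-linked : ∀ y → y ∈ᶜ C → (x + 1ℤ , y) ∈ all × Star (StepIn all) root (x + 1ℤ , y)
        C-linked y y∈C = C-inside y y∈C , runs-linked (runs C) attached C-inside y∈C
        go : ∀ {x′ D y} → At (x + 1ℤ) (C ∷ Cs) x′ D → y ∈ᶜ D → Star (StepIn all) root (x′ , y)
        go here       y∈D = proj₂ (C-linked _ y∈D)
        go (there at) y∈D = chain-linked (x + 1ℤ) C Cs chain C-linked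
          (λ c → inside c ∘ ∈-++⁺ʳ (map (x + 1ℤ ,_) (heights C))) at y∈D

-- Connected components of a column.

module Components where

  open LinearArithmetic using (lin; _:≤_; _:<_; _:≡_; _:+_; _:-_; con; false; ⊢_; _⇒_)
  open Columns
  open Counting using (narrow; wide; one; two)
  open import Data.Empty using (⊥; ⊥-elim)
  open import Data.Integer as ℤ using (ℤ; +_; 1ℤ; _+_; _-_; _≤_; _<_)
  import Data.Integer.Properties as ℤ
  open import Data.List using ([]; _∷_)
  open import Data.List.Membership.Propositional using (_∈_)
  open import Data.List.Relation.Unary.Any using (here; there)
  open import Data.Product using (_×_; _,_; proj₂)
  open import Data.Vec using ([]; _∷_)
  open import Function using (_∘_)
  open import Relation.Nullary using (¬_; yes; no)
  open import Relation.Binary.PropositionalEquality using (_≡_; _≢_; refl; sym; trans; cong; cong₂)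

  -- `IsComponent` freed from the polyomino, so that it applies both to the heights of cells and to
  -- encoded columns.
  record Component (A : ℤ → Set) (r : Run) : Set where
    field
      inhabited    : bottom r ≤ top r
      contained    : ∀ y → y ∈ᴿ r → A y
      maximalBelow : ¬ A (bottom r - 1ℤ)
      maximalAbove : ¬ A (top r + 1ℤ)

  open Component public

  component-cong : ∀ {A B : ℤ → Set} {r} → (∀ y → A y → B y) → (∀ y → B y → A y) →
    Component A r → Component B r
  component-cong to from comp = record
    { inhabited    = inhabited comp
    ; contained    = λ y → to y ∘ contained comp y
    ; maximalBelow = maximalBelow comp ∘ from _
    ; maximalAbove = maximalAbove comp ∘ from _
    }

  isComponent⇒component : ∀ {P x r} → IsComponent P x r → Component (λ y → (x , y) ∈ cells P) r
  isComponent⇒component comp = record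
    { inhabited    = IsComponent.inhabited comp
    ; contained    = IsComponent.contained comp
    ; maximalBelow = IsComponent.maximalBelow comp
    ; maximalAbove = IsComponent.maximalAbove comp
    }

  component⇒isComponent : ∀ {P x r} → Component (λ y → (x , y) ∈ cells P) r → IsComponent P x r
  component⇒isComponent comp = record
    { inhabited    = inhabited comp
    ; contained    = contained comp
    ; maximalBelow = maximalBelow comp
    ; maximalAbove = maximalAbove comp
    }

  private
    run-≡ : ∀ {s t} r → bottom r ≡ s → top r ≡ t → r ≡ run s t
    run-≡ (run _ _) refl refl = refl

    predecessor-inside : ∀ {a b s} → a ≤ s → s ≤ b → s ≢ a → (a ≤ s - 1ℤ) × (s - 1ℤ ≤ b)
    predecessor-inside {a} {b} {s} a≤s s≤b s≢a = low (ℤ.≤∧≢⇒< a≤s (s≢a ∘ sym)) , high s≤b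
      where
      low : a < s → a ≤ s - 1ℤ
      low = lin [] (a ∷ s ∷ []) (λ a s → a :< s ⇒ ⊢ a :≤ s :- con 1ℤ) refl
      high : s ≤ b → s - 1ℤ ≤ b
      high = lin [] (b ∷ s ∷ []) (λ b s → s :≤ b ⇒ ⊢ s :- con 1ℤ :≤ b) refl

    successor-inside : ∀ {a b t} → a ≤ t → t ≤ b → t ≢ b → (a ≤ t + 1ℤ) × (t + 1ℤ ≤ b)
    successor-inside {a} {b} {t} a≤t t≤b t≢b = low a≤t , high (ℤ.≤∧≢⇒< t≤b t≢b)
      where
      low : a ≤ t → a ≤ t + 1ℤ
      low = lin [] (a ∷ t ∷ []) (λ a t → a :≤ t ⇒ ⊢ a :≤ t :+ con 1ℤ) refl
      high : t < b → t + 1ℤ ≤ b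
      high = lin [] (b ∷ t ∷ []) (λ b t → t :< b ⇒ ⊢ t :+ con 1ℤ :≤ b) refl

    -- A component whose ends lie in the same run (a , b) of a column is that run.
    component-run : ∀ {A : ℤ → Set} {a b r} → (∀ y → a ≤ y × y ≤ b → A y) → Component A r →
      a ≤ bottom r × bottom r ≤ b → a ≤ top r × top r ≤ b → r ≡ run a b
    component-run {a = a} {b} {r} inside comp (a≤s , s≤b) (a≤t , t≤b) = run-≡ r s≡a t≡b
      where
      s≡a : bottom r ≡ a
      s≡a with bottom r ℤ.≟ a
      ... | yes eq = eq
      ... | no  s≢a = ⊥-elim (maximalBelow comp (inside _ (predecessor-inside a≤s s≤b s≢a)))
      t≡b : top r ≡ b
      t≡b with top r ℤ.≟ b
      ... | yes eq = eq
      ... | no  t≢b = ⊥-elim (maximalAbove comp (inside _ (successor-inside a≤t t≤b t≢b)))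

    gap-empty : ∀ p c g d → ¬ (p + 1ℤ ∈ᶜ (p , two c g d))
    gap-empty p c g d (here (_ , hi)) = lin [] (p ∷ []) (λ p → p :+ con 1ℤ :≤ p ⇒ ⊢ false) refl hi
    gap-empty p c g d (there (here (lo , _))) =
      lin [] (p ∷ rise g ∷ []) (λ p r → p :+ r :≤ p :+ con 1ℤ ⇒ con 1ℤ :< r ⇒ ⊢ false) refl lo (gap<rise g)

  -- A component reaching from the lower run into the upper one would contain the gap height p + 1.
  -- Hence both ends lie in one run, and maximality makes them its ends.
  component⇒run : ∀ D {r} → Component (_∈ᶜ D) r → r ∈ runs D
  component⇒run (p , one a) {r} comp
    with contained comp (bottom r) (ℤ.≤-refl , inhabited comp)
       | contained comp (top r) (inhabited comp , ℤ.≤-refl)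
  ... | here s∈ | here t∈ = here (component-run (λ _ → here) comp s∈ t∈)
  component⇒run (p , two c g d) {r} comp
    with contained comp (bottom r) (ℤ.≤-refl , inhabited comp)
       | contained comp (top r) (inhabited comp , ℤ.≤-refl)
  ... | here s∈         | here t∈         = here (component-run (λ _ → here) comp s∈ t∈)
  ... | there (here s∈) | there (here t∈) =
    there (here (component-run (λ _ → there ∘ here) comp s∈ t∈))
  ... | here (_ , s≤p)  | there (here (q≤t , _)) = ⊥-elim (gap-empty p c g d
    (contained comp (p + 1ℤ) (low s≤p , high q≤t (gap<rise g))))
    where
    low : bottom r ≤ p → bottom r ≤ p + 1ℤ
    low = lin [] (p ∷ bottom r ∷ []) (λ p s → s :≤ p ⇒ ⊢ s :≤ p :+ con 1ℤ) refl
    high : p + rise g ≤ top r → 1ℤ < rise g → p + 1ℤ ≤ top r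
    high = lin [] (p ∷ rise g ∷ top r ∷ []) (λ p q t →
      p :+ q :≤ t ⇒ con 1ℤ :< q ⇒ ⊢ p :+ con 1ℤ :≤ t) refl
  ... | there (here (q≤s , _)) | here (_ , t≤p) =
    ⊥-elim (reversed q≤s t≤p (inhabited comp) (gap<rise g))
    where
    reversed : p + rise g ≤ bottom r → top r ≤ p → bottom r ≤ top r → 1ℤ < rise g → ⊥
    reversed = lin [] (p ∷ rise g ∷ bottom r ∷ top r ∷ []) (λ p q s t →
      p :+ q :≤ s ⇒ t :≤ p ⇒ s :≤ t ⇒ con 1ℤ :< q ⇒ ⊢ false) refl

  run⇒component : ∀ D {r} → r ∈ runs D → Component (_∈ᶜ D) r
  run⇒component (p , one a) (here refl) = record
    { inhabited    = lin (a ∷ []) (p ∷ []) (λ a p → ⊢ p :≤ p :+ a) refl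
    ; contained    = λ y → here
    ; maximalBelow = λ { (here (lo , _)) → below lo }
    ; maximalAbove = λ { (here (_ , hi)) → above hi }
    }
    where
    below : ¬ (p ≤ p - 1ℤ)
    below = lin [] (p ∷ []) (λ p → p :≤ p :- con 1ℤ ⇒ ⊢ false) refl
    above : ¬ (p + + a + 1ℤ ≤ p + + a)
    above = lin (a ∷ []) (p ∷ []) (λ a p → p :+ a :+ con 1ℤ :≤ p :+ a ⇒ ⊢ false) refl
  run⇒component (p , two c g d) (here refl) = record
    { inhabited    = lin (c ∷ []) (p ∷ []) (λ c p → ⊢ p :- c :≤ p) refl
    ; contained    = λ y → here
    ; maximalBelow = λ { (here (lo , _)) → below lo ; (there (here (lo , _))) → below′ lo (gap<rise g) }
    ; maximalAbove = gap-empty p c g d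
    }
    where
    below : ¬ (p - + c ≤ p - + c - 1ℤ)
    below = lin (c ∷ []) (p ∷ []) (λ c p → p :- c :≤ p :- c :- con 1ℤ ⇒ ⊢ false) refl
    below′ : p + rise g ≤ p - + c - 1ℤ → 1ℤ < rise g → ⊥
    below′ = lin (c ∷ []) (p ∷ rise g ∷ []) (λ c p q →
      p :+ q :≤ p :- c :- con 1ℤ ⇒ con 1ℤ :< q ⇒ ⊢ false) refl
  run⇒component (p , two c g d) (there (here refl)) = record
    { inhabited    = lin (d ∷ []) (p + rise g ∷ []) (λ d q → ⊢ q :≤ q :+ d) refl
    ; contained    = λ y → there ∘ here
    ; maximalBelow = λ { (here (_ , hi)) → below hi (gap<rise g) ; (there (here (lo , _))) → below′ lo }
    ; maximalAbove = λ { (here (_ , hi)) → above hi (gap<rise g) ; (there (here (_ , hi))) → above′ hi }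
    }
    where
    below : p + rise g - 1ℤ ≤ p → 1ℤ < rise g → ⊥
    below = lin [] (p ∷ rise g ∷ []) (λ p q → p :+ q :- con 1ℤ :≤ p ⇒ con 1ℤ :< q ⇒ ⊢ false) refl
    below′ : ¬ (p + rise g ≤ p + rise g - 1ℤ)
    below′ = lin [] (p + rise g ∷ []) (λ q → q :≤ q :- con 1ℤ ⇒ ⊢ false) refl
    above : p + rise g + + d + 1ℤ ≤ p → 1ℤ < rise g → ⊥
    above = lin (d ∷ []) (p ∷ rise g ∷ []) (λ d p q →
      p :+ q :+ d :+ con 1ℤ :≤ p ⇒ con 1ℤ :< q ⇒ ⊢ false) refl
    above′ : ¬ (p + rise g + + d + 1ℤ ≤ p + rise g + + d)
    above′ = lin (d ∷ []) (p + rise g ∷ []) (λ d q → q :+ d :+ con 1ℤ :≤ q :+ d ⇒ ⊢ false) refl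

  private
    run-injective : ∀ {s t s′ t′} → run s t ≡ run s′ t′ → s ≡ s′ × t ≡ t′
    run-injective refl = refl , refl

    length-injective : ∀ {p m n} → p + + m ≡ p + + n → m ≡ n
    length-injective {p} {m} {n} eq = ℤ.+-injective (go eq)
      where
      go : p + + m ≡ p + + n → + m ≡ + n
      go = lin (m ∷ n ∷ []) (p ∷ []) (λ m n p → p :+ m :≡ p :+ n ⇒ ⊢ m :≡ n) refl

    depth-injective : ∀ {p m n} → p - + m ≡ p - + n → m ≡ n
    depth-injective {p} {m} {n} eq = ℤ.+-injective (go eq)
      where
      go : p - + m ≡ p - + n → + m ≡ + n
      go = lin (m ∷ n ∷ []) (p ∷ []) (λ m n p → p :- m :≡ p :- n ⇒ ⊢ m :≡ n) refl

    rise-injective : ∀ {p g h} → p + rise g ≡ p + rise h → g ≡ h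
    rise-injective {p} {narrow} {narrow} _  = refl
    rise-injective {p} {wide}   {wide}   _  = refl
    rise-injective {p} {narrow} {wide}   eq =
      ⊥-elim (lin [] (p ∷ []) (λ p → p :+ con (+ 2) :≡ p :+ con (+ 3) ⇒ ⊢ false) refl eq)
    rise-injective {p} {wide}   {narrow} eq =
      ⊥-elim (lin [] (p ∷ []) (λ p → p :+ con (+ 3) :≡ p :+ con (+ 2) ⇒ ⊢ false) refl eq)

    below-rise : ∀ p g d → p ≢ p + rise g + + d
    below-rise p g d eq = go eq (gap<rise g)
      where
      go : p ≡ p + rise g + + d → 1ℤ < rise g → ⊥
      go = lin (d ∷ []) (p ∷ rise g ∷ []) (λ d p q → p :≡ p :+ q :+ d ⇒ con 1ℤ :< q ⇒ ⊢ false) refl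

    single-run : ∀ {D p a} → (∀ {r} → r ∈ runs D → r ≡ run p (p + + a)) → D ≡ (p , one a)
    single-run {p′ , one a′} only with run-injective (only (here refl))
    ... | refl , eq = cong (λ a → p′ , one a) (length-injective {p′} eq)
    single-run {p′ , two c g d} only = ⊥-elim (below-rise p′ g d
      (proj₂ (run-injective (trans (only (here refl)) (sym (only (there (here refl))))))))

    two-runs : ∀ {p c g d p′ c′ g′ d′} →
      run (p - + c) p ≡ run (p′ - + c′) p′ →
      run (p + rise g) (p + rise g + + d) ≡ run (p′ + rise g′) (p′ + rise g′ + + d′) →
      (p , two c g d) ≡ (p′ , two c′ g′ d′)
    two-runs {p} {c} {g} {d} {p′} {c′} {g′} {d′} eq eq′ with run-injective eq | run-injective eq′
    ... | bottom≡ , refl | lower≡ , upper≡ with rise-injective {p} {g} {g′} lower≡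
    ... | refl = cong₂ (λ c d → p , two c g d)
      (depth-injective {p} bottom≡) (length-injective {p + rise g} upper≡)

  -- The components depend only on the set of heights, they are exactly the runs, and the runs
  -- determine the encoding.
  column-ext : ∀ {C D} → (∀ y → y ∈ᶜ C → y ∈ᶜ D) → (∀ y → y ∈ᶜ D → y ∈ᶜ C) → C ≡ D
  column-ext {C} {D} to from = same C D
    (λ r∈ → component⇒run D (component-cong to from (run⇒component C r∈)))
    (λ r∈ → component⇒run C (component-cong from to (run⇒component D r∈)))
    where
    same : ∀ C D → (∀ {r} → r ∈ runs C → r ∈ runs D) → (∀ {r} → r ∈ runs D → r ∈ runs C) → C ≡ D
    same C (p , one a) to from = single-run λ r∈ → only (to r∈)
      where
      only : ∀ {r} → r ∈ run p (p + + a) ∷ [] → r ≡ run p (p + + a)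
      only (here eq) = eq
    same (p , one a) D@(_ , two _ _ _) to from = sym (single-run λ r∈ → only (from r∈))
      where
      only : ∀ {r} → r ∈ run p (p + + a) ∷ [] → r ≡ run p (p + + a)
      only (here eq) = eq
    same (p , two c g d) (p′ , two c′ g′ d′) to from
      with to (here refl) | to (there (here refl))
    ... | here eq         | there (here eq′) = two-runs eq eq′
    ... | here eq         | here eq′         =
      ⊥-elim (below-rise p g d (proj₂ (run-injective (trans eq (sym eq′)))))
    ... | there (here eq) | there (here eq′) =
      ⊥-elim (below-rise p g d (proj₂ (run-injective (trans eq (sym eq′)))))
    ... | there (here eq) | here eq′         = ⊥-elim (crossed (proj₂ (run-injective eq))
      (proj₂ (run-injective eq′)) (gap<rise g) (gap<rise g′))
      where
      crossed : p ≡ p′ + rise g′ + + d′ → p + rise g + + d ≡ p′ → 1ℤ < rise g → 1ℤ < rise g′ → ⊥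
      crossed = lin (d ∷ d′ ∷ []) (p ∷ p′ ∷ rise g ∷ rise g′ ∷ []) (λ d d′ p p′ q q′ →
        p :≡ p′ :+ q′ :+ d′ ⇒ p :+ q :+ d :≡ p′ ⇒ con 1ℤ :< q ⇒ con 1ℤ :< q′ ⇒ ⊢ false) refl

-- From chains to polyominoes.

module Realisation where

  open LinearArithmetic using (lin; _:≤_; _:<_; _:≡_; _:+_; _:-_; con; false; ⊢_; _⇒_)
  open Columns
  open Cells
  open Components using (component-cong; isComponent⇒component; component⇒run; column-ext)
  open Chains using (Chain; []; _∷_; total)
  open Counting using (narrow; wide; one; two)
  open import Data.Empty using (⊥; ⊥-elim)
  open import Data.Integer as ℤ using (ℤ; +_; 0ℤ; 1ℤ; _+_; _-_; _≤_; _<_)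
  import Data.Integer.Properties as ℤ
  open import Data.List using (List; []; _∷_; length; map)
  open import Data.List.Membership.Propositional using (_∈_)
  open import Data.List.Membership.Propositional.Properties using (∈-map⁺; ∈-map⁻; ∈-++⁺ʳ)
  open import Data.List.Relation.Binary.BagAndSetEquality using (_∼[_]_; set)
  open import Data.List.Relation.Unary.All as All using (All; []; _∷_)
  open import Data.List.Relation.Unary.Any using (here; there)
  open import Data.Nat as ℕ using (ℕ; suc)
  import Data.Nat.Properties as ℕ
  open import Data.Product using (∃-syntax; _×_; _,_; proj₁; proj₂)
  open import Data.Sum using (_⊎_; inj₁; inj₂)
  open import Data.Vec using ([]; _∷_)
  open import Function using (_∘_)
  open import Function.Bundles using (Equivalence)
  open import Relation.Binary.Construct.Closure.ReflexiveTransitive using (Star; _◅◅_; reverse)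
  open import Relation.Nullary using (yes; no)
  open import Relation.Binary.PropositionalEquality
    using (_≡_; refl; sym; trans; cong; cong₂; subst)

  columns : ℕ × List Column → List Column
  columns (a , Cs) = (0ℤ , one a) ∷ Cs

  run-nonempty : ∀ C → ∃[ y ] y ∈ᶜ C
  run-nonempty (p , one a)     = p , here (ℤ.≤-refl , lin (a ∷ []) (p ∷ []) (λ a p → ⊢ p :≤ p :+ a) refl)
  run-nonempty (p , two c g d) = p , here (lin (c ∷ []) (p ∷ []) (λ c p → ⊢ p :- c :≤ p) refl , ℤ.≤-refl)

  module _ (a : ℕ) (Cs : List Column) (chain : Chain (0ℤ , one a) Cs) where

    private
      Cs₀ : List Column
      Cs₀ = (0ℤ , one a) ∷ Cs

      all : List Cell
      all = columnCells 0ℤ Cs₀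

      root : Cell
      root = 0ℤ , 0ℤ

      root∈ : 0ℤ ∈ᶜ (0ℤ , one a)
      root∈ = here (ℤ.≤-refl , ℤ.+≤+ ℕ.z≤n)

      linked : ∀ {x y D} → At 0ℤ Cs₀ x D → y ∈ᶜ D → Star (StepIn all) root (x , y)
      linked here       y∈D = first-linked _ y∈D
        where
        first-linked : ∀ y → y ∈ᶜ (0ℤ , one a) → Star (StepIn all) root (0ℤ , y)
        first-linked y (here y∈r) = within-run all 0ℤ (run 0ℤ (0ℤ + + a))
          (λ z → ∈-cells⁺ (here {0ℤ} {0ℤ , one a} {Cs}) ∘ here) (ℤ.≤-refl , ℤ.+≤+ ℕ.z≤n) y∈r
      linked (there at) y∈D = chain-linked all root 0ℤ (0ℤ , one a) Cs chain
        (λ y y∈C → ∈-cells⁺ (here {0ℤ} {0ℤ , one a} {Cs}) y∈C , linked here y∈C)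
        (λ c → ∈-++⁺ʳ (map (0ℤ ,_) (heights (0ℤ , one a)))) at y∈D

    realise : Polyomino
    realise = record
      { cells     = all
      ; unique    = columnCells-unique 0ℤ Cs₀
      ; nonempty  = λ ()
      ; connected = λ c d c∈ d∈ → reverse stepIn-sym (root-linked c∈) ◅◅ root-linked d∈
      }
      where
      root-linked : ∀ {c} → c ∈ all → Star (StepIn all) root c
      root-linked c∈ = let _ , at , y∈D = ∈-cells⁻ 0ℤ Cs₀ c∈ in linked at y∈D

    area-realise : area realise ≡ suc a ℕ.+ total Cs
    area-realise = length-columnCells 0ℤ Cs₀

    private
      component∈runs : ∀ {x D r} → At 0ℤ Cs₀ x D → IsComponent realise x r → r ∈ runs D
      component∈runs at comp = component⇒run _
        (component-cong (λ y → ∈-cells-At at) (λ y → ∈-cells⁺ at) (isComponent⇒component comp))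

      column-At : ∀ {x} → IsColumn realise x → ∃[ D ] At 0ℤ Cs₀ x D
      column-At (y , xy∈) = let D , at , _ = ∈-cells⁻ 0ℤ Cs₀ xy∈ in D , at

      At-column : ∀ {x D} → At 0ℤ Cs₀ x D → IsColumn realise x
      At-column {D = D} at = let y , y∈D = run-nonempty D in y , ∈-cells⁺ at y∈D

      length-runs : ∀ D → length (runs D) ℕ.≤ 2
      length-runs (p , one a)     = ℕ.s≤s ℕ.z≤n
      length-runs (p , two c g d) = ℕ.s≤s (ℕ.s≤s ℕ.z≤n)

      predecessor : ∀ {x L Cs x′ D} → Chain L Cs → At (x + 1ℤ) Cs x′ D →
        ∃[ w ] ∃[ E ] At x (L ∷ Cs) w E × x′ ≡ w + 1ℤ × Attached E D
      predecessor (attached ∷ chain) here       = _ , _ , here , refl , attached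
      predecessor (attached ∷ chain) (there at) =
        let w , E , at′ , eq , att = predecessor chain at in w , E , there at′ , eq , att

      between : ∀ {x w} → x < w + 1ℤ → w ≤ x ⊎ w + 1ℤ ≤ w → w ≡ x
      between {x} {w} x<w+1 (inj₁ w≤x) =
        lin [] (x ∷ w ∷ []) (λ x w → x :< w :+ con 1ℤ ⇒ w :≤ x ⇒ ⊢ w :≡ x) refl x<w+1 w≤x
      between {x} {w} _ (inj₂ w+1≤w) = ⊥-elim (x+1≰x w+1≤w)

      first : ∀ x → IsFirstColumn realise x → AtMost 1 (IsComponent realise x)
      first x (column , leftmost) with column-At column
      ... | _ , here     = runs (0ℤ , one a) , ℕ.≤-refl , λ r → component∈runs here
      ... | _ , there at = ⊥-elim (x+1≰x (ℤ.≤-trans (At-≤ at) (leftmost 0ℤ (At-column here))))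

      attach : ∀ x x′ → AdjacentColumns realise x x′ → ∀ r → IsComponent realise x′ r →
        ∃[ y ] ∃[ y′ ] (x , y) ∈ all × y′ ∈ᴿ r × ShareEdge (x , y) (x′ , y′)
      attach x x′ (column , column′ , x<x′ , adjacent) r comp with column-At column′
      ... | _ , here = let _ , at = column-At column in ⊥-elim (ℤ.<⇒≱ x<x′ (At-≤ at))
      ... | D , there at with predecessor chain at
      -- The left neighbour w in the list is the adjacent column x, since no column lies strictly
      -- between x and w + 1.
      ... | w , E , at′ , refl , attached with between x<x′ (adjacent w (At-column at′))
      ... | refl = let y , y′ , y∈E , y′∈r , lo , hi = All.lookup attached (component∈runs (there at) comp)
                   in y , y′ , ∈-cells⁺ at′ y∈E , y′∈r , shareEdge-right w lo hi

      gap : ∀ x r s → IsComponent realise x r → IsComponent realise x s → top r < bottom s →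
        AtMost 2 (InGap x r s)
      gap x r s comp-r comp-s r<s with column-At (bottom r , IsComponent.contained comp-r (bottom r)
                                                    (ℤ.≤-refl , IsComponent.inhabited comp-r))
      ... | D , at = small D (component∈runs at comp-r) (component∈runs at comp-s)
                       (IsComponent.inhabited comp-r) r<s
        where
        inGap : ∀ p g y → p < y → y < p + rise g → (x , y) ∈ (x , p + 1ℤ) ∷ (x , p + + 2) ∷ []
        inGap p narrow y p<y y<q = here (cong (x ,_) (only p<y y<q))
          where
          only : p < y → y < p + + 2 → y ≡ p + 1ℤ
          only = lin [] (p ∷ y ∷ []) (λ p y → p :< y ⇒ y :< p :+ con (+ 2) ⇒ ⊢ y :≡ p :+ con 1ℤ) refl
        inGap p wide y p<y y<q with y ℤ.≟ p + 1ℤ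
        ... | yes refl = here refl
        ... | no  y≢p+1 = there (here (cong (x ,_) (only (ℤ.≤∧≢⇒< (low p<y) (y≢p+1 ∘ sym)) y<q)))
          where
          low : p < y → p + 1ℤ ≤ y
          low = lin [] (p ∷ y ∷ []) (λ p y → p :< y ⇒ ⊢ p :+ con 1ℤ :≤ y) refl
          only : p + 1ℤ < y → y < p + + 3 → y ≡ p + + 2
          only = lin [] (p ∷ y ∷ []) (λ p y →
            p :+ con 1ℤ :< y ⇒ y :< p :+ con (+ 3) ⇒ ⊢ y :≡ p :+ con (+ 2)) refl
        small : ∀ D {r s} → r ∈ runs D → s ∈ runs D → bottom r ≤ top r → top r < bottom s →
          AtMost 2 (InGap x r s)
        small (p , one _) (here refl) (here refl) b≤t t<b = ⊥-elim (ℤ.<⇒≱ t<b b≤t)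
        small (p , two c g d) (here refl) (here refl) b≤t t<b = ⊥-elim (ℤ.<⇒≱ t<b b≤t)
        small (p , two c g d) (here refl) (there (here refl)) _ _ =
          -- One list serves both gap sizes, since `AtMost` only asks for a list that covers the
          -- gap; a narrow gap consists of the first cell alone.
          (x , p + 1ℤ) ∷ (x , p + + 2) ∷ [] , ℕ.≤-refl ,
          λ { (_ , y) (refl , p<y , y<q) → inGap p g y p<y y<q }
        small (p , two c g d) (there (here refl)) (there (here refl)) b≤t t<b = ⊥-elim (ℤ.<⇒≱ t<b b≤t)
        small (p , two c g d) (there (here refl)) (here refl) _ t<b = ⊥-elim (reversed t<b (gap<rise g))
          where
          reversed : p + rise g + + d < p - + c → 1ℤ < rise g → ⊥
          reversed = lin (c ∷ d ∷ []) (p ∷ rise g ∷ []) (λ c d p q →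
            p :+ q :+ d :< p :- c ⇒ con 1ℤ :< q ⇒ ⊢ false) refl

    realise-cheesy : Cheesy 2 realise
    realise-cheesy = record
      { semiDirected  = record { firstConnected = first ; attached = attach }
      ; twoComponents = λ x column → let D , at = column-At column in
          runs D , length-runs D , λ r → component∈runs at
      ; smallGap      = gap
      }

  -- At position x only the head has cells, and all cells of the tail are at x + 1 or further right,
  -- so heads and tails can be compared separately.
  columns-ext : ∀ x Cs Ds → (∀ c → c ∈ columnCells x Cs → c ∈ columnCells x Ds) →
    (∀ c → c ∈ columnCells x Ds → c ∈ columnCells x Cs) → Cs ≡ Ds
  columns-ext x []       []       to from = refl
  columns-ext x []       (D ∷ Ds) to from with from _ (∈-cells⁺ (here {x} {D} {Ds}) (proj₂ (run-nonempty D)))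
  ... | ()
  columns-ext x (C ∷ Cs) []       to from with to _ (∈-cells⁺ (here {x} {C} {Cs}) (proj₂ (run-nonempty C)))
  ... | ()
  columns-ext x (C ∷ Cs) (D ∷ Ds) to from = cong₂ _∷_
    (column-ext (λ y y∈ → ∈-cells-At {Cs = D ∷ Ds} here (to _ (∈-cells⁺ (here {Cs = Cs}) y∈)))
                (λ y y∈ → ∈-cells-At {Cs = C ∷ Cs} here (from _ (∈-cells⁺ (here {Cs = Ds}) y∈))))
    (columns-ext (x + 1ℤ) Cs Ds (tail {Cs} {Ds} C D to) (tail {Ds} {Cs} D C from))
    where
    tail : ∀ {Cs Ds} C D → (∀ c → c ∈ columnCells x (C ∷ Cs) → c ∈ columnCells x (D ∷ Ds)) →
      ∀ c → c ∈ columnCells (x + 1ℤ) Cs → c ∈ columnCells (x + 1ℤ) Ds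
    tail {Cs} {Ds} C D to c c∈ with ∈-cells⁻ (x + 1ℤ) Cs c∈
    ... | E , at , y∈E with ∈-cells⁻ x (D ∷ Ds) (to _ (∈-cells⁺ (there {C = C} at) y∈E))
    ... | F , here      , _   = ⊥-elim (x+1≰x (At-≤ at))
    ... | F , there at′ , y∈F = ∈-cells⁺ at′ y∈F

  private
    translate-∈ : ∀ {t cs ds} → map (translate t) cs ∼[ set ] ds →
      ∀ c → c ∈ cs → translate t c ∈ ds
    translate-∈ {t} eq c c∈ = Equivalence.to eq (∈-map⁺ (translate t) c∈)

    untranslate-∈ : ∀ {t cs ds} → map (translate t) cs ∼[ set ] ds →
      ∀ c → c ∈ ds → ∃[ d ] d ∈ cs × c ≡ translate t d
    untranslate-∈ {t} eq c c∈ = ∈-map⁻ (translate t) (Equivalence.from eq c∈)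

  -- Both first columns have their lowest cell at (0 , 0), so the translation is trivial.
  realise-injective : ∀ {a Cs b Ds} (c : Chain (0ℤ , one a) Cs) (d : Chain (0ℤ , one b) Ds) →
    realise a Cs c ≈ₜ realise b Ds d → (a , Cs) ≡ (b , Ds)
  realise-injective {a} {Cs} {b} {Ds} c d ((s , t) , eq) = same (columns-ext 0ℤ
    (columns (a , Cs)) (columns (b , Ds)) to from)
    where
    root∈ : ∀ {a Cs} → (0ℤ , 0ℤ) ∈ columnCells 0ℤ (columns (a , Cs))
    root∈ {a} {Cs} = ∈-cells⁺ (here {0ℤ} {0ℤ , one a} {Cs}) (here (ℤ.≤-refl , ℤ.+≤+ ℕ.z≤n))

    0≤x : ∀ {x y} Cs → (x , y) ∈ columnCells 0ℤ Cs → 0ℤ ≤ x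
    0≤x Cs xy∈ = let _ , at , _ = ∈-cells⁻ 0ℤ Cs xy∈ in At-≤ at

    0≤y : ∀ {y a Cs} → (0ℤ , y) ∈ columnCells 0ℤ (columns (a , Cs)) → 0ℤ ≤ y
    0≤y {y} {a} {Cs} y∈ with ∈-cells-At (here {0ℤ} {0ℤ , one a} {Cs}) y∈
    ... | here (0≤y , _) = 0≤y

    forth : (0ℤ + s , 0ℤ + t) ∈ columnCells 0ℤ (columns (b , Ds))
    forth = translate-∈ eq (0ℤ , 0ℤ) (root∈ {a} {Cs})

    back : ∃[ z ] z ∈ columnCells 0ℤ (columns (a , Cs)) × (0ℤ , 0ℤ) ≡ translate (s , t) z
    back = untranslate-∈ eq (0ℤ , 0ℤ) (root∈ {b} {Ds})

    s≡0 : s ≡ 0ℤ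
    s≡0 with back
    ... | (x , y) , xy∈ , z≡ = zero-sum
      (0≤x (columns (b , Ds)) forth) (0≤x (columns (a , Cs)) xy∈) (cong proj₁ z≡)
      where
      zero-sum : 0ℤ ≤ 0ℤ + s → 0ℤ ≤ x → 0ℤ ≡ x + s → s ≡ 0ℤ
      zero-sum = lin [] (s ∷ x ∷ []) (λ s x →
        con 0ℤ :≤ con 0ℤ :+ s ⇒ con 0ℤ :≤ x ⇒ con 0ℤ :≡ x :+ s ⇒ ⊢ s :≡ con 0ℤ) refl

    -- Later columns may reach below height 0. The vertical bound holds in the first column only, so
    -- s = 0 has to be known before.
    t≡0 : t ≡ 0ℤ
    t≡0 with back
    ... | (x , y) , xy∈ , z≡ = zero-sum
      (0≤y {a = b} {Ds} (subst (λ s → (0ℤ + s , 0ℤ + t) ∈ columnCells 0ℤ (columns (b , Ds))) s≡0 forth))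
      (0≤y {a = a} {Cs} (subst (λ x → (x , y) ∈ columnCells 0ℤ (columns (a , Cs))) x≡0 xy∈))
      (cong proj₂ z≡)
      where
      x≡0 : x ≡ 0ℤ
      x≡0 = trans (sym (ℤ.+-identityʳ x)) (trans (cong (_+_ x) (sym s≡0)) (sym (cong proj₁ z≡)))
      zero-sum : 0ℤ ≤ 0ℤ + t → 0ℤ ≤ y → 0ℤ ≡ y + t → t ≡ 0ℤ
      zero-sum = lin [] (t ∷ y ∷ []) (λ t y →
        con 0ℤ :≤ con 0ℤ :+ t ⇒ con 0ℤ :≤ y ⇒ con 0ℤ :≡ y :+ t ⇒ ⊢ t :≡ con 0ℤ) refl

    translate≡ : ∀ z → translate (s , t) z ≡ z
    translate≡ (x , y) = cong₂ _,_
      (trans (cong (_+_ x) s≡0) (ℤ.+-identityʳ x)) (trans (cong (_+_ y) t≡0) (ℤ.+-identityʳ y))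

    to : ∀ z → z ∈ columnCells 0ℤ (columns (a , Cs)) → z ∈ columnCells 0ℤ (columns (b , Ds))
    to z z∈ = subst (_∈ columnCells 0ℤ (columns (b , Ds))) (translate≡ z) (translate-∈ eq z z∈)

    from : ∀ z → z ∈ columnCells 0ℤ (columns (b , Ds)) → z ∈ columnCells 0ℤ (columns (a , Cs))
    from z z∈ with untranslate-∈ eq z z∈
    ... | w , w∈ , z≡ = subst (_∈ columnCells 0ℤ (columns (a , Cs))) (trans (sym (translate≡ w)) (sym z≡)) w∈

    same : columns (a , Cs) ≡ columns (b , Ds) → (a , Cs) ≡ (b , Ds)
    same refl = refl

-- Recognising an encoded column in a finite set of heights.

module Extraction where

  open LinearArithmetic using (lin; _:≤_; _:<_; _:≡_; _:+_; _:-_; con; false; ⊢_; _⇒_)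
  open Enumerations using (≤⇒∃)
  open Columns
  open Components
  open Counting using (narrow; wide; one; two)
  open import Data.Empty using (⊥; ⊥-elim)
  open import Data.Integer as ℤ using (ℤ; +_; 0ℤ; 1ℤ; _+_; _-_; _≤_; _<_)
  import Data.Integer.Properties as ℤ
  open import Data.List using (List; []; _∷_)
  open import Data.List.Membership.Propositional using (_∈_)
  open import Data.List.Relation.Unary.All using ([]; _∷_)
  open import Data.List.Relation.Unary.Any using (here; there)
  open import Data.Nat as ℕ using (ℕ; zero; suc)
  import Data.Nat.Properties as ℕ
  open import Data.Product using (∃-syntax; _×_; _,_; proj₁)
  open import Data.Sum using (_⊎_; inj₁; inj₂)
  open import Data.Vec using ([]; _∷_)
  open import Function using (_∘_)
  open import Relation.Nullary using (¬_; Dec; yes; no; _×-dec_)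
  open import Relation.Binary.PropositionalEquality using (_≡_; _≢_; refl; sym; cong; subst)

  least : ∀ {Q : ℤ → Set} → (∀ y → Dec (Q y)) → ∀ xs → (∀ y → Q y → y ∈ xs) →
    (∀ y → ¬ Q y) ⊎ ∃[ m ] Q m × (∀ y → Q y → m ≤ y)
  least {Q} Q? xs covers with search xs
    where
    search : ∀ xs → (∀ y → y ∈ xs → ¬ Q y) ⊎ ∃[ m ] Q m × (∀ y → y ∈ xs → Q y → m ≤ y)
    search []       = inj₁ λ _ ()
    search (x ∷ xs) with Q? x | search xs
    ... | no ¬q | inj₁ none = inj₁ λ { _ (here refl) → ¬q ; y (there y∈) → none y y∈ }
    ... | no ¬q | inj₂ (m , q , m≤) = inj₂ (m , q , λ
      { _ (here refl) q′ → ⊥-elim (¬q q′) ; y (there y∈) → m≤ y y∈ })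
    ... | yes q | inj₁ none = inj₂ (x , q , λ
      { _ (here refl) _ → ℤ.≤-refl ; y (there y∈) q′ → ⊥-elim (none y y∈ q′) })
    ... | yes q | inj₂ (m , q′ , m≤) with ≤-<-connex x m
    ... | inj₁ x≤m = inj₂ (x , q , λ
      { _ (here refl) _ → ℤ.≤-refl ; y (there y∈) r → ℤ.≤-trans x≤m (m≤ y y∈ r) })
    ... | inj₂ m<x = inj₂ (m , q′ , λ { _ (here refl) _ → ℤ.<⇒≤ m<x ; y (there y∈) → m≤ y y∈ })
  ... | inj₁ none          = inj₁ λ y q → none y (covers y q) q
  ... | inj₂ (m , q , m≤) = inj₂ (m , q , λ y q′ → m≤ y (covers y q′) q′)

  upperBound : ∀ xs → ∃[ b ] ∀ y → y ∈ xs → y ≤ b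
  upperBound []       = 0ℤ , λ _ ()
  upperBound (x ∷ xs) = let b , ≤b = upperBound xs in x ℤ.⊔ b , λ
    { _ (here refl) → ℤ.i≤i⊔j x b ; y (there y∈) → ℤ.≤-trans (≤b y y∈) (ℤ.i≤j⊔i x b) }

  atMost-one : ∀ {A : Set} {P : A → Set} → AtMost 1 P → ∀ {a b} → P a → P b → a ≡ b
  atMost-one ([]         , _             , covers) p _ with covers _ p
  ... | ()
  atMost-one (_ ∷ []     , _             , covers) p q with covers _ p | covers _ q
  ... | here refl | here refl = refl
  atMost-one (_ ∷ _ ∷ _  , ℕ.s≤s ()      , _)

  atMost-two : ∀ {A : Set} {P : A → Set} → AtMost 2 P → ∀ {a b c} → P a → P b → P c →
    a ≢ b → a ≢ c → b ≢ c → ⊥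
  atMost-two ([]            , _ , covers) p _ _ _ _ _ with covers _ p
  ... | ()
  atMost-two (_ ∷ []        , _ , covers) p q _ a≢b _ _ with covers _ p | covers _ q
  ... | here refl | here refl = a≢b refl
  atMost-two (_ ∷ _ ∷ []    , _ , covers) p q r a≢b a≢c b≢c with covers _ p | covers _ q | covers _ r
  ... | here refl         | here refl         | _                 = a≢b refl
  ... | here refl         | there (here refl) | here refl         = a≢c refl
  ... | here refl         | there (here refl) | there (here refl) = b≢c refl
  ... | there (here refl) | here refl         | here refl         = b≢c refl
  ... | there (here refl) | here refl         | there (here refl) = a≢c refl
  ... | there (here refl) | there (here refl) | _                 = a≢b refl
  atMost-two (_ ∷ _ ∷ _ ∷ _ , ℕ.s≤s (ℕ.s≤s ()) , _)

  +suc : ∀ y n → y + + suc n ≡ y + 1ℤ + + n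
  +suc y n = lin (n ∷ []) (y ∷ []) (λ n y → ⊢ y :+ (con 1ℤ :+ n) :≡ y :+ con 1ℤ :+ n) refl

  private
    point : ∀ {y z} → y ≤ z → z ≤ y + 0ℤ → y ≡ z
    point {y} {z} = lin [] (y ∷ z ∷ []) (λ y z → y :≤ z ⇒ z :≤ y :+ con 0ℤ ⇒ ⊢ y :≡ z) refl

    y+0+1≰y+0 : ∀ {y} → ¬ (y + 0ℤ + 1ℤ ≤ y + 0ℤ)
    y+0+1≰y+0 {y} = lin [] (y ∷ []) (λ y → y :+ con 0ℤ :+ con 1ℤ :≤ y :+ con 0ℤ ⇒ ⊢ false) refl

    <⇒+1≤ : ∀ {y z} → y < z → y + 1ℤ ≤ z
    <⇒+1≤ {y} {z} = lin [] (y ∷ z ∷ []) (λ y z → y :< z ⇒ ⊢ y :+ con 1ℤ :≤ z) refl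

    +1<⇒<-1 : ∀ {y z} → y + 1ℤ < z → y < z - 1ℤ
    +1<⇒<-1 {y} {z} = lin [] (y ∷ z ∷ []) (λ y z → y :+ con 1ℤ :< z ⇒ ⊢ y :< z :- con 1ℤ) refl

    s≰s-1 : ∀ {s} → ¬ (s ≤ s - 1ℤ)
    s≰s-1 {s} = lin [] (s ∷ []) (λ s → s :≤ s :- con 1ℤ ⇒ ⊢ false) refl

  module _ {A : ℤ → Set} (A? : ∀ y → Dec (A y)) (ys : List ℤ) (covers : ∀ y → A y → y ∈ ys) where

    Ascent : ℤ → Set
    Ascent y = ∃[ k ] (∀ z → y ≤ z → z ≤ y + + k → A z) × ¬ A (y + + k + 1ℤ)

    private
      stop : ∀ {y} → A y → ¬ A (y + 1ℤ) → Ascent y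
      stop {y} a ¬a = 0 , (λ z y≤z z≤y → subst A (point y≤z z≤y) a) ,
        ¬a ∘ subst A (cong (_+ 1ℤ) (ℤ.+-identityʳ y))

      go-on : ∀ {y} → A y → Ascent (y + 1ℤ) → Ascent y
      go-on {y} a (k , inside , ¬above) =
        suc k , extended , ¬above ∘ subst A (cong (_+ 1ℤ) (+suc y k))
        where
        extended : ∀ z → y ≤ z → z ≤ y + + suc k → A z
        extended z y≤z z≤ with y ℤ.≟ z
        ... | yes refl = a
        ... | no  y≢z  = inside z (<⇒+1≤ (ℤ.≤∧≢⇒< y≤z y≢z)) (subst (z ≤_) (+suc y k) z≤)

    -- `n` bounds the distance to the highest element and makes the search terminate; when it is 0,
    -- nothing lies above y.
    ascend : ∀ n y → A y → (∀ z → A z → z ≤ y + + n) → Ascent y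
    ascend zero    y a ≤y = stop a λ a′ →
      y+0+1≰y+0 {y} (≤y _ (subst A (cong (_+ 1ℤ) (sym (ℤ.+-identityʳ y))) a′))
    ascend (suc n) y a ≤y with A? (y + 1ℤ)
    ... | no ¬a  = stop a ¬a
    ... | yes a′ = go-on a (ascend n (y + 1ℤ) a′ λ z a″ → subst (z ≤_) (+suc y n) (≤y z a″))

    component-at : ∀ s → A s → ¬ A (s - 1ℤ) → ∃[ n ] Component A (run s (s + + n))
    component-at s a ¬below with upperBound ys
    ... | b , ≤b with ≤⇒∃ (≤b s (covers s a))
    ... | m , refl with ascend m s a (λ z a′ → ≤b z (covers z a′))
    ... | n , inside , ¬above = n , record
      { inhabited    = lin (n ∷ []) (s ∷ []) (λ n s → ⊢ s :≤ s :+ n) refl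
      ; contained    = λ y (lo , hi) → inside y lo hi
      ; maximalBelow = ¬below
      ; maximalAbove = ¬above
      }

    -- The least element above t starts a component. As t + 1 is missing, the height just below that
    -- element is still above t, so by minimality it is not an element.
    next-component : ∀ t → ¬ A (t + 1ℤ) →
      (∀ y → A y → y ≤ t) ⊎
      ∃[ s ] ∃[ n ] t + 1ℤ < s × Component A (run s (s + + n)) × (∀ y → A y → t < y → s ≤ y)
    next-component t ¬a with least (λ y → A? y ×-dec (t ℤ.<? y)) ys (λ y → covers y ∘ proj₁)
    ... | inj₁ none = inj₁ λ y a → ℤ.≮⇒≥ λ t<y → none y (a , t<y)
    ... | inj₂ (s , (a , t<s) , s≤) with component-at s a (λ a′ → s≰s-1 (s≤ (s - 1ℤ) (a′ , +1<⇒<-1 t+1<s)))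
      where
      t+1<s : t + 1ℤ < s
      t+1<s = ℤ.≤∧≢⇒< (<⇒+1≤ t<s) λ { refl → ¬a a }
    ... | n , comp = inj₂ (s , n , ℤ.≤∧≢⇒< (<⇒+1≤ t<s) (λ { refl → ¬a a }) , comp ,
      λ y a′ t<y → s≤ y (a′ , t<y))

    -- Components are collected from below. A third one contradicts the bound on their number, and
    -- for two of them the gap condition leaves the distances 2 and 3 only.
    extract-column : ∃[ y ] A y → AtMost 2 (Component A) →
      (∀ r s → Component A r → Component A s → top r < bottom s → bottom s ≤ top r + + 3) →
      ∃[ D ] (∀ y → A y → y ∈ᶜ D) × (∀ y → y ∈ᶜ D → A y)
    extract-column (y₀ , a₀) two-at-most small with least A? ys covers
    ... | inj₁ none = ⊥-elim (none y₀ a₀)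
    ... | inj₂ (s , a , s≤) with component-at s a (λ a′ → s≰s-1 (s≤ (s - 1ℤ) a′))
    ... | n , comp with next-component (s + + n) (maximalAbove comp)
    ... | inj₁ none = (s , one n) ,
      (λ y a′ → here (s≤ y a′ , none y a′)) , λ { y (here y∈) → contained comp y y∈ }
    ... | inj₂ (s′ , n′ , t<s′ , comp′ , s′≤) with next-component (s′ + + n′) (maximalAbove comp′)
    ... | inj₂ (s″ , n″ , t′<s″ , comp″ , _) = ⊥-elim (atMost-two two-at-most comp comp′ comp″
      (λ eq → first<second t<s′ (cong bottom eq))
      (λ eq → first<third t<s′ t′<s″ (cong bottom eq))
      (λ eq → second<third t′<s″ (cong bottom eq)))
      where
      first<second : s + + n + 1ℤ < s′ → s ≢ s′
      first<second = lin (n ∷ []) (s ∷ s′ ∷ []) (λ n s s′ →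
        s :+ n :+ con 1ℤ :< s′ ⇒ s :≡ s′ ⇒ ⊢ false) refl
      first<third : s + + n + 1ℤ < s′ → s′ + + n′ + 1ℤ < s″ → s ≢ s″
      first<third = lin (n ∷ n′ ∷ []) (s ∷ s′ ∷ s″ ∷ []) (λ n n′ s s′ s″ →
        s :+ n :+ con 1ℤ :< s′ ⇒ s′ :+ n′ :+ con 1ℤ :< s″ ⇒ s :≡ s″ ⇒ ⊢ false) refl
      second<third : s′ + + n′ + 1ℤ < s″ → s′ ≢ s″
      second<third = lin (n′ ∷ []) (s′ ∷ s″ ∷ []) (λ n s s′ →
        s :+ n :+ con 1ℤ :< s′ ⇒ s :≡ s′ ⇒ ⊢ false) refl
    ... | inj₁ none = fit (measure t<s′ (small _ _ comp comp′ (weaken t<s′)))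
      where
      t : ℤ
      t = s + + n
      weaken : s + + n + 1ℤ < s′ → s + + n < s′
      weaken = lin (n ∷ []) (s ∷ s′ ∷ []) (λ n s s′ → s :+ n :+ con 1ℤ :< s′ ⇒ ⊢ s :+ n :< s′) refl
      measure : t + 1ℤ < s′ → s′ ≤ t + + 3 → ∃[ g ] s′ ≡ t + rise g
      measure lo hi with s′ ℤ.≟ t + + 2
      ... | yes eq = narrow , eq
      ... | no  s′≢ = wide , ℤ.≤-antisym hi (next (ℤ.≤∧≢⇒< (next′ lo) (s′≢ ∘ sym)))
        where
        next′ : t + 1ℤ < s′ → t + + 2 ≤ s′
        next′ = lin [] (t ∷ s′ ∷ []) (λ t s → t :+ con 1ℤ :< s ⇒ ⊢ t :+ con (+ 2) :≤ s) refl
        next : t + + 2 < s′ → t + + 3 ≤ s′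
        next = lin [] (t ∷ s′ ∷ []) (λ t s → t :+ con (+ 2) :< s ⇒ ⊢ t :+ con (+ 3) :≤ s) refl
      bottom≡ : s ≡ t - + n
      bottom≡ = lin (n ∷ []) (s ∷ []) (λ n s → ⊢ s :≡ s :+ n :- n) refl
      fit : ∃[ g ] s′ ≡ t + rise g → ∃[ D ] (∀ y → A y → y ∈ᶜ D) × (∀ y → y ∈ᶜ D → A y)
      fit (g , eq) = (t , two n g n′) , to , from
        where
        to : ∀ y → A y → y ∈ᶜ (t , two n g n′)
        to y a′ with ≤-<-connex y t
        ... | inj₁ y≤t = here (subst (_≤ y) bottom≡ (s≤ y a′) , y≤t)
        ... | inj₂ t<y = there (here
          ( subst (_≤ y) eq (s′≤ y a′ t<y)
          , subst (λ z → y ≤ z + + n′) eq (none y a′) ))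
        from : ∀ y → y ∈ᶜ (t , two n g n′) → A y
        from y (here (lo , hi))         = contained comp y (subst (_≤ y) (sym bottom≡) lo , hi)
        from y (there (here (lo , hi))) = contained comp′ y
          (subst (_≤ y) (sym eq) lo , subst (λ z → y ≤ z + + n′) (sym eq) hi)

-- From cheesy polyominoes to chains.

module Decompositions where

  open LinearArithmetic using (lin; _:≤_; _:<_; _:≡_; _:+_; _:-_; con; false; ⊢_; _⇒_)
  open Enumerations using (≤⇒∃)
  open Columns
  open Components
  open Cells
  open Extraction
  open Realisation
  open Chains using (Chain; []; _∷_; total; Normalised)
  open Counting using (one; two)
  open import Data.Empty using (⊥; ⊥-elim)
  open import Data.Integer as ℤ using (ℤ; +_; 0ℤ; 1ℤ; _+_; _-_; -_; _≤_; _<_)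
  import Data.Integer.Properties as ℤ
  open import Data.List using (List; []; _∷_; _++_; map; upTo)
  open import Data.List.Properties using (map-∘; map-++) renaming (map-cong to map-≗)
  open import Data.List.Membership.Propositional using (_∈_; _∉_)
  open import Data.List.Membership.Propositional.Properties using (∈-map⁺; ∈-map⁻)
  open import Data.List.Membership.Propositional.Properties.WithK using (unique∧set⇒bag)
  import Data.List.Membership.DecPropositional as DecMembership
  open import Data.List.Relation.Binary.BagAndSetEquality
    using (_∼[_]_; set; [_]-Equality; ∼bag⇒↭)
    renaming (map-cong to ∼-map)
  open import Data.List.Relation.Binary.Permutation.Propositional.Properties using (↭-length)
  open import Data.List.Relation.Unary.All as All using (All; []; _∷_)
  open import Data.List.Relation.Unary.Any using (here; there)
  open import Data.Nat as ℕ using (ℕ; zero; suc)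
  import Data.Nat.Properties as ℕ
  open import Data.Product using (Σ; ∃-syntax; _×_; _,_; proj₁; proj₂)
  open import Data.Product.Properties using (≡-dec)
  open import Data.Sum using (_⊎_; inj₁; inj₂)
  open import Data.Vec using ([]; _∷_)
  open import Function using (_∘_)
  open import Function.Bundles using (mk⇔)
  open import Relation.Nullary using (Dec; yes; no; _×-dec_)
  open import Relation.Binary using (Setoid)
  open import Relation.Binary.PropositionalEquality
    using (_≡_; _≢_; refl; sym; trans; cong; cong₂; subst)

  shareEdge⇒right : ∀ {x x′ y y′} → x < x′ → ShareEdge (x , y) (x′ , y′) →
    x′ ≡ x + 1ℤ × y - 1ℤ ≤ y′ × y′ ≤ y
  shareEdge⇒right {y = y} x<x (here refl)         = ⊥-elim (ℤ.<-irrefl refl x<x)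
  shareEdge⇒right {y = y} x<x (there (here refl)) = ⊥-elim (ℤ.<-irrefl refl x<x)
  shareEdge⇒right {y = y} _ (there (there (here refl))) =
    refl , lin [] (y ∷ []) (λ y → ⊢ y :- con 1ℤ :≤ y) refl , ℤ.≤-refl
  shareEdge⇒right {y = y} _ (there (there (there (here refl)))) =
    refl , ℤ.≤-refl , lin [] (y ∷ []) (λ y → ⊢ y :- con 1ℤ :≤ y) refl
  shareEdge⇒right {x} x<x-1 (there (there (there (there (here refl))))) = ⊥-elim
    (lin [] (x ∷ []) (λ x → x :< x :- con 1ℤ ⇒ ⊢ false) refl x<x-1)
  shareEdge⇒right {x} x<x-1 (there (there (there (there (there (here refl)))))) = ⊥-elim
    (lin [] (x ∷ []) (λ x → x :< x :- con 1ℤ ⇒ ⊢ false) refl x<x-1)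

  module Decomposition (P : Polyomino) (cheesy : Cheesy 2 P) where

    open RightwardSemiDirected (Cheesy.semiDirected cheesy)
    open DecMembership (≡-dec ℤ._≟_ ℤ._≟_) using (_∈?_)

    private
      xs ys : List ℤ
      xs = map proj₁ (cells P)
      ys = map proj₂ (cells P)

    isColumn? : ∀ x → Dec (x ∈ xs)
    isColumn? x = DecMembership._∈?_ ℤ._≟_ x xs

    column⇒∈ : ∀ {x} → IsColumn P x → x ∈ xs
    column⇒∈ (_ , xy∈) = ∈-map⁺ proj₁ xy∈

    ∈⇒column : ∀ {x} → x ∈ xs → IsColumn P x
    ∈⇒column x∈ with ∈-map⁻ proj₁ x∈
    ... | (_ , y) , xy∈ , refl = y , xy∈

    -- Otherwise the gap would contain the three distinct cells above `top r`, too many for a list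
    -- of length two.
    smallGap′ : ∀ x r s → IsComponent P x r → IsComponent P x s → top r < bottom s →
      bottom s ≤ top r + + 3
    smallGap′ x r s comp-r comp-s r<s with ≤-<-connex (bottom s) (top r + + 3)
    ... | inj₁ small = small
    ... | inj₂ large = ⊥-elim (atMost-two (Cheesy.smallGap cheesy x r s comp-r comp-s r<s)
      {x , top r + 1ℤ} {x , top r + + 2} {x , top r + + 3}
      (refl , lin [] (top r ∷ []) (λ t → ⊢ t :< t :+ con 1ℤ) refl ,
        lin [] (top r ∷ bottom s ∷ []) (λ t s → t :+ con (+ 3) :< s ⇒ ⊢ t :+ con 1ℤ :< s) refl large)
      (refl , lin [] (top r ∷ []) (λ t → ⊢ t :< t :+ con (+ 2)) refl ,
        lin [] (top r ∷ bottom s ∷ []) (λ t s → t :+ con (+ 3) :< s ⇒ ⊢ t :+ con (+ 2) :< s) refl large)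
      (refl , lin [] (top r ∷ []) (λ t → ⊢ t :< t :+ con (+ 3)) refl , large)
      (λ eq → lin [] (top r ∷ []) (λ t → t :+ con 1ℤ :≡ t :+ con (+ 2) ⇒ ⊢ false) refl (cong proj₂ eq))
      (λ eq → lin [] (top r ∷ []) (λ t → t :+ con 1ℤ :≡ t :+ con (+ 3) ⇒ ⊢ false) refl (cong proj₂ eq))
      (λ eq → lin [] (top r ∷ []) (λ t → t :+ con (+ 2) :≡ t :+ con (+ 3) ⇒ ⊢ false) refl (cong proj₂ eq)))

    Fits : ℤ → Column → Set
    Fits x D = (∀ y → (x , y) ∈ cells P → y ∈ᶜ D) × (∀ y → y ∈ᶜ D → (x , y) ∈ cells P)

    column-at : ∀ x → IsColumn P x → ∃[ D ] Fits x D
    column-at x column = extract-column (λ y → (x , y) ∈? cells P) ys (λ y → ∈-map⁺ proj₂) column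
      (let rs , length≤2 , covers = Cheesy.twoComponents cheesy x column in
       rs , length≤2 , λ r comp → covers r (component⇒isComponent {P} comp))
      (λ r s comp-r comp-s → smallGap′ x r s
        (component⇒isComponent {P} comp-r) (component⇒isComponent {P} comp-s))

    fits⇒isComponent : ∀ {x D r} → Fits x D → r ∈ runs D → IsComponent P x r
    fits⇒isComponent {D = D} (to , from) r∈ =
      component⇒isComponent {P} (component-cong from to (run⇒component D r∈))

    -- An edge between different stacks joins stacks at distance 1. Any run of the right column thus
    -- shows that adjacent columns have consecutive positions; `next` takes the first run.
    attached-columns : ∀ {x x′ D E} → AdjacentColumns P x x′ → Fits x D → Fits x′ E →
      x′ ≡ x + 1ℤ × Attached D E
    attached-columns {x} {x′} {D} {E} adjacent@(_ , _ , x<x′ , _) (toD , _) fitsE =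
      next E (All.tabulate touch) , All.tabulate (proj₂ ∘ touch)
      where
      touch : ∀ {r} → r ∈ runs E → x′ ≡ x + 1ℤ × Touches D r
      touch {r} r∈ =
        let y , y′ , xy∈ , y′∈r , edge = attached x x′ adjacent r (fits⇒isComponent {D = E} fitsE r∈)
            x′≡ , lo , hi              = shareEdge⇒right x<x′ edge
        in x′≡ , y , y′ , toD y xy∈ , y′∈r , lo , hi
      next : ∀ E → All (λ r → x′ ≡ x + 1ℤ × Touches D r) (runs E) → x′ ≡ x + 1ℤ
      next (_ , one _)     ((eq , _) ∷ _) = eq
      next (_ , two _ _ _) ((eq , _) ∷ _) = eq

    Rightward : ℤ → Column → List Column → Set
    Rightward x D Cs = Chain D Cs ×
      (∀ {x′ y} → x + 1ℤ ≤ x′ → (x′ , y) ∈ cells P → (x′ , y) ∈ columnCells (x + 1ℤ) Cs) ×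
      (∀ {x′ y} → (x′ , y) ∈ columnCells (x + 1ℤ) Cs → (x′ , y) ∈ cells P)

    cells-∷⁺ : ∀ {x} E Cs → Fits x E →
      (∀ {x′ y} → x + 1ℤ ≤ x′ → (x′ , y) ∈ cells P → (x′ , y) ∈ columnCells (x + 1ℤ) Cs) →
      ∀ {x′ y} → x ≤ x′ → (x′ , y) ∈ cells P → (x′ , y) ∈ columnCells x (E ∷ Cs)
    cells-∷⁺ {x} E Cs (toE , _) to {x′} {y} x≤x′ xy∈ with x ℤ.≟ x′
    ... | yes refl = ∈-cells⁺ (here {x} {E} {Cs}) (toE y xy∈)
    ... | no  x≢x′ =
      let D , at , y∈D = ∈-cells⁻ (x + 1ℤ) Cs (to (next (ℤ.≤∧≢⇒< x≤x′ x≢x′)) xy∈)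
      in ∈-cells⁺ (there {C = E} at) y∈D
      where
      next : x < x′ → x + 1ℤ ≤ x′
      next = lin [] (x ∷ x′ ∷ []) (λ x x′ → x :< x′ ⇒ ⊢ x :+ con 1ℤ :≤ x′) refl

    cells-∷⁻ : ∀ {x} E Cs → Fits x E →
      (∀ {x′ y} → (x′ , y) ∈ columnCells (x + 1ℤ) Cs → (x′ , y) ∈ cells P) →
      ∀ {x′ y} → (x′ , y) ∈ columnCells x (E ∷ Cs) → (x′ , y) ∈ cells P
    cells-∷⁻ {x} E Cs (_ , fromE) from {x′} {y} xy∈ with ∈-cells⁻ x (E ∷ Cs) xy∈
    ... | _ , here     , y∈E = fromE y y∈E
    ... | _ , there at , y∈D = from (∈-cells⁺ at y∈D)

    rightward : ∀ n x D → IsColumn P x → Fits x D → (∀ x′ → IsColumn P x′ → x′ ≤ x + + n) →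
      ∃[ Cs ] Rightward x D Cs
    rightward n x D column fitsD ≤n
      with least (λ x′ → isColumn? x′ ×-dec (x ℤ.<? x′)) xs (λ _ → proj₁)
    ... | inj₁ none = [] , [] ,
      (λ {x′} {y} x+1≤x′ xy∈ → ⊥-elim (none x′ (column⇒∈ (y , xy∈) , before x+1≤x′))) , λ ()
      where
      before : ∀ {x′} → x + 1ℤ ≤ x′ → x < x′
      before {x′} = lin [] (x ∷ x′ ∷ []) (λ x x′ → x :+ con 1ℤ :≤ x′ ⇒ ⊢ x :< x′) refl
    ... | inj₂ (x′ , (x′∈ , x<x′) , x′≤) with column-at x′ (∈⇒column x′∈)
    ... | E , fitsE with attached-columns (column , ∈⇒column x′∈ , x<x′ , adjacent) fitsD fitsE
      where
      adjacent : ∀ x″ → IsColumn P x″ → x″ ≤ x ⊎ x′ ≤ x″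
      adjacent x″ column″ with ≤-<-connex x″ x
      ... | inj₁ x″≤x = inj₁ x″≤x
      ... | inj₂ x<x″ = inj₂ (x′≤ x″ (column⇒∈ column″ , x<x″))
    ... | refl , attached = extend n ≤n
      where
      -- `n` bounds how far right a column can be. It is matched only now that x′ is known to be x +
      -- 1: for n = 0 this column is beyond the bound, and otherwise the bound for the rest is one
      -- less.
      extend : ∀ n → (∀ x′ → IsColumn P x′ → x′ ≤ x + + n) → ∃[ Cs ] Rightward x D Cs
      extend zero    ≤n = ⊥-elim (ℤ.<⇒≱ x<x′
        (subst (x + 1ℤ ≤_) (ℤ.+-identityʳ x) (≤n (x + 1ℤ) (∈⇒column x′∈))))
      extend (suc n) ≤n =
        let Cs , chain , to , from = rightward n (x + 1ℤ) E (∈⇒column x′∈) fitsE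
              (λ x″ column″ → subst (x″ ≤_) (+suc x n) (≤n x″ column″))
        in E ∷ Cs , attached ∷ chain , cells-∷⁺ E Cs fitsE to , cells-∷⁻ E Cs fitsE from

    decomposition : ∃[ x ] ∃[ p ] ∃[ a ] ∃[ Cs ] Chain (p , one a) Cs ×
      columnCells x ((p , one a) ∷ Cs) ∼[ set ] cells P
    decomposition with least isColumn? xs (λ _ x∈ → x∈)
    ... | inj₁ none = ⊥-elim (empty (cells P) (Polyomino.nonempty P)
      λ x y xy∈ → none x (column⇒∈ (y , xy∈)))
      where
      empty : ∀ cs → cs ≢ [] → (∀ x y → (x , y) ∉ cs) → ⊥
      empty []             cs≢[] _    = cs≢[] refl
      empty ((x , y) ∷ cs) _     none = none x y (here refl)
    ... | inj₂ (x , x∈ , x≤) with column-at x (∈⇒column x∈)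
    ... | (p , two c g d) , fits = ⊥-elim (twoRuns (cong top (atMost-one
        (firstConnected x (∈⇒column x∈ , λ x′ column → x≤ x′ (column⇒∈ column)))
        (fits⇒isComponent {D = p , two c g d} fits (here refl))
        (fits⇒isComponent {D = p , two c g d} fits (there (here refl))))) (gap<rise g))
      where
      twoRuns : p ≡ p + rise g + + d → 1ℤ < rise g → ⊥
      twoRuns = lin (d ∷ []) (p ∷ rise g ∷ []) (λ d p q → p :≡ p :+ q :+ d ⇒ con 1ℤ :< q ⇒ ⊢ false) refl
    ... | (p , one a) , fits =
      let b , ≤b                 = upperBound xs
          n , b≡                 = ≤⇒∃ (≤b x x∈)
          Cs , chain , to , from = rightward n x (p , one a) (∈⇒column x∈) fits
            (λ x′ column → subst (x′ ≤_) b≡ (≤b x′ (column⇒∈ column)))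
      in x , p , a , Cs , chain , λ { {x′ , y} → mk⇔ (cells-∷⁻ (p , one a) Cs fits from)
           (λ xy∈ → cells-∷⁺ (p , one a) Cs fits to (x≤ x′ (column⇒∈ (y , xy∈))) xy∈) }

  -- A column carries no horizontal position. The vertical part of a translation acts on the
  -- columns, the horizontal part on the starting index of `columnCells`.
  shift : ℤ → Column → Column
  shift t (p , s) = p + t , s

  private
    swap : ∀ x y z → x + y + z ≡ x + z + y
    swap x y z = lin [] (x ∷ y ∷ z ∷ []) (λ x y z → ⊢ x :+ y :+ z :≡ x :+ z :+ y) refl

  segment-shift : ∀ t p a → segment (p + t) a ≡ map (_+ t) (segment p a)
  segment-shift t p a = trans (map-≗ (λ i → swap p t (+ i)) (upTo (suc a))) (map-∘ (upTo (suc a)))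

  heights-shift : ∀ t C → heights (shift t C) ≡ map (_+ t) (heights C)
  heights-shift t (p , one a)     = segment-shift t p a
  heights-shift t (p , two c g d) = trans
    (cong₂ _++_ (trans (cong (λ q → segment q c) (swap p t (- + c))) (segment-shift t (p - + c) c))
                (trans (cong (λ q → segment q d) (swap p t (rise g))) (segment-shift t (p + rise g) d)))
    (sym (map-++ (_+ t) (segment (p - + c) c) (segment (p + rise g) d)))

  columnCells-shift : ∀ s t x Cs →
    columnCells (x + s) (map (shift t) Cs) ≡ map (translate (s , t)) (columnCells x Cs)
  columnCells-shift s t x []       = refl
  columnCells-shift s t x (C ∷ Cs) = trans
    (cong₂ _++_
      (trans (cong (map (x + s ,_)) (heights-shift t C))
             (trans (sym (map-∘ (heights C))) (map-∘ (heights C))))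
      (trans (cong (λ z → columnCells z (map (shift t) Cs)) (swap x s 1ℤ))
             (columnCells-shift s t (x + 1ℤ) Cs)))
    (sym (map-++ (translate (s , t)) (map (x ,_) (heights C)) (columnCells (x + 1ℤ) Cs)))

  ∈ᶜ-shift : ∀ t C {y} → y ∈ᶜ C → y + t ∈ᶜ shift t C
  ∈ᶜ-shift t C {y} y∈ = ∈-heights⁻ (shift t C)
    (subst (y + t ∈_) (sym (heights-shift t C)) (∈-map⁺ (_+ t) (∈-heights⁺ C y∈)))

  touches-shift : ∀ t L {a b a′ b′} → a + t ≡ a′ → b + t ≡ b′ →
    Touches L (run a b) → Touches (shift t L) (run a′ b′)
  touches-shift t L refl refl (y , y′ , y∈L , (a≤y′ , y′≤b) , lo , hi) =
    y + t , y′ + t , ∈ᶜ-shift t L y∈L , (ℤ.+-monoˡ-≤ t a≤y′ , ℤ.+-monoˡ-≤ t y′≤b) ,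
    subst (_≤ y′ + t) (swap y (- 1ℤ) t) (ℤ.+-monoˡ-≤ t lo) , ℤ.+-monoˡ-≤ t hi

  attached-shift : ∀ t L C → Attached L C → Attached (shift t L) (shift t C)
  attached-shift t L (p , one a) (touch ∷ []) = touches-shift t L refl (swap p (+ a) t) touch ∷ []
  attached-shift t L (p , two c g d) (touch ∷ touch′ ∷ []) =
    touches-shift t L (swap p (- + c) t) refl touch ∷
    touches-shift t L (swap p (rise g) t)
      (trans (swap (p + rise g) (+ d) t) (cong (_+ + d) (swap p (rise g) t))) touch′ ∷ []

  chain-shift : ∀ t {L Cs} → Chain L Cs → Chain (shift t L) (map (shift t) Cs)
  chain-shift t []                 = []
  chain-shift t (attached ∷ chain) = attached-shift t _ _ attached ∷ chain-shift t chain

  total-shift : ∀ t Cs → total (map (shift t) Cs) ≡ total Cs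
  total-shift t []                     = refl
  total-shift t ((_ , one a) ∷ Cs)     = cong (ℕ._+_ (suc a)) (total-shift t Cs)
  total-shift t ((_ , two c g d) ∷ Cs) = cong (ℕ._+_ (suc c ℕ.+ suc d)) (total-shift t Cs)

  private
    module SetEq = Setoid ([ set ]-Equality Cell)

  -- The translation takes the lowest cell of the first column to the origin. The decomposition
  -- matches `cells P` only as a set; the areas agree because two lists without repetitions and with
  -- the same elements are permutations of each other.
  realise-surjective : ∀ {n} P → Cheesy 2 P → area P ≡ n →
    ∃[ a ] ∃[ Cs ] Σ (Normalised n (a , Cs)) λ norm → realise a Cs (proj₁ norm) ≈ₜ P
  realise-surjective {n} P cheesy area≡n =
    let x , p , a , Cs , chain , Cs∼P = Decomposition.decomposition P cheesy
        Cs₀    = map (shift (- p)) Cs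
        chain₀ = subst (λ z → Chain (z , one a) Cs₀) (ℤ.+-inverseʳ p) (chain-shift (- p) chain)
        translated : map (translate (- x , - p)) (columnCells x ((p , one a) ∷ Cs)) ≡
                     columnCells 0ℤ ((0ℤ , one a) ∷ Cs₀)
        translated = trans (sym (columnCells-shift (- x) (- p) x ((p , one a) ∷ Cs)))
          (cong₂ (λ y z → columnCells y ((z , one a) ∷ Cs₀)) (ℤ.+-inverseʳ x) (ℤ.+-inverseʳ p))
        size : suc a ℕ.+ total Cs ≡ n
        size = trans (sym (length-columnCells x ((p , one a) ∷ Cs))) (trans
          (↭-length (∼bag⇒↭ (unique∧set⇒bag
            (columnCells-unique x ((p , one a) ∷ Cs)) (Polyomino.unique P) Cs∼P)))
          area≡n)
    in a , Cs₀ , (chain₀ , trans (cong (ℕ._+_ (suc a)) (total-shift (- p) Cs)) size) ,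
       ≈ₜ-sym {P} {realise a Cs₀ chain₀} ((- x , - p) , SetEq.trans
         (∼-map (λ _ → refl) (SetEq.sym Cs∼P)) (SetEq.reflexive translated))

-- The bijection with cheesy polyominoes of given area.

module Bijections where

  open Enumerations
  open Counting using (cheesyCount)
  open Chains using (normalised)
  open Realisation
  open Decompositions
  open import Data.Fin using (Fin)
  open import Data.Product using (_,_; proj₁; proj₂)
  open import Relation.Binary.PropositionalEquality using (_≡_; refl; trans)

  countsCheesy : CountsCheesy 2 cheesyCount
  countsCheesy n = record
    { to        = to
    ; cong      = λ { {i} refl → ≈ₜ-refl {proj₁ (to i)} }
    ; bijective =
        (λ {i} {j} eq → injective (realise-injective (proj₁ (sound i)) (proj₁ (sound j)) eq))
      , λ (P , cheesy , area≡n) →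
          let a , Cs , norm , realised = realise-surjective P cheesy area≡n
              i , at-i≡                = complete (a , Cs) norm
          in i , λ { refl → subst-realise {P} {chain = proj₁ norm} realised at-i≡ (proj₁ (sound i)) }
    }
    where
    open Enumeration (normalised n)
    -- The enumeration supplies its own proof that the columns form a chain, which may differ from
    -- the extracted one. `realise` uses this proof only for connectedness, and `≈ₜ` compares cells
    -- only.
    subst-realise : ∀ {P a Cs x chain} → realise a Cs chain ≈ₜ P → x ≡ (a , Cs) →
      ∀ chain′ → realise (proj₁ x) (proj₂ x) chain′ ≈ₜ P
    subst-realise realised refl chain′ = realised
    to : Fin (cheesyCount n) → Σ Polyomino λ P → Cheesy 2 P × area P ≡ n
    to i = let (a , Cs) = at i ; (chain , size) = sound i in
      realise a Cs chain , realise-cheesy a Cs chain , trans (area-realise a Cs chain) size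

open Counting using (cheesyCount)
open GeneratingFunction using (cheesyCount-series)
open Bijections using (countsCheesy)
open import Data.Product using (_,_)

proposition3 : Σ (ℕ → ℕ) λ k → CountsCheesy 2 k × (generatingSeries k ≐ numerator ÷ denominator)
proposition3 = cheesyCount , countsCheesy , cheesyCount-series
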